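{- Let $G_n$ be the $n\times n$ grid graph with vertices $(x,y)$, $1\le x,y\le n$, adjacent iff they differ by $1$ in exactly one coordinate. Let $\mathbb{P}_n$ be the distribution under which $E=(x_E,y_E)$ and $F=(x_F,y_F)$ are two independent uniformly random vertices of $G_n$, and let $G_n'$ be $G_n$ with the edge $e_n=EF$ added. Let ${\rm Gain}'=\max\big(0,\,\big||y_F-y_E|-|x_E-x_F|\big|-1\big)$ and let $\mathcal{C}_n$ be the event "${\rm Gain}'$ is odd or $\min(|x_E-x_F|,|y_E-y_F|)<\frac{{\rm Gain}'}{2}+2$". Then $$\lim_{n\to\infty}\mathbb{P}_n\big(\beta(G_n')\in\{3,4\}\big)=1,\qquad \lim_{n\to\infty}\mathbb{P}_n\big(\beta(G_n')=3 \,\big|\, \mathcal{C}_n\big)=1,\qquad \lim_{n\to\infty}\mathbb{P}_n(\mathcal{C}_n)=\frac{19}{27}.$$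
   Context: For a connected graph $H$, a set $R$ of vertices is resolving if every pair of distinct vertices $A\ne B$ has some $X\in R$ with $d_H(A,X)\ne d_H(B,X)$, where $d_H$ is shortest-path distance; the metric dimension $\beta(H)$ is the minimum size of a resolving set. When $E$ and $F$ coincide or are adjacent (an event of vanishing probability), $G_n'$ is understood to be $G_n$. -}

module Defs where

open import Data.Bool using (Bool; true; false; _∧_; _∨_; if_then_else_; T; not)
open import Data.Nat as ℕ using (ℕ; zero; suc; _+_; _*_; _∸_; _^_; _≥_; ∣_-_∣; _≡ᵇ_; _<ᵇ_; _⊓_; _%_)
open import Data.Fin using (Fin; toℕ)
open import Data.List using (List; []; _∷_; map; concatMap; filter; length; _++_; allFin)
open import Data.Product using (_×_; _,_; ∃-syntax)
open import Data.Integer using (+_)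
import Data.Rational as ℚ
open ℚ using (ℚ; 0ℚ)
open import Data.Bool.ListAction using (any; all)

-- The n×n grid. Coordinates are 0..n-1 (a shift of 1..n, irrelevant
-- since only coordinate differences matter).

V : ℕ → Set
V n = Fin n × Fin n

verts : (n : ℕ) → List (V n)
verts n = concatMap (λ x → map (λ y → (x , y)) (allFin n)) (allFin n)

_==_ : {n : ℕ} → V n → V n → Bool
(x₁ , y₁) == (x₂ , y₂) = (toℕ x₁ ≡ᵇ toℕ x₂) ∧ (toℕ y₁ ≡ᵇ toℕ y₂)

gridAdj : {n : ℕ} → V n → V n → Bool
gridAdj (x₁ , y₁) (x₂ , y₂) =
  ((toℕ x₁ ≡ᵇ toℕ x₂) ∧ (∣ toℕ y₁ - toℕ y₂ ∣ ≡ᵇ 1))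
  ∨ ((toℕ y₁ ≡ᵇ toℕ y₂) ∧ (∣ toℕ x₁ - toℕ x₂ ∣ ≡ᵇ 1))

adj' : {n : ℕ} → V n → V n → V n → V n → Bool
adj' E F A B = gridAdj A B ∨ ((A == E) ∧ (B == F)) ∨ ((A == F) ∧ (B == E))

reach : {n : ℕ} → (V n → V n → Bool) → V n → ℕ → V n → Bool
reach adj A zero    B = A == B
reach {n} adj A (suc k) B =
  reach adj A k B ∨ any (λ C → reach adj A k C ∧ adj C B) (verts n)

search : ℕ → ℕ → (ℕ → Bool) → ℕ
search zero     c p = c
search (suc f)  c p = if p c then c else search f (suc c) p

-- least k ≤ B with p k  (returns suc B if none)
leastUpTo : ℕ → (ℕ → Bool) → ℕ
leastUpTo B p = search (suc B) 0 p

-- shortest-path distance d_H(A,B) (all graphs here are connected with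
-- n*n vertices, so the distance is at most n*n)
dist : {n : ℕ} → (V n → V n → Bool) → V n → V n → ℕ
dist {n} adj A B = leastUpTo (n * n) (λ k → reach adj A k B)

resolves : {n : ℕ} → (V n → V n → Bool) → List (V n) → Bool
resolves {n} adj R =
  all (λ A → all (λ B → (A == B) ∨
         any (λ X → not (dist adj A X ≡ᵇ dist adj B X)) R) (verts n)) (verts n)

subsets : {A : Set} → ℕ → List A → List (List A)
subsets zero    xs       = [] ∷ []
subsets (suc k) []       = []
subsets (suc k) (x ∷ xs) = map (x ∷_) (subsets k xs) ++ subsets (suc k) xs

metricDim : {n : ℕ} → (V n → V n → Bool) → ℕ
metricDim {n} adj = leastUpTo (n * n) (λ k → any (resolves adj) (subsets k (verts n)))

β' : {n : ℕ} → V n → V n → ℕ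
β' E F = metricDim (adj' E F)

dx dy : {n : ℕ} → V n → V n → ℕ
dx (xE , _) (xF , _) = ∣ toℕ xE - toℕ xF ∣
dy (_ , yE) (_ , yF) = ∣ toℕ yF - toℕ yE ∣

gain' : {n : ℕ} → V n → V n → ℕ
gain' E F = ∣ dy E F - dx E F ∣ ∸ 1

-- C_n : Gain' odd, or min(dx,dy) < Gain'/2 + 2  (⇔ 2·min < Gain' + 4)
eventC : {n : ℕ} → V n → V n → Bool
eventC E F = (gain' E F % 2 ≡ᵇ 1)
           ∨ ((2 * (dx E F ⊓ dy E F)) <ᵇ (gain' E F + 4))

eventβ34 : {n : ℕ} → V n → V n → Bool
eventβ34 E F = (β' E F ≡ᵇ 3) ∨ (β' E F ≡ᵇ 4)

eventβ3∧C : {n : ℕ} → V n → V n → Bool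
eventβ3∧C E F = (β' E F ≡ᵇ 3) ∧ eventC E F

countL : {A : Set} → (A → Bool) → List A → ℕ
countL P []       = 0
countL P (x ∷ xs) = (if P x then 1 else 0) + countL P xs

count : (n : ℕ) → (V n → V n → Bool) → ℕ
count n P = sumE (verts n)
  where
  sumE : List (V n) → ℕ
  sumE []       = 0
  sumE (E ∷ Es) = countL (P E) (verts n) + sumE Es

-- a / b as a rational (convention: 0 when b = 0)
ratio : ℕ → ℕ → ℚ
ratio a zero    = 0ℚ
ratio a (suc b) = (+ a) ℚ./ suc b

prob : (n : ℕ) → (V n → V n → Bool) → ℚ
prob n P = ratio (count n P) (n ^ 4)

condProb : (n : ℕ) → (V n → V n → Bool) → (V n → V n → Bool) → ℚ
condProb n P Q = ratio (count n (λ E F → P E F ∧ Q E F)) (count n Q)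

Tendsto : (ℕ → ℚ) → ℚ → Set
Tendsto f L = ∀ (ε : ℚ) → 0ℚ ℚ.< ε → ∃[ N ] ∀ (n : ℕ) → n ≥ N → ℚ.∣ f n ℚ.- L ∣ ℚ.< ε

{-# OPTIONS --safe #-}
module Submission where

-- Let d be the grid distance. The distance from P to X in the new graph is the minimum of d(P,X),
-- d(P,E) + 1 + d(F,X) and d(P,F) + 1 + d(E,X). The symmetries of the grid reduce everything to
-- E = (a , b) and F = (a + p , b + q) with p < q.
--
-- Upper bound. A landmark whose distances to E and F differ by at most 1 never profits from the edge.
-- If the gain is odd, 2k + 1, the row s = b + p + 1 + k makes (0 , s) such a landmark; the edge closes an odd
-- cycle, so parity tells which vertices are reached through the edge, and (0 , s), (n - 1 , s), (0 , 0) resolve.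
-- If the gain is even, 2k, put t = b + k + 1. The landmarks (0 , t + p) and (n - 1 , t) never profit, and
-- they leave essentially only pairs on a common diagonal between the rows t and t + p. Towards (0 , t) no vertex
-- between these rows profits if p ≤ k + 1, which is the second alternative of the event C; in general
-- (0 , t) and (n - 1 , t + p) together separate these pairs.
--
-- Lower bound. Two landmarks are confused by neighbours of F if one of them gains at least 2 at F, and by
-- the neighbours of a corner unless one of them lies on a side at this corner, but not in it. This leaves
-- landmarks on opposite sides, where two neighbours of one landmark are confused.
--
-- Counting. Up to O(n³) pairs, a unit shift of E changes the parity of the gain but not the truth of
-- 3 min < max, hence 2 #C ≈ n⁴ + #(3 min < max), and the latter is (11/27) n⁴ up to O(n³).

open import Defs
open import Data.Bool using (Bool; true; false; _∧_; _∨_; if_then_else_; T; not)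
open import Data.Bool.ListAction using (any)
open import Data.Bool.Properties using (T-∧; T-∨; T?)
open import Data.Empty using (⊥; ⊥-elim)
open import Data.Fin as Fin using (Fin; zero; suc; toℕ; inject₁; fromℕ; fromℕ<; opposite)
import Data.Fin.Properties as Finₚ
open import Data.List as List using (List; []; _∷_; concatMap; length; tabulate; allFin; _++_)
open import Data.List.Membership.Propositional using (_∈_; lose; find)
import Data.List.Membership.Propositional.Properties as ∈ₚ
import Data.List.Properties as Listₚ
open import Data.List.Relation.Unary.All as All using (All; []; _∷_)
import Data.List.Relation.Unary.All.Properties as Allₚ
open import Data.List.Relation.Unary.Any using (here; there)
import Data.List.Relation.Unary.Any.Properties as Anyₚ
open import Data.Nat as ℕ using (ℕ; zero; suc; _+_; _*_; _∸_; _^_; _≤_; _<_; _≥_; _≡ᵇ_; _<ᵇ_; _≤ᵇ_; _⊓_; ∣_-_∣; z≤n; s≤s; _%_)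
import Data.Nat.DivMod as DivMod
import Data.Nat.Properties as ℕₚ
open import Data.Nat.Tactic.RingSolver using (solve-∀)
open import Data.Product using (_×_; _,_; proj₁; proj₂; ∃; ∃-syntax; swap)
open import Data.Sum using (_⊎_; inj₁; inj₂; [_,_]′)
open import Data.Unit using (⊤; tt)
open import Data.Vec as Vec using (Vec; []; _∷_)
open import Function using (_∘_; id)
open import Function.Bundles using (module Equivalence)
open import Relation.Binary.Definitions using (tri<; tri≈; tri>)
open import Relation.Binary.PropositionalEquality
open import Relation.Nullary using (¬_; yes; no; Dec)

-- Grid distances are sums of absolute differences, and `D` is a minimum of such sums. In
-- coordinates every geometric step is therefore a quantifier-free formula of linear arithmetic with
-- very many sign cases. This is why a verified refutation procedure stands at the beginning.
-- Rational elimination alone cannot express the parity arguments, so it also tests equations modulo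
-- 2.
--
-- For even gain the event asks for `2 * min < gain + 4`, that is `3 * min < max + 3`; up to bounded
-- shifts this is the `3 min < max` of the count. In the limit a normalised coordinate difference
-- has density 2(1 - x), and one difference exceeds three times the other, in a given order, with
-- probability equal to the integral of 2(1 - x)(1 - 3x)² over [0, 1/3], which is 11/54. Twice this
-- is 11/27, and (1 + 11/27)/2 = 19/27.
--
-- Matching `a` with `a + 1` requires an even side length and the exact summation one divisible by
-- 3. Hence the count is done for multiples of 6 and carried to all `n` by monotonicity.

private
  variable
    m n w : ℕ

-- Linear arithmetic over ℕ by reflection

module LinearArithmetic where

  open import Data.Integer as ℤ using (ℤ; +_; -[1+_]; 0ℤ; 1ℤ; -1ℤ)
  open import Data.Integer.Divisibility.Signed using (_∣_; _∣?_; divides; ∣m∣n⇒∣m+n; ∣m+n∣n⇒∣m; ∣m⇒∣m*n)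
  import Data.Integer.Properties as ℤₚ
  open import Data.Integer.Tactic.RingSolver renaming (solve-∀ to solve-∀ᶻ) using ()
  open import Data.Maybe using (Maybe; just; nothing)
  open import Data.Vec using (lookup; replicate; _[_]≔_)
  open import Data.Vec.N-ary using (N-ary; _$ⁿ_)
  open import Relation.Nullary.Decidable using (⌊_⌋; _×-dec_; _⊎-dec_; _→-dec_; decidable-stable)

  infix  30 ∣_:-_∣
  infixl 28 _:*_
  infixl 27 _:+_
  infixl 28 _:⊓_
  infix  24 _:≤_ _:≡_ _:<_
  infixr 23 _:∧_
  infixr 22 _:∨_
  infixr 21 _:⇒_

  -- Syntax and meaning of the formulas

  data Tm (n : ℕ) : Set where
    var    : Fin n → Tm n
    con    : ℕ → Tm n
    _:+_   : Tm n → Tm n → Tm n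
    _:*_   : ℕ → Tm n → Tm n
    ∣_:-_∣ : Tm n → Tm n → Tm n
    _:⊓_   : Tm n → Tm n → Tm n

  data Fm (n : ℕ) : Set where
    :⊥             : Fm n
    _:≤_ _:≡_      : Tm n → Tm n → Fm n
    _:∧_ _:∨_ _:⇒_ : Fm n → Fm n → Fm n

  _:<_ : Tm n → Tm n → Fm n
  s :< t = con 1 :+ s :≤ t

  ⟦_⟧ : Tm n → Vec ℕ n → ℕ
  ⟦ var i ⟧      ρ = lookup ρ i
  ⟦ con k ⟧      ρ = k
  ⟦ s :+ t ⟧     ρ = ⟦ s ⟧ ρ + ⟦ t ⟧ ρ
  ⟦ k :* t ⟧     ρ = k * ⟦ t ⟧ ρ
  ⟦ ∣ s :- t ∣ ⟧ ρ = ∣ ⟦ s ⟧ ρ - ⟦ t ⟧ ρ ∣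
  ⟦ s :⊓ t ⟧     ρ = ⟦ s ⟧ ρ ⊓ ⟦ t ⟧ ρ

  _⊨_ : Vec ℕ n → Fm n → Set
  ρ ⊨ :⊥       = ⊥
  ρ ⊨ (s :≤ t) = ⟦ s ⟧ ρ ≤ ⟦ t ⟧ ρ
  ρ ⊨ (s :≡ t) = ⟦ s ⟧ ρ ≡ ⟦ t ⟧ ρ
  ρ ⊨ (φ :∧ ψ) = ρ ⊨ φ × ρ ⊨ ψ
  ρ ⊨ (φ :∨ ψ) = ρ ⊨ φ ⊎ ρ ⊨ ψ
  ρ ⊨ (φ :⇒ ψ) = ρ ⊨ φ → ρ ⊨ ψ

  ⊨-dec : (ρ : Vec ℕ n) (φ : Fm n) → Dec (ρ ⊨ φ)
  ⊨-dec ρ :⊥       = no λ ()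
  ⊨-dec ρ (s :≤ t) = _ ℕₚ.≤? _
  ⊨-dec ρ (s :≡ t) = _ ℕₚ.≟ _
  ⊨-dec ρ (φ :∧ ψ) = ⊨-dec ρ φ ×-dec ⊨-dec ρ ψ
  ⊨-dec ρ (φ :∨ ψ) = ⊨-dec ρ φ ⊎-dec ⊨-dec ρ ψ
  ⊨-dec ρ (φ :⇒ ψ) = ⊨-dec ρ φ →-dec ⊨-dec ρ ψ

  -- The head coefficient of a linear form is its constant term.
  Lin : ℕ → Set
  Lin n = Vec ℤ (suc n)

  dot : Vec ℤ m → Vec ℕ m → ℤ
  dot []       []       = 0ℤ
  dot (c ∷ cs) (x ∷ xs) = c ℤ.* + x ℤ.+ dot cs xs

  value : Vec ℕ n → Lin n → ℤ
  value ρ f = dot f (1 ∷ ρ)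

  infixl 6 _⊞_
  _⊞_ : Vec ℤ m → Vec ℤ m → Vec ℤ m
  []       ⊞ []       = []
  (c ∷ cs) ⊞ (d ∷ ds) = (c ℤ.+ d) ∷ (cs ⊞ ds)

  infixl 7 _⊠_
  _⊠_ : ℤ → Vec ℤ m → Vec ℤ m
  k ⊠ []       = []
  k ⊠ (c ∷ cs) = (k ℤ.* c) ∷ (k ⊠ cs)

  infixl 6 _⊟_
  _⊟_ : Vec ℤ m → Vec ℤ m → Vec ℤ m
  f ⊟ g = f ⊞ (-1ℤ ⊠ g)

  const : ℤ → Lin n
  const c = c ∷ replicate _ 0ℤ

  unit : Fin m → Vec ℤ m
  unit zero    = 1ℤ ∷ replicate _ 0ℤ
  unit (suc i) = 0ℤ ∷ unit i

  dot-⊞ : (f g : Vec ℤ m) (xs : Vec ℕ m) → dot (f ⊞ g) xs ≡ dot f xs ℤ.+ dot g xs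
  dot-⊞ []       []       []       = refl
  dot-⊞ (c ∷ cs) (d ∷ ds) (x ∷ xs) =
    trans (cong (ℤ._+_ ((c ℤ.+ d) ℤ.* + x)) (dot-⊞ cs ds xs)) (shuffle c d (+ x) _ _)
    where
    shuffle : ∀ c d x a b → (c ℤ.+ d) ℤ.* x ℤ.+ (a ℤ.+ b) ≡ (c ℤ.* x ℤ.+ a) ℤ.+ (d ℤ.* x ℤ.+ b)
    shuffle = solve-∀ᶻ

  dot-⊠ : ∀ k (f : Vec ℤ m) xs → dot (k ⊠ f) xs ≡ k ℤ.* dot f xs
  dot-⊠ k []       []       = sym (ℤₚ.*-zeroʳ k)
  dot-⊠ k (c ∷ cs) (x ∷ xs) = trans (cong (ℤ._+_ (k ℤ.* c ℤ.* + x)) (dot-⊠ k cs xs)) (shuffle k c (+ x) _)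
    where
    shuffle : ∀ k c x a → k ℤ.* c ℤ.* x ℤ.+ k ℤ.* a ≡ k ℤ.* (c ℤ.* x ℤ.+ a)
    shuffle = solve-∀ᶻ

  dot-⊟ : (f g : Vec ℤ m) (xs : Vec ℕ m) → dot (f ⊟ g) xs ≡ dot f xs ℤ.- dot g xs
  dot-⊟ f g xs = trans (dot-⊞ f (-1ℤ ⊠ g) xs)
    (cong (ℤ._+_ (dot f xs)) (trans (dot-⊠ -1ℤ g xs) (ℤₚ.-1*i≡-i _)))

  dot-0 : (xs : Vec ℕ m) → dot (replicate m 0ℤ) xs ≡ 0ℤ
  dot-0 []       = refl
  dot-0 (x ∷ xs) = trans (cong (ℤ._+_ (0ℤ ℤ.* + x)) (dot-0 xs)) refl

  dot-unit : (i : Fin m) (xs : Vec ℕ m) → dot (unit i) xs ≡ + lookup xs i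
  dot-unit zero    (x ∷ xs) = trans (cong (ℤ._+_ (1ℤ ℤ.* + x)) (dot-0 xs))
                                    (trans (ℤₚ.+-identityʳ _) (ℤₚ.*-identityˡ _))
  dot-unit (suc i) (x ∷ xs) = trans (ℤₚ.+-identityˡ _) (dot-unit i xs)

  value-const : ∀ c (ρ : Vec ℕ n) → value ρ (const c) ≡ c
  value-const c ρ = trans (cong (ℤ._+_ (c ℤ.* 1ℤ)) (dot-0 ρ))
                          (trans (ℤₚ.+-identityʳ _) (ℤₚ.*-identityʳ c))

  data Con (n : ℕ) : Set where
    ≥0 =0 : Lin n → Con n

  Nonneg : Vec ℕ n → Lin n → Set
  Nonneg ρ f = 0ℤ ℤ.≤ value ρ f

  Zero : Vec ℕ n → Lin n → Set
  Zero ρ f = value ρ f ≡ 0ℤ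

  Sat : Vec ℕ n → Con n → Set
  Sat ρ (≥0 f) = Nonneg ρ f
  Sat ρ (=0 f) = Zero ρ f

  nonpos? : ℤ → Bool
  nonpos? (+ zero)  = true
  nonpos? (+ suc _) = false
  nonpos? -[1+ _ ]  = true

  allᵥ : (ℤ → Bool) → Vec ℤ m → Bool
  allᵥ p []       = true
  allᵥ p (c ∷ cs) = if p c then allᵥ p cs else false

  absurd? : Lin n → Bool
  absurd? (+ _      ∷ cs) = false
  absurd? (-[1+ _ ] ∷ cs) = allᵥ nonpos? cs

  dot-nonpos : (cs : Vec ℤ m) (xs : Vec ℕ m) → T (allᵥ nonpos? cs) → dot cs xs ℤ.≤ 0ℤ
  dot-nonpos []               []       _ = ℤₚ.≤-refl
  dot-nonpos (+ zero   ∷ cs) (x ∷ xs) t =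
    subst (ℤ._≤ 0ℤ) (sym (ℤₚ.+-identityˡ _)) (dot-nonpos cs xs t)
  dot-nonpos (-[1+ k ] ∷ cs) (x ∷ xs) t = ℤₚ.+-mono-≤ {x = -[1+ k ] ℤ.* + x} {y = 0ℤ}
    (subst ((-[1+ k ] ℤ.* (+ x)) ℤ.≤_) (ℤₚ.*-zeroʳ -[1+ k ])
      (ℤₚ.*-monoˡ-≤-nonPos -[1+ k ] (ℤ.+≤+ (z≤n {x}))))
    (dot-nonpos cs xs t)

  absurd-sound : (ρ : Vec ℕ n) (f : Lin n) → T (absurd? f) → ¬ Nonneg ρ f
  absurd-sound ρ (-[1+ k ] ∷ cs) t h with () ← ℤₚ.≤-trans h
    (ℤₚ.+-mono-≤ {x = -[1+ k ] ℤ.* 1ℤ} (ℤₚ.≤-reflexive (ℤₚ.*-identityʳ -[1+ k ])) (dot-nonpos cs ρ t))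

  nonneg-unit : (ρ : Vec ℕ n) (i : Fin n) → Nonneg ρ (unit (suc i))
  nonneg-unit ρ i = subst (0ℤ ℤ.≤_) (sym (dot-unit (suc i) (1 ∷ ρ))) (ℤ.+≤+ z≤n)

  even? : ℤ → Bool
  even? c = ⌊ + 2 ∣? c ⌋

  -- Modulo 2 such an equation reads 1 = 0. Apart from reading `<` as a gap of at least 1, this is
  -- where integrality enters the procedure.
  unbalanced? : Lin n → Bool
  unbalanced? (c ∷ cs) = if even? c then false else allᵥ even? cs

  dot-even : (cs : Vec ℤ m) (xs : Vec ℕ m) → T (allᵥ even? cs) → + 2 ∣ dot cs xs
  dot-even []       []       _ = divides 0ℤ refl
  dot-even (c ∷ cs) (x ∷ xs) t with + 2 ∣? c
  ... | yes 2∣c = ∣m∣n⇒∣m+n (∣m⇒∣m*n (+ x) 2∣c) (dot-even cs xs t)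

  unbalanced-sound : (ρ : Vec ℕ n) (e : Lin n) → T (unbalanced? e) → ¬ Zero ρ e
  unbalanced-sound ρ (c ∷ cs) t z with + 2 ∣? c
  ... | no 2∤c = 2∤c (subst (+ 2 ∣_) (ℤₚ.*-identityʳ c)
    (∣m+n∣n⇒∣m {n = dot cs ρ} (subst (+ 2 ∣_) (sym z) (divides 0ℤ refl)) (dot-even cs ρ t)))

  -- A simplex tableau in dictionary form: the coordinates and all rows are nonnegative.
  -- A violated row becomes a coordinate in exchange for one in which it increases,
  -- and a row with negative constant term and no positive coefficient is a contradiction.
  -- The field transform rewrites a form in the original variables, up to a positive factor.
  -- The field reduce substitutes monic equations only; it keeps the original variables,
  -- so that an equation that it makes odd has no integer solution.
  record Tableau (n : ℕ) : Set where
    constructor tableau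
    field
      reduce    : Lin n → Lin n
      transform : Lin n → Lin n
      rows      : List (Lin n)

  record Models (ρ : Vec ℕ n) (t : Tableau n) : Set where
    constructor models
    open Tableau t
    field
      point  : Vec ℕ n
      same   : ∀ f → value ρ (reduce f) ≡ value ρ f
      nonneg : ∀ f → Nonneg ρ f → Nonneg point (transform f)
      zeros  : ∀ f → Zero ρ f → Zero point (transform f)
      sat    : All (Nonneg point) rows

  -- The first clause is only a shortcut for the most frequent case.
  fused : ℤ → ℤ → ℤ → ℤ → ℤ
  fused (+ 1) b (+ 0) g = g
  fused a     b f     g = a ℤ.* g ℤ.- b ℤ.* f

  fused-≡ : ∀ a b f g → fused a b f g ≡ a ℤ.* g ℤ.- b ℤ.* f
  fused-≡ (+ 0)           b f          g = refl
  fused-≡ (+ 1)           b (+ 0)      g = sym (trans (cong₂ ℤ._-_ (ℤₚ.*-identityˡ g) (ℤₚ.*-zeroʳ b)) (ℤₚ.+-identityʳ g))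
  fused-≡ (+ 1)           b (+ suc _)  g = refl
  fused-≡ (+ 1)           b -[1+ _ ]   g = refl
  fused-≡ (+ suc (suc _)) b f          g = refl
  fused-≡ -[1+ _ ]        b f          g = refl

  fusedRow : ℤ → ℤ → Vec ℤ m → Vec ℤ m → Vec ℤ m
  fusedRow a b []       []       = []
  fusedRow a b (f ∷ fs) (g ∷ gs) = fused a b f g ∷ fusedRow a b fs gs

  dot-fusedRow : ∀ a b (fs gs : Vec ℤ m) xs → dot (fusedRow a b fs gs) xs ≡ a ℤ.* dot gs xs ℤ.- b ℤ.* dot fs xs
  dot-fusedRow a b []       []       []       = sym (trans (cong₂ ℤ._-_ (ℤₚ.*-zeroʳ a) (ℤₚ.*-zeroʳ b)) refl)
  dot-fusedRow a b (f ∷ fs) (g ∷ gs) (x ∷ xs) =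
    trans (cong₂ (λ u v → u ℤ.* + x ℤ.+ v) (fused-≡ a b f g) (dot-fusedRow a b fs gs xs)) (shuffle a b f g (+ x) _ _)
    where
    shuffle : ∀ a b f g x u v → (a ℤ.* g ℤ.- b ℤ.* f) ℤ.* x ℤ.+ (a ℤ.* u ℤ.- b ℤ.* v) ≡
      a ℤ.* (g ℤ.* x ℤ.+ u) ℤ.- b ℤ.* (f ℤ.* x ℤ.+ v)
    shuffle = solve-∀ᶻ

  -- A fraction-free pivot step: `g` is multiplied by the pivot entry `a` of `f`, and coordinate `j`
  -- is eliminated with the help of `f`. Column `j` then belongs to the value of `f`; its entry `b′`
  -- is `b` for an inequality and 0 for an equation.
  exchange : Fin m → (a b b′ : ℤ) → Vec ℤ m → Vec ℤ m → Vec ℤ m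
  exchange zero    a b b′ (_ ∷ fs) (_ ∷ gs) = b′ ∷ fusedRow a b fs gs
  exchange (suc j) a b b′ (f ∷ fs) (g ∷ gs) = fused a b f g ∷ exchange j a b b′ fs gs

  dot-exchange : (j : Fin m) (b′ : ℤ) (f g : Vec ℤ m) (xs : Vec ℕ m) (s : ℕ) →
    dot (exchange j (lookup f j) (lookup g j) b′ f g) (xs [ j ]≔ s)
      ≡ lookup f j ℤ.* dot g xs ℤ.- lookup g j ℤ.* dot f xs ℤ.+ b′ ℤ.* + s
  dot-exchange zero    b′ (a ∷ fs) (b ∷ gs) (x ∷ xs) s =
    trans (cong (ℤ._+_ (b′ ℤ.* + s)) (dot-fusedRow a b fs gs xs)) (shuffle a b (b′ ℤ.* + s) (+ x) _ _)
    where
    shuffle : ∀ a b c x u v → c ℤ.+ (a ℤ.* u ℤ.- b ℤ.* v) ≡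
      a ℤ.* (b ℤ.* x ℤ.+ u) ℤ.- b ℤ.* (a ℤ.* x ℤ.+ v) ℤ.+ c
    shuffle = solve-∀ᶻ
  dot-exchange (suc j) b′ (f ∷ fs) (g ∷ gs) (x ∷ xs) s =
    trans (cong₂ (λ u v → u ℤ.* + x ℤ.+ v) (fused-≡ a b f g) (dot-exchange j b′ fs gs xs s))
          (shuffle a b f g (+ x) _ _ (b′ ℤ.* + s))
    where
    a = lookup fs j
    b = lookup gs j
    shuffle : ∀ a b f g x u v c → (a ℤ.* g ℤ.- b ℤ.* f) ℤ.* x ℤ.+ (a ℤ.* u ℤ.- b ℤ.* v ℤ.+ c) ≡
      a ℤ.* (g ℤ.* x ℤ.+ u) ℤ.- b ℤ.* (f ℤ.* x ℤ.+ v) ℤ.+ c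
    shuffle = solve-∀ᶻ

  dot-update : (j : Fin m) (g : Vec ℤ m) (xs : Vec ℕ m) (s : ℕ) → lookup g j ≡ 0ℤ → dot g (xs [ j ]≔ s) ≡ dot g xs
  dot-update zero    (_ ∷ gs) (x ∷ xs) s refl = refl
  dot-update (suc j) (g ∷ gs) (x ∷ xs) s h    = cong (ℤ._+_ (g ℤ.* + x)) (dot-update j gs xs s h)

  rewriteRow : Fin n → (ℤ → ℤ) → Lin n → Lin n → Lin n
  rewriteRow j keep f g with lookup g (suc j)
  ... | + 0 = g
  ... | b   = exchange (suc j) (lookup f (suc j)) b (keep b) f g

  nonneg? : ℤ → Bool
  nonneg? (+ _)    = true
  nonneg? -[1+ _ ] = false

  -- Rows without negative entries follow from the nonnegativity of the coordinates.
  prune : List (Lin n) → List (Lin n)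
  prune []       = []
  prune (f ∷ fs) = if allᵥ nonneg? f then prune fs else f ∷ prune fs

  prune-sound : {P : Lin n → Set} (fs : List (Lin n)) → All P fs → All P (prune fs)
  prune-sound []       []       = []
  prune-sound (f ∷ fs) (h ∷ hs) with allᵥ nonneg? f
  ... | true  = prune-sound fs hs
  ... | false = h ∷ prune-sound fs hs

  pivotOn : Fin n → (ℤ → ℤ) → Lin n → Tableau n → Tableau n
  pivotOn j keep f (tableau rd tr rs) =
    -- The eliminated coordinate turns into a row, because its nonnegativity is no longer implicit.
    tableau rd (λ g → rewriteRow j keep f (tr g)) (prune (List.map (rewriteRow j keep f) (unit (suc j) ∷ rs)))

  -- The new value s of the exchanged coordinate is f; for an equation it is 0, and then its coefficient may be dropped.
  rewriteRow-value : (j : Fin n) (keep : ℤ → ℤ) (f g : Lin n) (xs : Vec ℕ n) (s : ℕ) →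
    value xs f ≡ + s → (∀ b → keep b ℤ.* + s ≡ b ℤ.* + s) →
    ∃ λ c → ((c ≡ 1ℤ) ⊎ (c ≡ lookup f (suc j))) × value (xs [ j ]≔ s) (rewriteRow j keep f g) ≡ c ℤ.* value xs g
  rewriteRow-value j keep f g xs s hf hk with lookup g (suc j) in eq
  ... | + 0       = 1ℤ , inj₁ refl , trans (dot-update (suc j) g (1 ∷ xs) s eq) (sym (ℤₚ.*-identityˡ _))
  ... | + suc k   = _ , inj₂ refl , general (+ suc k) eq
    where
    general : ∀ b → lookup g (suc j) ≡ b → value (xs [ j ]≔ s) (exchange (suc j) (lookup f (suc j)) b (keep b) f g)
      ≡ lookup f (suc j) ℤ.* value xs g
    general b refl = trans (dot-exchange (suc j) (keep b) f g (1 ∷ xs) s)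
      (trans (cong₂ (λ u v → lookup f (suc j) ℤ.* value xs g ℤ.- b ℤ.* u ℤ.+ v) hf (hk b)) (cancel _ _))
      where
      cancel : ∀ x y → x ℤ.- y ℤ.+ y ≡ x
      cancel = solve-∀ᶻ
  ... | -[1+ k ]  = _ , inj₂ refl , general -[1+ k ] eq
    where
    general : ∀ b → lookup g (suc j) ≡ b → value (xs [ j ]≔ s) (exchange (suc j) (lookup f (suc j)) b (keep b) f g)
      ≡ lookup f (suc j) ℤ.* value xs g
    general b refl = trans (dot-exchange (suc j) (keep b) f g (1 ∷ xs) s)
      (trans (cong₂ (λ u v → lookup f (suc j) ℤ.* value xs g ℤ.- b ℤ.* u ℤ.+ v) hf (hk b)) (cancel _ _))
      where
      cancel : ∀ x y → x ℤ.- y ℤ.+ y ≡ x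
      cancel = solve-∀ᶻ

  scale-nonneg : ∀ {c x} → (c ≡ 1ℤ) ⊎ (∃ λ k → c ≡ + k) → 0ℤ ℤ.≤ x → 0ℤ ℤ.≤ c ℤ.* x
  scale-nonneg {x = x} (inj₁ refl) h = subst (0ℤ ℤ.≤_) (sym (ℤₚ.*-identityˡ x)) h
  scale-nonneg {x = x} (inj₂ (k , refl)) h = subst (ℤ._≤ (+ k) ℤ.* x) (ℤₚ.*-zeroʳ (+ k)) (ℤₚ.*-monoˡ-≤-nonNeg (+ k) h)

  pivotOn-sound : (ρ : Vec ℕ n) (j : Fin n) (keep : ℤ → ℤ) (f : Lin n) (t : Tableau n) (M : Models ρ t) (s k : ℕ) →
    lookup f (suc j) ≡ + k → value (Models.point M) f ≡ + s → (∀ b → keep b ℤ.* + s ≡ b ℤ.* + s) →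
    Models ρ (pivotOn j keep f t)
  pivotOn-sound ρ j keep f t (models ys sm nn zs hs) s k hj hf hk = models (ys [ j ]≔ s) sm
    (λ g hg → preserve (Tableau.transform t g) (nn g hg))
    (λ g hg → let c , _ , eq = rewriteRow-value j keep f (Tableau.transform t g) ys s hf hk in
      trans eq (trans (cong (c ℤ.*_) (zs g hg)) (ℤₚ.*-zeroʳ c)))
    (prune-sound _ (Allₚ.map⁺ {xs = unit (suc j) ∷ Tableau.rows t} {f = rewriteRow j keep f}
      (preserve (unit (suc j)) (nonneg-unit ys j) ∷ All.map (λ {g} → preserve g) hs)))
    where
    preserve : ∀ g → Nonneg ys g → Nonneg (ys [ j ]≔ s) (rewriteRow j keep f g)
    preserve g hg with rewriteRow-value j keep f g ys s hf hk
    ... | c , inj₁ c≡1 , eq = subst (0ℤ ℤ.≤_) (sym eq) (scale-nonneg {c} (inj₁ c≡1) hg)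
    ... | c , inj₂ c≡a , eq = subst (0ℤ ℤ.≤_) (sym eq) (scale-nonneg {c} (inj₂ (k , trans c≡a hj)) hg)

  increasing : Vec ℤ m → Maybe (Fin m)
  increasing []             = nothing
  increasing (+ suc _ ∷ cs) = just zero
  increasing (_       ∷ cs) with increasing cs
  ... | nothing = nothing
  ... | just j  = just (suc j)

  violated : List (Lin n) → Maybe (Lin n × List (Lin n))
  violated []                      = nothing
  violated ((-[1+ k ] ∷ cs) ∷ fs)  = just (-[1+ k ] ∷ cs , fs)
  violated (f ∷ fs) with violated fs
  ... | nothing       = nothing
  ... | just (g , gs) = just (g , f ∷ gs)

  violated-sound : (P : Lin n → Set) (fs : List (Lin n)) {g : Lin n} {gs : List (Lin n)} →
    violated fs ≡ just (g , gs) → All P fs → P g × All P gs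
  violated-sound P ((-[1+ k ] ∷ cs) ∷ fs) refl (h ∷ hs) = h , hs
  violated-sound P ((+ k ∷ cs) ∷ fs) eq (h ∷ hs) with violated fs in eq′
  violated-sound P ((+ k ∷ cs) ∷ fs) refl (h ∷ hs) | just (g , gs) =
    let hg , hgs = violated-sound P fs eq′ hs in hg , h ∷ hgs

  -- The fuel bounds the number of pivots; when it runs out the tableau is merely treated as feasible.
  repair : ℕ → Tableau n → Maybe (Tableau n)
  repair zero    t = just t
  repair (suc k) (tableau rd tr rs) with violated rs
  ... | nothing = just (tableau rd tr rs)
  ... | just (f , fs) with absurd? f | increasing (Vec.tail f)
  ...   | true  | _      = nothing
  ...   | false | nothing = just (tableau rd tr rs)
  ...   | false | just j  = repair k (pivotOn j id f (tableau rd tr fs))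

  Result : Vec ℕ n → Maybe (Tableau n) → Set
  Result ρ nothing  = ⊥
  Result ρ (just t) = Models ρ t

  increasing-positive : (cs : Vec ℤ m) {j : Fin m} → increasing cs ≡ just j → ∃ λ k → lookup cs j ≡ + k
  increasing-positive (+ suc k ∷ cs) refl = _ , refl
  increasing-positive (+ zero ∷ cs) eq with increasing cs in eq′
  increasing-positive (+ zero ∷ cs) refl | just j = increasing-positive cs eq′
  increasing-positive (-[1+ _ ] ∷ cs) eq with increasing cs in eq′
  increasing-positive (-[1+ _ ] ∷ cs) refl | just j = increasing-positive cs eq′

  repair-sound : (ρ : Vec ℕ n) (k : ℕ) (t : Tableau n) → Models ρ t → Result ρ (repair k t)
  repair-sound ρ zero    t M = M
  repair-sound ρ (suc k) (tableau rd tr rs) M with violated rs in eq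
  ... | nothing = M
  ... | just (f , fs) with absurd? f in eqa | increasing (Vec.tail f) in eqj
  ...   | true  | _      = absurd-sound (Models.point M) f (subst T (sym eqa) tt)
                             (proj₁ (violated-sound _ rs eq (Models.sat M)))
  ...   | false | nothing = M
  ...   | false | just j  with violated-sound _ rs eq (Models.sat M) | increasing-positive (Vec.tail f) eqj
  ...     | hf , hfs | a , hj = repair-sound ρ k _ (pivotOn-sound ρ j id f (tableau rd tr fs)
              (models (Models.point M) (Models.same M) (Models.nonneg M) (Models.zeros M) hfs) ℤ.∣ value (Models.point M) f ∣ a
              (trans (lookup-tail f j) hj) (sym (ℤₚ.0≤i⇒+∣i∣≡i hf)) (λ _ → refl))
    where
    lookup-tail : ∀ (f : Lin _) j → lookup f (suc j) ≡ lookup (Vec.tail f) j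
    lookup-tail (_ ∷ _) j = refl

  monic : Vec ℤ m → Maybe (Fin m × Bool)
  monic []              = nothing
  monic (+ 1      ∷ cs) = just (zero , true)
  monic (-[1+ 0 ] ∷ cs) = just (zero , false)
  monic (_        ∷ cs) with monic cs
  ... | nothing      = nothing
  ... | just (j , b) = just (suc j , b)

  fuel : ℕ
  fuel = 40

  -- The coefficient of `e` at `j` will be 1 or -1, hence its own inverse; multiplying by it instead
  -- of dividing clears column `j` of `f`.
  substitute : Fin n → Lin n → Lin n → Lin n
  substitute j e f with lookup f (suc j)
  ... | + 0 = f
  ... | c   = f ⊟ (c ℤ.* lookup e (suc j)) ⊠ e

  learn : Lin n → (Lin n → Lin n) → Lin n → Lin n
  learn e rd with monic (Vec.tail e)
  ... | just (j , _) = substitute j e ∘ rd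
  ... | nothing      = rd

  pivotZero : Lin n → Tableau n → Tableau n
  pivotZero f t with monic (Vec.tail f)
  ... | just (j , true)  = pivotOn j (λ _ → 0ℤ) f t
  ... | just (j , false) = pivotOn j (λ _ → 0ℤ) (-1ℤ ⊠ f) t
  ... | nothing          = tableau (Tableau.reduce t) (Tableau.transform t) (f ∷ (-1ℤ ⊠ f) ∷ Tableau.rows t)

  assert : Con n → Tableau n → Maybe (Tableau n)
  assert (≥0 f) (tableau rd tr rs) = repair fuel (tableau rd tr (tr f ∷ rs))
  assert (=0 e) (tableau rd tr rs) =
    if unbalanced? (rd e) then nothing else repair fuel (pivotZero (tr e) (tableau (learn (rd e) rd) tr rs))

  monic-coefficient : (cs : Vec ℤ m) {j : Fin m} {b : Bool} → monic cs ≡ just (j , b) →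
    lookup (if b then cs else -1ℤ ⊠ cs) j ≡ 1ℤ
  monic-coefficient (+ 1 ∷ cs) refl = refl
  monic-coefficient (-[1+ 0 ] ∷ cs) refl = refl
  monic-coefficient (+ 0 ∷ cs) eq with monic cs in eq′
  monic-coefficient (+ 0 ∷ cs) refl | just (j , true)  = monic-coefficient cs eq′
  monic-coefficient (+ 0 ∷ cs) refl | just (j , false) = monic-coefficient cs eq′
  monic-coefficient (+ suc (suc _) ∷ cs) eq with monic cs in eq′
  monic-coefficient (+ suc (suc _) ∷ cs) refl | just (j , true)  = monic-coefficient cs eq′
  monic-coefficient (+ suc (suc _) ∷ cs) refl | just (j , false) = monic-coefficient cs eq′
  monic-coefficient (-[1+ suc _ ] ∷ cs) eq with monic cs in eq′
  monic-coefficient (-[1+ suc _ ] ∷ cs) refl | just (j , true)  = monic-coefficient cs eq′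
  monic-coefficient (-[1+ suc _ ] ∷ cs) refl | just (j , false) = monic-coefficient cs eq′

  zero-negate : (xs : Vec ℕ n) (f : Lin n) → Zero xs f → Zero xs (-1ℤ ⊠ f)
  zero-negate xs f z = trans (dot-⊠ -1ℤ f (1 ∷ xs)) (cong (-1ℤ ℤ.*_) z)

  substitute-value : (ρ : Vec ℕ n) (j : Fin n) (e f : Lin n) → Zero ρ e → value ρ (substitute j e f) ≡ value ρ f
  substitute-value ρ j e f z with lookup f (suc j)
  ... | + 0      = refl
  ... | + suc k  = cancel (+ suc k ℤ.* lookup e (suc j))
    where
    cancel : ∀ c → value ρ (f ⊟ c ⊠ e) ≡ value ρ f
    cancel c = trans (dot-⊟ f (c ⊠ e) _) (trans (cong (ℤ._-_ (value ρ f))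
      (trans (dot-⊠ c e _) (trans (cong (c ℤ.*_) z) (ℤₚ.*-zeroʳ c)))) (ℤₚ.+-identityʳ _))
  ... | -[1+ k ] = cancel (-[1+ k ] ℤ.* lookup e (suc j))
    where
    cancel : ∀ c → value ρ (f ⊟ c ⊠ e) ≡ value ρ f
    cancel c = trans (dot-⊟ f (c ⊠ e) _) (trans (cong (ℤ._-_ (value ρ f))
      (trans (dot-⊠ c e _) (trans (cong (c ℤ.*_) z) (ℤₚ.*-zeroʳ c)))) (ℤₚ.+-identityʳ _))

  learn-value : (ρ : Vec ℕ n) (e : Lin n) (rd : Lin n → Lin n) → Zero ρ e →
    (∀ f → value ρ (rd f) ≡ value ρ f) → ∀ f → value ρ (learn e rd f) ≡ value ρ f
  learn-value ρ e rd z h f with monic (Vec.tail e)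
  ... | just (j , _) = trans (substitute-value ρ j e (rd f) z) (h f)
  ... | nothing      = h f

  pivotZero-sound : (ρ : Vec ℕ n) (f : Lin n) (t : Tableau n) (M : Models ρ t) →
    Zero (Models.point M) f → Models ρ (pivotZero f t)
  pivotZero-sound ρ (c ∷ cs) t M@(models ys sm nn zs hs) z with monic cs in eq
  ... | just (j , true)  = pivotOn-sound ρ j _ (c ∷ cs) t M 0 1 (monic-coefficient cs eq) z (λ b → sym (ℤₚ.*-zeroʳ b))
  ... | just (j , false) = pivotOn-sound ρ j _ (-1ℤ ⊠ (c ∷ cs)) t M 0 1 (monic-coefficient cs eq)
    (zero-negate ys (c ∷ cs) z) (λ b → sym (ℤₚ.*-zeroʳ b))
  ... | nothing          = models ys sm nn zs
    (ℤₚ.≤-reflexive (sym z) ∷ ℤₚ.≤-reflexive (sym (zero-negate ys (c ∷ cs) z)) ∷ hs)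

  assert-sound : (ρ : Vec ℕ n) (c : Con n) (t : Tableau n) → Sat ρ c → Models ρ t → Result ρ (assert c t)
  assert-sound ρ (≥0 f) (tableau rd tr rs) h (models ys sm nn zs hs) =
    repair-sound ρ fuel (tableau rd tr (tr f ∷ rs)) (models ys sm nn zs (nn f h ∷ hs))
  assert-sound ρ (=0 e) (tableau rd tr rs) h (models ys sm nn zs hs) with unbalanced? (rd e) in eq
  ... | true  = unbalanced-sound ρ (rd e) (subst T (sym eq) tt) (trans (sm e) h)
  ... | false = repair-sound ρ fuel (pivotZero (tr e) t) (pivotZero-sound ρ (tr e) t
          (models ys (learn-value ρ (rd e) rd (trans (sm e) h) sm) nn zs hs) (zs e h))
    where t = tableau (learn (rd e) rd) tr rs

  -- Case distinctions and their refutation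

  data Tree (n : ℕ) : Set where
    open′ closed : Tree n
    assume       : Con n → Tree n → Tree n
    either       : Tree n → Tree n → Tree n

  Holds : Vec ℕ n → Tree n → Set
  Holds ρ open′        = ⊤
  Holds ρ closed       = ⊥
  Holds ρ (assume c t) = Sat ρ c × Holds ρ t
  Holds ρ (either t u) = Holds ρ t ⊎ Holds ρ u

  refute : Tree n → Tableau n → Bool
  refute open′        s = false
  refute closed       s = true
  refute (assume c t) s with assert c s
  ... | nothing = true
  ... | just s′ = refute t s′
  refute (either t u) s = if refute t s then refute u s else false

  refute-sound : (ρ : Vec ℕ n) (t : Tree n) (s : Tableau n) → T (refute t s) → Models ρ s → ¬ Holds ρ t
  refute-sound ρ (assume c t) s r M (hc , ht) with assert c s | assert-sound ρ c s hc M
  ... | just s′ | M′ = refute-sound ρ t s′ r M′ ht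
  refute-sound ρ (either t u) s r M h with refute t s in eq
  refute-sound ρ (either t u) s r M (inj₁ h) | true = refute-sound ρ t s (subst T (sym eq) tt) M h
  refute-sound ρ (either t u) s r M (inj₂ h) | true = refute-sound ρ u s r M h

  -- In continuation-passing style an absolute value or a minimum splits everything that follows it.
  -- The sign condition is assumed at the split, so an infeasible branch is closed before it is
  -- developed further.
  cases : Tm n → (Lin n → Tree n) → Tree n
  cases (var i)     k = k (unit (suc i))
  cases (con c)     k = k (const (+ c))
  cases (s :+ t)    k = cases s λ f → cases t λ g → k (f ⊞ g)
  cases (c :* t)    k = cases t λ f → k (+ c ⊠ f)
  cases (∣ s :- t ∣) k = cases s λ f → cases t λ g →
    either (assume (≥0 (g ⊟ f)) (k (g ⊟ f))) (assume (≥0 (f ⊟ g ⊞ const -1ℤ)) (k (f ⊟ g)))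
  cases (s :⊓ t)    k = cases s λ f → cases t λ g →
    either (assume (≥0 (g ⊟ f)) (k f)) (assume (≥0 (f ⊟ g ⊞ const -1ℤ)) (k g))

  value-⊟ : (ρ : Vec ℕ n) {f g : Lin n} {x y : ℕ} → value ρ f ≡ + x → value ρ g ≡ + y →
    value ρ (g ⊟ f) ≡ + y ℤ.- + x
  value-⊟ ρ {f} {g} hf hg = trans (dot-⊟ g f _) (cong₂ ℤ._-_ hg hf)

  monus : {x y : ℕ} → x ≤ y → + y ℤ.- + x ≡ + (y ℕ.∸ x)
  monus {x} {y} x≤y = trans (ℤₚ.m-n≡m⊖n y x) (ℤₚ.⊖-≥ x≤y)

  nonneg-≤ : (ρ : Vec ℕ n) {f g : Lin n} {x y : ℕ} → value ρ f ≡ + x → value ρ g ≡ + y → x ≤ y →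
    Nonneg ρ (g ⊟ f)
  nonneg-≤ ρ {f} {g} hf hg x≤y =
    subst (0ℤ ℤ.≤_) (sym (trans (value-⊟ ρ {f} {g} hf hg) (monus x≤y))) (ℤ.+≤+ z≤n)

  nonneg-< : (ρ : Vec ℕ n) {f g : Lin n} {x y : ℕ} → value ρ f ≡ + x → value ρ g ≡ + y → suc x ≤ y →
    Nonneg ρ (g ⊟ f ⊞ const -1ℤ)
  nonneg-< ρ {f} {g} {x} {y} hf hg x<y = subst (0ℤ ℤ.≤_)
    (sym (trans (dot-⊞ (g ⊟ f) (const -1ℤ) _)
           (trans (cong₂ ℤ._+_ (value-⊟ ρ {f} {g} hf hg) (value-const -1ℤ ρ))
             (trans (step (+ y) (+ x)) (monus x<y)))))
    (ℤ.+≤+ z≤n)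
    where
    step : ∀ a b → (a ℤ.- b) ℤ.+ -1ℤ ≡ a ℤ.- (1ℤ ℤ.+ b)
    step = solve-∀ᶻ

  cases-sound : (ρ : Vec ℕ n) (t : Tm n) (k : Lin n → Tree n) →
    (∀ f → value ρ f ≡ + ⟦ t ⟧ ρ → Holds ρ (k f)) → Holds ρ (cases t k)
  cases-sound ρ (var i)  k h = h _ (dot-unit (suc i) (1 ∷ ρ))
  cases-sound ρ (con c)  k h = h _ (value-const (+ c) ρ)
  cases-sound ρ (s :+ t) k h = cases-sound ρ s _ λ f hf → cases-sound ρ t _ λ g hg →
    h _ (trans (dot-⊞ f g _) (cong₂ ℤ._+_ hf hg))
  cases-sound ρ (c :* t) k h = cases-sound ρ t _ λ f hf →
    h _ (trans (dot-⊠ (+ c) f _) (trans (cong (+ c ℤ.*_) hf) (sym (ℤₚ.pos-* c _))))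
  cases-sound ρ (∣ s :- t ∣) k h = cases-sound ρ s _ λ f hf → cases-sound ρ t _ λ g hg → branch f g hf hg
    where
    branch : ∀ f g → value ρ f ≡ + ⟦ s ⟧ ρ → value ρ g ≡ + ⟦ t ⟧ ρ → Holds ρ
      (either (assume (≥0 (g ⊟ f)) (k (g ⊟ f))) (assume (≥0 (f ⊟ g ⊞ const -1ℤ)) (k (f ⊟ g))))
    branch f g hf hg with ℕₚ.≤-<-connex (⟦ s ⟧ ρ) (⟦ t ⟧ ρ)
    ... | inj₁ s≤t = inj₁ (nonneg-≤ ρ {f} {g} hf hg s≤t , h _ (trans (value-⊟ ρ {f} {g} hf hg)
            (trans (monus s≤t) (cong +_ (sym (ℕₚ.m≤n⇒∣m-n∣≡n∸m s≤t))))))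
    ... | inj₂ t<s = inj₂ (nonneg-< ρ {g} {f} hg hf t<s , h _ (trans (value-⊟ ρ {g} {f} hg hf)
            (trans (monus (ℕₚ.<⇒≤ t<s)) (cong +_ (sym (ℕₚ.m≤n⇒∣n-m∣≡n∸m (ℕₚ.<⇒≤ t<s)))))))
  cases-sound ρ (s :⊓ t) k h = cases-sound ρ s _ λ f hf → cases-sound ρ t _ λ g hg → branch f g hf hg
    where
    branch : ∀ f g → value ρ f ≡ + ⟦ s ⟧ ρ → value ρ g ≡ + ⟦ t ⟧ ρ → Holds ρ
      (either (assume (≥0 (g ⊟ f)) (k f)) (assume (≥0 (f ⊟ g ⊞ const -1ℤ)) (k g)))
    branch f g hf hg with ℕₚ.≤-<-connex (⟦ s ⟧ ρ) (⟦ t ⟧ ρ)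
    ... | inj₁ s≤t = inj₁ (nonneg-≤ ρ {f} {g} hf hg s≤t , h _ (trans hf (cong +_ (sym (ℕₚ.m≤n⇒m⊓n≡m s≤t)))))
    ... | inj₂ t<s = inj₂ (nonneg-< ρ {g} {f} hg hf t<s , h _ (trans hg (cong +_ (sym (ℕₚ.m≥n⇒m⊓n≡n (ℕₚ.<⇒≤ t<s))))))

  compare : (Lin n → Lin n → Con n) → Tm n → Tm n → Tree n → Tree n
  compare c s t k = cases s λ f → cases t λ g → assume (c f g) k

  at-most below equal : Lin n → Lin n → Con n
  at-most f g = ≥0 (g ⊟ f)
  below   f g = ≥0 (g ⊟ f ⊞ const -1ℤ)
  equal   f g = =0 (g ⊟ f)

  compare-sound : (ρ : Vec ℕ n) (c : Lin n → Lin n → Con n) (s t : Tm n) {k : Tree n} →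
    (∀ f g → value ρ f ≡ + ⟦ s ⟧ ρ → value ρ g ≡ + ⟦ t ⟧ ρ → Sat ρ (c f g)) → Holds ρ k → Holds ρ (compare c s t k)
  compare-sound ρ c s t h hk = cases-sound ρ s _ λ f hf → cases-sound ρ t _ λ g hg → h f g hf hg , hk

  -- Negation is pushed inwards and disjunctions are split in one pass; `k` holds what remains to be
  -- assumed.
  positive negative : Fm n → Tree n → Tree n
  positive :⊥       k = closed
  positive (s :≤ t) k = compare at-most s t k
  positive (s :≡ t) k = compare equal s t k
  positive (φ :∧ ψ) k = positive φ (positive ψ k)
  positive (φ :∨ ψ) k = either (positive φ k) (positive ψ k)
  positive (φ :⇒ ψ) k = either (negative φ k) (positive ψ k)
  negative :⊥       k = k
  negative (s :≤ t) k = compare below t s k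
  negative (s :≡ t) k = either (compare below s t k) (compare below t s k)
  negative (φ :∧ ψ) k = either (negative φ k) (negative ψ k)
  negative (φ :∨ ψ) k = negative φ (negative ψ k)
  negative (φ :⇒ ψ) k = positive φ (negative ψ k)

  below-sound : (ρ : Vec ℕ n) (s t : Tm n) {k : Tree n} → ⟦ s ⟧ ρ ℕ.< ⟦ t ⟧ ρ → Holds ρ k → Holds ρ (compare below s t k)
  below-sound ρ s t s<t = compare-sound ρ below s t λ f g hf hg → nonneg-< ρ {f} {g} hf hg s<t

  positive-sound : (ρ : Vec ℕ n) (φ : Fm n) {k : Tree n} → ρ ⊨ φ → Holds ρ k → Holds ρ (positive φ k)
  negative-sound : (ρ : Vec ℕ n) (φ : Fm n) {k : Tree n} → ¬ ρ ⊨ φ → Holds ρ k → Holds ρ (negative φ k)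
  positive-sound ρ (s :≤ t) h         = compare-sound ρ at-most s t λ f g hf hg → nonneg-≤ ρ {f} {g} hf hg h
  positive-sound ρ (s :≡ t) h         = compare-sound ρ equal s t λ f g hf hg →
    trans (value-⊟ ρ {f} {g} hf hg) (ℤₚ.i≡j⇒i-j≡0 (cong +_ (sym h)))
  positive-sound ρ (φ :∧ ψ) (h , h′) hk = positive-sound ρ φ h (positive-sound ρ ψ h′ hk)
  positive-sound ρ (φ :∨ ψ) (inj₁ h) hk = inj₁ (positive-sound ρ φ h hk)
  positive-sound ρ (φ :∨ ψ) (inj₂ h) hk = inj₂ (positive-sound ρ ψ h hk)
  positive-sound ρ (φ :⇒ ψ) h        hk with ⊨-dec ρ φ
  ... | yes hφ = inj₂ (positive-sound ρ ψ (h hφ) hk)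
  ... | no ¬hφ = inj₁ (negative-sound ρ φ ¬hφ hk)
  negative-sound ρ :⊥       h hk = hk
  negative-sound ρ (s :≤ t) h hk = below-sound ρ t s (ℕₚ.≰⇒> h) hk
  negative-sound ρ (s :≡ t) h hk with ℕₚ.<-≤-connex (⟦ s ⟧ ρ) (⟦ t ⟧ ρ)
  ... | inj₁ s<t = inj₁ (below-sound ρ s t s<t hk)
  ... | inj₂ t≤s = inj₂ (below-sound ρ t s (ℕₚ.≤∧≢⇒< t≤s (h ∘ sym)) hk)
  negative-sound ρ (φ :∧ ψ) h hk with ⊨-dec ρ φ
  ... | yes hφ = inj₂ (negative-sound ρ ψ (h ∘ (hφ ,_)) hk)
  ... | no ¬hφ = inj₁ (negative-sound ρ φ ¬hφ hk)
  negative-sound ρ (φ :∨ ψ) h hk = negative-sound ρ φ (h ∘ inj₁) (negative-sound ρ ψ (h ∘ inj₂) hk)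
  negative-sound ρ (φ :⇒ ψ) h hk with ⊨-dec ρ φ
  ... | yes hφ = positive-sound ρ φ hφ (negative-sound ρ ψ (λ hψ → h λ _ → hψ) hk)
  ... | no ¬hφ = ⊥-elim (h λ hφ → ⊥-elim (¬hφ hφ))

  Goal : ∀ n → N-ary n (Tm n) (Fm n) → Fm n
  Goal n φ = φ $ⁿ Vec.map var (Vec.allFin n)

  initial : Tableau n
  initial = tableau id id []

  -- The second argument is tt: the type checker runs the refutation of ¬ φ and accepts tt only if it succeeds.
  arith : (φ : Fm n) → T (refute (negative φ open′) initial) → (ρ : Vec ℕ n) → ρ ⊨ φ
  arith φ t ρ = decidable-stable (⊨-dec ρ φ) λ h →
    refute-sound ρ (negative φ open′) initial t (models ρ (λ _ → refl) (λ _ h → h) (λ _ h → h) [])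
      (negative-sound ρ φ h tt)

open LinearArithmetic using (Tm; con; _:+_; _:*_; ∣_:-_∣; _:⊓_; Fm; :⊥; _:≤_; _:≡_; _:<_; _:∧_; _:∨_; _:⇒_; _⊨_; Goal; arith)

-- Distances in the graph with the added edge

d : V n → V n → ℕ
d (x , y) (x′ , y′) = ∣ toℕ x - toℕ x′ ∣ + ∣ toℕ y - toℕ y′ ∣

D : V n → V n → V n → V n → ℕ
D E F P X = d P X ⊓ (d P E + 1 + d F X) ⊓ (d P F + 1 + d E X)

∈-verts : (A : V n) → A ∈ verts n
∈-verts (x , y) = ∈ₚ.∈-concatMap⁺ _ (lose (∈ₚ.∈-allFin x) (∈ₚ.∈-map⁺ _ (∈ₚ.∈-allFin y)))

==⇒≡ : {A B : V n} → T (A == B) → A ≡ B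
==⇒≡ t = let tx , ty = Equivalence.to T-∧ t in
  cong₂ _,_ (Finₚ.toℕ-injective (ℕₚ.≡ᵇ⇒≡ _ _ tx)) (Finₚ.toℕ-injective (ℕₚ.≡ᵇ⇒≡ _ _ ty))

==-refl : (A : V n) → T (A == A)
==-refl (x , y) = Equivalence.from T-∧ (ℕₚ.≡⇒≡ᵇ (toℕ x) _ refl , ℕₚ.≡⇒≡ᵇ (toℕ y) _ refl)

d-refl : (A : V n) → d A A ≡ 0
d-refl (x , y) = cong₂ _+_ (ℕₚ.∣n-n∣≡0 (toℕ x)) (ℕₚ.∣n-n∣≡0 (toℕ y))

d-sym : (A B : V n) → d A B ≡ d B A
d-sym (x , y) (x′ , y′) = cong₂ _+_ (ℕₚ.∣-∣-comm (toℕ x) (toℕ x′)) (ℕₚ.∣-∣-comm (toℕ y) (toℕ y′))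

d-triangle : (A B C : V n) → d A C ≤ d A B + d B C
d-triangle (a , b) (a′ , b′) (a″ , b″) = arith
  (Goal 6 λ a b a′ b′ a″ b″ → ∣ a :- a″ ∣ :+ ∣ b :- b″ ∣
    :≤ (∣ a :- a′ ∣ :+ ∣ b :- b′ ∣) :+ (∣ a′ :- a″ ∣ :+ ∣ b′ :- b″ ∣)) tt
  (toℕ a ∷ toℕ b ∷ toℕ a′ ∷ toℕ b′ ∷ toℕ a″ ∷ toℕ b″ ∷ [])

d≡0⇒≡ : (A B : V n) → d A B ≡ 0 → A ≡ B
d≡0⇒≡ (x , y) (x′ , y′) h = cong₂ _,_
  (Finₚ.toℕ-injective (ℕₚ.∣m-n∣≡0⇒m≡n (ℕₚ.m+n≡0⇒m≡0 _ h)))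
  (Finₚ.toℕ-injective (ℕₚ.∣m-n∣≡0⇒m≡n (ℕₚ.m+n≡0⇒n≡0 ∣ toℕ x - toℕ x′ ∣ h)))

gridAdj⇒d≡1 : (A B : V n) → T (gridAdj A B) → d A B ≡ 1
gridAdj⇒d≡1 (x , y) (x′ , y′) t with Equivalence.to T-∨ t
... | inj₁ t₁ = let a , b = Equivalence.to T-∧ t₁ in
  cong₂ _+_ (ℕₚ.m≡n⇒∣m-n∣≡0 (ℕₚ.≡ᵇ⇒≡ (toℕ x) _ a)) (ℕₚ.≡ᵇ⇒≡ ∣ toℕ y - toℕ y′ ∣ 1 b)
... | inj₂ t₁ = let a , b = Equivalence.to T-∧ t₁ in
  trans (cong₂ _+_ (ℕₚ.≡ᵇ⇒≡ ∣ toℕ x - toℕ x′ ∣ 1 b) (ℕₚ.m≡n⇒∣m-n∣≡0 (ℕₚ.≡ᵇ⇒≡ (toℕ y) _ a))) refl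

⊓-step : ∀ {a b c a′ b′ c′} → a′ ≤ a + 1 → b′ ≤ b + 1 → c′ ≤ c + 1 → a′ ⊓ b′ ⊓ c′ ≤ suc (a ⊓ b ⊓ c)
⊓-step {a} {b} {c} {a′} {b′} {c′} = arith (Goal 6 λ a b c a′ b′ c′ →
  a′ :≤ a :+ con 1 :⇒ b′ :≤ b :+ con 1 :⇒ c′ :≤ c :+ con 1 :⇒ a′ :⊓ b′ :⊓ c′ :≤ con 1 :+ a :⊓ b :⊓ c) tt
  (a ∷ b ∷ c ∷ a′ ∷ b′ ∷ c′ ∷ [])

edge-step : ∀ e f l {z} → z ≡ 0 → f ⊓ (e + 1 + z) ⊓ (f + 1 + l) ≤ suc (e ⊓ (e + 1 + l) ⊓ (f + 1 + z))
edge-step e f l {z} = arith (Goal 4 λ e f l z → z :≡ con 0 :⇒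
  f :⊓ (e :+ con 1 :+ z) :⊓ (f :+ con 1 :+ l) :≤ con 1 :+ e :⊓ (e :+ con 1 :+ l) :⊓ (f :+ con 1 :+ z)) tt (e ∷ f ∷ l ∷ z ∷ [])

D-swap : (E F P X : V n) → D F E P X ≡ D E F P X
D-swap E F P X = trans (ℕₚ.⊓-assoc (d P X) _ _)
  (trans (cong (d P X ⊓_) (ℕₚ.⊓-comm (d P F + 1 + d E X) _)) (sym (ℕₚ.⊓-assoc (d P X) _ _)))

D-edge : (E F P : V n) → D E F P F ≤ suc (D E F P E)
D-edge E F P rewrite d-refl F | d-refl E | d-sym F E = edge-step (d P E) (d P F) (d E F) refl

-- This makes `D` a lower bound for the length of every walk in the new graph.
D-step : (E F P C B : V n) → T (adj' E F C B) → D E F P B ≤ suc (D E F P C)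
D-step E F P C B t with Equivalence.to (T-∨ {gridAdj C B}) t
... | inj₁ g = ⊓-step (near P) (shift (d P E) (near F)) (shift (d P F) (near E))
  where
  near : ∀ Z → d Z B ≤ d Z C + 1
  near Z = subst (d Z B ≤_) (cong (d Z C +_) (gridAdj⇒d≡1 C B g)) (d-triangle Z C B)
  shift : ∀ k {a b} → b ≤ a + 1 → k + 1 + b ≤ k + 1 + a + 1
  shift k {a} {b} h = subst (k + 1 + b ≤_) (sym (ℕₚ.+-assoc (k + 1) a 1)) (ℕₚ.+-monoʳ-≤ (k + 1) h)
... | inj₂ g with Equivalence.to (T-∨ {(C == E) ∧ (B == F)}) g
...   | inj₁ ef with refl ← ==⇒≡ {A = C} (proj₁ (Equivalence.to T-∧ ef)) | refl ← ==⇒≡ {A = B} (proj₂ (Equivalence.to (T-∧ {C == E}) ef)) = D-edge E F P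
...   | inj₂ ef with refl ← ==⇒≡ {A = C} (proj₁ (Equivalence.to T-∧ ef)) | refl ← ==⇒≡ {A = B} (proj₂ (Equivalence.to (T-∧ {C == F}) ef)) =
  subst₂ _≤_ (D-swap E F P E) (cong suc (D-swap E F P F)) (D-edge F E P)

D-refl : (E F A : V n) → D E F A A ≡ 0
D-refl E F A rewrite d-refl A = refl

reach⇒D≤ : (E F A B : V n) (k : ℕ) → T (reach (adj' E F) A k B) → D E F A B ≤ k
reach⇒D≤ E F A B zero t with refl ← ==⇒≡ {A = A} {B} t = ℕₚ.≤-reflexive (D-refl E F A)
reach⇒D≤ {n} E F A B (suc k) t with Equivalence.to (T-∨ {reach (adj' E F) A k B}) t
... | inj₁ t′ = ℕₚ.m≤n⇒m≤1+n (reach⇒D≤ E F A B k t′)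
... | inj₂ t′ with find (Anyₚ.any⁻ _ (verts n) t′)
...   | C , _ , tC = let r , a = Equivalence.to (T-∧ {reach (adj' E F) A k C}) tC in
  ℕₚ.≤-trans (D-step E F A C B a) (s≤s (reach⇒D≤ E F A C k r))

∣m-suc-m∣≡1 : ∀ m → ∣ m - suc m ∣ ≡ 1
∣m-suc-m∣≡1 zero    = refl
∣m-suc-m∣≡1 (suc m) = ∣m-suc-m∣≡1 m

closer : (c b : Fin n) {j : ℕ} → ∣ toℕ c - toℕ b ∣ ≡ suc j → ∃[ b′ ] (∣ toℕ c - toℕ b′ ∣ ≡ j × ∣ toℕ {n} b′ - toℕ b ∣ ≡ 1)
closer zero    (suc b) h = inject₁ b , trans (Finₚ.toℕ-inject₁ b) (ℕₚ.suc-injective h)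
  , trans (cong (λ z → ∣ z - suc (toℕ b) ∣) (Finₚ.toℕ-inject₁ b)) (∣m-suc-m∣≡1 (toℕ b))
closer {suc (suc n)} (suc c) zero h = suc zero , trans (ℕₚ.∣-∣-identityʳ (toℕ c)) (ℕₚ.suc-injective h) , refl
closer (suc c) (suc b) h = let b′ , p , q = closer c b h in suc b′ , p , q

closerVertex : (C B : V n) {j : ℕ} → d C B ≡ suc j → ∃[ B′ ] (d C B′ ≡ j × T (gridAdj B′ B))
closerVertex (x , y) (x′ , y′) {j} h with ∣ toℕ x - toℕ x′ ∣ in eq
... | suc i = let b , p , q = closer x x′ eq in
  (b , y′) , trans (cong (_+ ∣ toℕ y - toℕ y′ ∣) p) (ℕₚ.suc-injective h) ,
  Equivalence.from T-∨ (inj₂ (Equivalence.from T-∧ (ℕₚ.≡⇒≡ᵇ (toℕ y′) _ refl , ℕₚ.≡⇒≡ᵇ ∣ toℕ b - toℕ x′ ∣ 1 q)))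
... | zero = let b , p , q = closer y y′ h in
  (x′ , b) , trans (cong (_+ ∣ toℕ y - toℕ b ∣) eq) p ,
  Equivalence.from (T-∨ {(toℕ x′ ≡ᵇ toℕ x′) ∧ (∣ toℕ b - toℕ y′ ∣ ≡ᵇ 1)}) (inj₁ (Equivalence.from T-∧ (ℕₚ.≡⇒≡ᵇ (toℕ x′) _ refl , ℕₚ.≡⇒≡ᵇ ∣ toℕ b - toℕ y′ ∣ 1 q)))

reach-suc : (adj : V n → V n → Bool) (A C B : V n) (k : ℕ) → T (reach adj A k C) → T (adj C B) → T (reach adj A (suc k) B)
reach-suc {n} adj A C B k r a = Equivalence.from (T-∨ {reach adj A k B})
  (inj₂ (Anyₚ.any⁺ _ (lose (∈-verts C) (Equivalence.from T-∧ (r , a)))))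

reach-walk : (E F A C B : V n) (k j : ℕ) → T (reach (adj' E F) A k C) → d C B ≡ j →
  T (reach (adj' E F) A (k + j) B)
reach-walk E F A C B k zero r h with refl ← d≡0⇒≡ C B h =
  subst (λ z → T (reach (adj' E F) A z C)) (sym (ℕₚ.+-identityʳ k)) r
reach-walk E F A C B k (suc j) r h = let B′ , p , g = closerVertex C B h in
  subst (λ z → T (reach (adj' E F) A z B)) (sym (ℕₚ.+-suc k j))
    (reach-suc (adj' E F) A B′ B (k + j) (reach-walk E F A C B′ k j r p)
      (Equivalence.from (T-∨ {gridAdj B′ B}) (inj₁ g)))

reach-d : (E F A B : V n) → T (reach (adj' E F) A (d A B) B)
reach-d E F A B = reach-walk E F A A B 0 (d A B) (==-refl A) refl

adj'-edge : (E F : V n) → T (adj' E F E F)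
adj'-edge E F = Equivalence.from (T-∨ {gridAdj E F}) (inj₂ (Equivalence.from T-∨
  (inj₁ (Equivalence.from T-∧ (==-refl E , ==-refl F)))))

adj'-edge′ : (E F : V n) → T (adj' E F F E)
adj'-edge′ E F = Equivalence.from (T-∨ {gridAdj F E}) (inj₂ (Equivalence.from (T-∨ {(F == E) ∧ (E == F)})
  (inj₂ (Equivalence.from T-∧ (==-refl F , ==-refl E)))))

reach-via : (E F C C′ : V n) → T (adj' E F C C′) → (A B : V n) → T (reach (adj' E F) A (d A C + 1 + d C′ B) B)
reach-via E F C C′ a A B = reach-walk E F A C′ B (d A C + 1) (d C′ B)
  (subst (λ z → T (reach (adj' E F) A z C′)) (ℕₚ.+-comm 1 (d A C))
    (reach-suc (adj' E F) A C C′ (d A C) (reach-d E F A C) a)) refl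

reach-D : (E F A B : V n) → T (reach (adj' E F) A (D E F A B) B)
reach-D E F A B with ℕₚ.⊓-sel (d A B ⊓ (d A E + 1 + d F B)) (d A F + 1 + d E B)
... | inj₂ h rewrite h = reach-via E F F E (adj'-edge′ E F) A B
... | inj₁ h rewrite h with ℕₚ.⊓-sel (d A B) (d A E + 1 + d F B)
...   | inj₁ h′ rewrite h′ = reach-d E F A B
...   | inj₂ h′ rewrite h′ = reach-via E F E F (adj'-edge E F) A B

module _ (p : ℕ → Bool) where
  search-least : ∀ f c {k} → c ≤ k → k < c + f → T (p k) → (∀ j → T (p j) → k ≤ j) → search f c p ≡ k
  search-least zero    c c≤k k<c+f pk least = ⊥-elim (ℕₚ.<⇒≱ (subst (_ <_) (ℕₚ.+-identityʳ c) k<c+f) c≤k)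
  search-least (suc f) c {k} c≤k k<c+f pk least with p c in eq
  ... | true  = ℕₚ.≤-antisym c≤k (least c (subst T (sym eq) tt))
  ... | false = search-least f (suc c) (ℕₚ.≤∧≢⇒< c≤k λ { refl → subst T eq pk })
                  (subst (k <_) (ℕₚ.+-suc c f) k<c+f) pk least

  leastUpTo-least : ∀ {b k} → k ≤ b → T (p k) → (∀ j → T (p j) → k ≤ j) → leastUpTo b p ≡ k
  leastUpTo-least k≤b = search-least _ 0 z≤n (s≤s k≤b)

  search-≤ : ∀ f c {k} → c ≤ k → T (p k) → search f c p ≤ k
  search-≤ zero    c c≤k pk = c≤k
  search-≤ (suc f) c {k} c≤k pk with p c in eq
  ... | true  = c≤k
  ... | false = search-≤ f (suc c) (ℕₚ.≤∧≢⇒< c≤k λ { refl → subst T eq pk }) pk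

  search-≥ : ∀ f c {k} → k ≤ c + f → (∀ j → T (p j) → k ≤ j) → k ≤ search f c p
  search-≥ zero    c k≤ least = subst (_ ≤_) (ℕₚ.+-identityʳ c) k≤
  search-≥ (suc f) c {k} k≤ least with p c in eq
  ... | true  = least c (subst T (sym eq) tt)
  ... | false = search-≥ f (suc c) (subst (k ≤_) (ℕₚ.+-suc c f) k≤) least

∣toℕ-toℕ∣≤ : (x y : Fin (suc n)) → ∣ toℕ x - toℕ y ∣ ≤ n
∣toℕ-toℕ∣≤ x y = ℕₚ.≤-trans (ℕₚ.∣m-n∣≤m⊔n (toℕ x) (toℕ y))
  (ℕₚ.⊔-lub (ℕₚ.≤-pred (Finₚ.toℕ<n x)) (ℕₚ.≤-pred (Finₚ.toℕ<n y)))

-- The search in `dist` stops at `n * n`, so the distance has to be found before that.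
d≤n*n : (A B : V n) → d A B ≤ n * n
d≤n*n {suc m} (x , y) (x′ , y′) = ℕₚ.≤-trans (ℕₚ.+-mono-≤ (∣toℕ-toℕ∣≤ x x′) (∣toℕ-toℕ∣≤ y y′))
  (ℕₚ.+-mono-≤ (ℕₚ.n≤1+n m) (ℕₚ.m≤m*n m (suc m)))

dist≡D : (E F A B : V n) → dist (adj' E F) A B ≡ D E F A B
dist≡D E F A B = leastUpTo-least _ (ℕₚ.≤-trans (ℕₚ.m⊓n≤m _ _) (ℕₚ.≤-trans (ℕₚ.m⊓n≤m _ _) (d≤n*n A B)))
  (reach-D E F A B) (λ j → reach⇒D≤ E F A B j)

-- Metric dimension

Resolving : V n → V n → List (V n) → Set
Resolving E F R = ∀ A B → All (λ X → D E F A X ≡ D E F B X) R → A ≡ B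

differ : V n → V n → V n → V n → V n → Bool
differ E F A B X = not (dist (adj' E F) A X ≡ᵇ dist (adj' E F) B X)

T-not : {b : Bool} → T (not b) → ¬ T b
T-not {false} _ ()

¬T⇒T-not : {b : Bool} → ¬ T b → T (not b)
¬T⇒T-not {false} _ = tt
¬T⇒T-not {true}  h = ⊥-elim (h tt)

¬differ⇒≡ : (E F A B X : V n) → ¬ T (differ E F A B X) → D E F A X ≡ D E F B X
¬differ⇒≡ E F A B X h with T? (dist (adj' E F) A X ≡ᵇ dist (adj' E F) B X)
... | yes t = trans (sym (dist≡D E F A X)) (trans (ℕₚ.≡ᵇ⇒≡ _ _ t) (dist≡D E F B X))
... | no ¬t = ⊥-elim (h (¬T⇒T-not ¬t))

≡⇒¬differ : (E F A B X : V n) → D E F A X ≡ D E F B X → ¬ T (differ E F A B X)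
≡⇒¬differ E F A B X h t = T-not t
  (ℕₚ.≡⇒≡ᵇ _ _ (trans (dist≡D E F A X) (trans h (sym (dist≡D E F B X)))))

resolves⇒Resolving : (E F : V n) (R : List (V n)) → T (resolves (adj' E F) R) → Resolving E F R
resolves⇒Resolving {n} E F R t A B same with
  Equivalence.to (T-∨ {A == B}) (All.lookup (Allₚ.all⁺ _ (verts n) (All.lookup (Allₚ.all⁺ _ (verts n) t) (∈-verts A))) (∈-verts B))
... | inj₁ eq = ==⇒≡ eq
... | inj₂ t′ with find (Anyₚ.any⁻ (differ E F A B) R t′)
...   | X , X∈R , tX = ⊥-elim (≡⇒¬differ E F A B X (All.lookup same X∈R) tX)

Resolving⇒resolves : (E F : V n) (R : List (V n)) → Resolving E F R → T (resolves (adj' E F) R)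
Resolving⇒resolves {n} E F R res = Allₚ.all⁻ _ (All.tabulate {xs = verts n} λ {A} _ → Allₚ.all⁻ _ (All.tabulate {xs = verts n} λ {B} _ → pair A B))
  where
  pair : ∀ A B → T ((A == B) ∨ any (differ E F A B) R)
  pair A B with T? (any (differ E F A B) R)
  ... | yes t = Equivalence.from (T-∨ {A == B}) (inj₂ t)
  ... | no ¬t with refl ← res A B (All.tabulate {xs = R} λ {X} X∈R → ¬differ⇒≡ E F A B X λ tX → ¬t (Anyₚ.any⁺ _ (lose X∈R tX))) =
    Equivalence.from (T-∨ {A == A}) (inj₁ (==-refl A))

module _ {A : Set} where

  subsets-∷ : ∀ {v : A} {S} k vs → S ∈ subsets k vs → S ∈ subsets k (v ∷ vs)
  subsets-∷ zero    vs S∈ = S∈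
  subsets-∷ (suc k) vs S∈ = ∈ₚ.∈-++⁺ʳ _ S∈

  subsets-length : ∀ {S : List A} k vs → S ∈ subsets k vs → length S ≡ k
  subsets-length zero    vs       (here refl) = refl
  subsets-length (suc k) (v ∷ vs) S∈ with ∈ₚ.∈-++⁻ (List.map (v ∷_) (subsets k vs)) S∈
  ... | inj₂ S∈′ = subsets-length (suc k) vs S∈′
  ... | inj₁ S∈′ with ∈ₚ.∈-map⁻ (v ∷_) S∈′
  ...   | S′ , S′∈ , refl = cong suc (subsets-length k vs S′∈)

  subsets-insert : ∀ {x : A} {S} k vs → x ∈ vs → S ∈ subsets k vs →
    ∃[ j ] ∃[ S′ ] (j ≤ suc k × S′ ∈ subsets j vs × x ∈ S′ × (∀ {y} → y ∈ S → y ∈ S′))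
  subsets-insert zero (v ∷ vs) (here refl) (here refl) =
    1 , v ∷ [] , ℕₚ.≤-refl , here refl , here refl , λ ()
  subsets-insert zero (v ∷ vs) (there x∈) S∈ with subsets-insert zero vs x∈ S∈
  ... | j , S′ , j≤ , S′∈ , x∈′ , sub = j , S′ , j≤ , subsets-∷ j vs S′∈ , x∈′ , sub
  subsets-insert (suc k) (v ∷ vs) x∈ S∈ with ∈ₚ.∈-++⁻ (List.map (v ∷_) (subsets k vs)) S∈
  subsets-insert (suc k) (v ∷ vs) (here refl) S∈ | inj₂ S∈′ =
    suc (suc k) , v ∷ _ , ℕₚ.≤-refl , ∈ₚ.∈-++⁺ˡ (∈ₚ.∈-map⁺ (v ∷_) S∈′) , here refl , there
  subsets-insert (suc k) (v ∷ vs) (there x∈) S∈ | inj₂ S∈′ with subsets-insert (suc k) vs x∈ S∈′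
  ... | j , S′ , j≤ , S′∈ , x∈′ , sub = j , S′ , j≤ , subsets-∷ j vs S′∈ , x∈′ , sub
  subsets-insert (suc k) (v ∷ vs) x∈ S∈ | inj₁ S∈′ with ∈ₚ.∈-map⁻ (v ∷_) S∈′
  subsets-insert (suc k) (v ∷ vs) (here refl) S∈ | inj₁ S∈′ | S′ , S′∈ , refl =
    suc k , _ , ℕₚ.n≤1+n _ , S∈ , here refl , λ y∈ → y∈
  subsets-insert (suc k) (v ∷ vs) (there x∈) S∈ | inj₁ S∈′ | S′ , S′∈ , refl with subsets-insert k vs x∈ S′∈
  ... | j , S″ , j≤ , S″∈ , x∈′ , sub =
    suc j , v ∷ S″ , s≤s j≤ , ∈ₚ.∈-++⁺ˡ (∈ₚ.∈-map⁺ (v ∷_) S″∈) , there x∈′ , λ { (here p) → here p ; (there y∈) → there (sub y∈) }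

  -- `subsets` yields sublists of `verts n`, whereas a list of landmarks comes in any order and may
  -- repeat a vertex. Covering it suffices, since adding landmarks keeps a list resolving.
  subsets-cover : ∀ (R vs : List A) → All (_∈ vs) R →
    ∃[ j ] ∃[ S ] (j ≤ length R × S ∈ subsets j vs × All (_∈ S) R)
  subsets-cover []      vs []        = 0 , [] , z≤n , here refl , []
  subsets-cover (x ∷ R) vs (x∈ ∷ R⊆) with subsets-cover R vs R⊆
  ... | j , S , j≤ , S∈ , R⊆S with subsets-insert j vs x∈ S∈
  ...   | i , S′ , i≤ , S′∈ , x∈′ , sub = i , S′ , ℕₚ.≤-trans i≤ (s≤s j≤) , S′∈ , x∈′ ∷ All.map sub R⊆S

attained : V n → V n → ℕ → Bool
attained {n} E F k = any (resolves (adj' E F)) (subsets k (verts n))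

β'-≤ : (E F : V n) (R : List (V n)) → Resolving E F R → β' E F ≤ length R
β'-≤ {n} E F R res with subsets-cover R (verts n) (All.universal ∈-verts R)
... | j , S , j≤ , S∈ , R⊆S = ℕₚ.≤-trans
  (search-≤ (attained E F) (suc (n * n)) 0 z≤n (Anyₚ.any⁺ (resolves (adj' E F)) (lose S∈ (Resolving⇒resolves E F S λ A B same →
    res A B (All.map (All.lookup same) R⊆S)))))
  j≤

Unresolvable : V n → V n → Set
Unresolvable E F = ∀ X Y → ∃[ A ] ∃[ B ] (A ≢ B × D E F A X ≡ D E F B X × D E F A Y ≡ D E F B Y)

-- The bound on `n` concerns the default value `suc (n * n)` of the search, which must be at least 3
-- as well.
β'-≥3 : (E F : V n) → 2 ≤ n → Unresolvable E F → 3 ≤ β' E F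
β'-≥3 {n} E F 2≤n unres = search-≥ (attained E F) (suc (n * n)) 0 (s≤s (ℕₚ.≤-trans (s≤s (s≤s z≤n)) (ℕₚ.*-mono-≤ 2≤n 2≤n))) large
  where
  none : ∀ S → length S ≤ 2 → ¬ Resolving E F S
  none []              _ res = let A , B , A≢B , _ = unres E E in A≢B (res A B [])
  none (X ∷ [])        _ res = let A , B , A≢B , p , _ = unres X X in A≢B (res A B (p ∷ []))
  none (X ∷ Y ∷ [])    _ res = let A , B , A≢B , p , q = unres X Y in A≢B (res A B (p ∷ q ∷ []))
  none (_ ∷ _ ∷ _ ∷ _) (s≤s (s≤s ())) _
  large : ∀ j → T (attained E F j) → 3 ≤ j
  large j t with find (Anyₚ.any⁻ (resolves (adj' E F)) (subsets j (verts n)) t) | j ℕₚ.≤? 2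
  ... | S , S∈ , tS | no j≰2  = ℕₚ.≰⇒> j≰2
  ... | S , S∈ , tS | yes j≤2 = ⊥-elim (none S (subst (_≤ 2) (sym (subsets-length j (verts n) S∈)) j≤2)
    (resolves⇒Resolving E F S tS))

-- Upper bounds

-- Crossing the edge from `E` to `F` does not pay: the way from `E` straight to `X` is at most one
-- step longer than the way from `F`, and the edge costs this step.
D-oneway : (E F P X : V n) → d E X ≤ d F X + 1 → D E F P X ≡ d P X ⊓ (d P F + 1 + d E X)
D-oneway E F P X h = arith
  (Goal 5 λ px pe pf ex fx → ex :≤ fx :+ con 1 :⇒ px :≤ pe :+ ex :⇒
    px :⊓ (pe :+ con 1 :+ fx) :⊓ (pf :+ con 1 :+ ex) :≡ px :⊓ (pf :+ con 1 :+ ex)) tt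
  (d P X ∷ d P E ∷ d P F ∷ d E X ∷ d F X ∷ []) h (d-triangle P E X)

D-balanced : (E F P X : V n) → d E X ≤ d F X + 1 → d F X ≤ d E X + 1 → D E F P X ≡ d P X
D-balanced E F P X h h′ = trans (D-oneway E F P X h) (ℕₚ.m≤n⇒m⊓n≡m (arith
  (Goal 4 λ px pf ex fx → fx :≤ ex :+ con 1 :⇒ px :≤ pf :+ fx :⇒ px :≤ pf :+ con 1 :+ ex) tt
  (d P X ∷ d P F ∷ d E X ∷ d F X ∷ []) h′ (d-triangle P F X)))

-- The suffix ᶠ marks reified formulas. In them (a , b) and (c , e) stand for E and F, w for the last coordinate.

own : Tm n → Tm n → Tm n → Tm n → Tm n
own x y z t = ∣ x :- z ∣ :+ ∣ y :- t ∣

viaEdge : Tm n → Tm n → Tm n → Tm n → Tm n → Tm n → Tm n → Tm n → Tm n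
viaEdge x y a b c e z t = own x y z t :⊓ (own x y c e :+ con 1 :+ own a b z t)

-- The equations belong to the landmarks `(0 , s)`, `(w , s)` and `(0 , 0)`. They use the simplified
-- forms of `D`: no detour for the first, a detour in one direction for the other two.
oddᶠ : (a b c e s x y x′ y′ w : Tm n) → Fm n
oddᶠ a b c e s x y x′ y′ w = c :≤ w :⇒ x :≤ w :⇒ x′ :≤ w :⇒ y :≤ y′ :⇒
  own x y z s :≡ own x′ y′ z s :⇒
  viaEdge x y c e a b w s :≡ viaEdge x′ y′ c e a b w s :⇒
  viaEdge x y a b c e z z :≡ viaEdge x′ y′ a b c e z z :⇒ x :≡ x′ :∧ y :≡ y′
  where z = con 0

evenᶠ : (a b c e t s x y x′ y′ w : Tm n) → Fm n → Fm n
evenᶠ a b c e t s x y x′ y′ w φ = c :≤ w :⇒ x :≤ w :⇒ x′ :≤ w :⇒ y :≤ y′ :⇒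
  own x y z s :≡ own x′ y′ z s :⇒ own x y w t :≡ own x′ y′ w t :⇒
  viaEdge x y a b c e z t :≡ viaEdge x′ y′ a b c e z t :⇒ φ
  where z = con 0

even₄ᶠ : (a b c e t s x y x′ y′ w : Tm n) → Fm n
even₄ᶠ a b c e t s x y x′ y′ w = evenᶠ a b c e t s x y x′ y′ w
  (viaEdge x y c e a b w s :≡ viaEdge x′ y′ c e a b w s :⇒ x :≡ x′ :∧ y :≡ y′)

even₃ᶠ : (a b c e t s x y x′ y′ w : Tm n) → Fm n
even₃ᶠ a b c e t s x y x′ y′ w = evenᶠ a b c e t s x y x′ y′ w (x :≡ x′ :∧ y :≡ y′)

-- Equal distances to `(0 , s)` put both vertices into the same colour class of the bipartite grid.
-- Since a detour through the edge changes the parity of a length, towards each of the other two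
-- landmarks either both vertices profit or neither does. The coordinates of `F` and the row are
-- substituted, so the refutation has fewer variables; `odd-separates` reintroduces them for values
-- known only up to an equation.
odd-arith = arith (Goal 9 λ a b p k x y x′ y′ w → con 1 :≤ p :⇒
  oddᶠ a b (a :+ p) (b :+ p :+ con 2 :+ 2 :* k) (b :+ p :+ con 1 :+ k) x y x′ y′ w) tt

-- Take two vertices on a diagonal with `x - y` constant, between the rows `t` and `s`. Going up the
-- diagonal, profit towards `(0 , t)` persists once it occurs; going down, so does profit towards
-- `(w , s)`. Grid distances to both landmarks vary along the diagonal, so equality towards
-- `(0 , t)` forces the upper vertex to profit and equality towards `(w , s)` the lower one. These
-- two equalities bound the sum of all four coordinates from below and from above by incompatible
-- values.
even₄-arith = arith (Goal 9 λ a b p k x y x′ y′ w → con 1 :≤ p :⇒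
  even₄ᶠ a b (a :+ p) (b :+ p :+ con 1 :+ 2 :* k) (b :+ k :+ con 1) (b :+ k :+ con 1 :+ p) x y x′ y′ w) tt

even₃-arith = arith (Goal 9 λ a b p k x y x′ y′ w → con 1 :≤ p :⇒ p :≤ k :+ con 1 :⇒
  even₃ᶠ a b (a :+ p) (b :+ p :+ con 1 :+ 2 :* k) (b :+ k :+ con 1) (b :+ k :+ con 1 :+ p) x y x′ y′ w) tt

odd-separates : ∀ a b c e p k s x y x′ y′ w → 1 ≤ p → c ≡ a + p → e ≡ b + p + 2 + 2 * k → s ≡ b + p + 1 + k →
  (a ∷ b ∷ c ∷ e ∷ s ∷ x ∷ y ∷ x′ ∷ y′ ∷ w ∷ []) ⊨ Goal 10 oddᶠ
odd-separates a b _ _ p k _ x y x′ y′ w 1≤p refl refl refl = odd-arith (a ∷ b ∷ p ∷ k ∷ x ∷ y ∷ x′ ∷ y′ ∷ w ∷ []) 1≤p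

even₄-separates : ∀ a b c e p k t s x y x′ y′ w → 1 ≤ p → c ≡ a + p → e ≡ b + p + 1 + 2 * k → t ≡ b + k + 1 → s ≡ t + p →
  (a ∷ b ∷ c ∷ e ∷ t ∷ s ∷ x ∷ y ∷ x′ ∷ y′ ∷ w ∷ []) ⊨ Goal 11 even₄ᶠ
even₄-separates a b _ _ p k _ _ x y x′ y′ w 1≤p refl refl refl refl =
  even₄-arith (a ∷ b ∷ p ∷ k ∷ x ∷ y ∷ x′ ∷ y′ ∷ w ∷ []) 1≤p

even₃-separates : ∀ a b c e p k t s x y x′ y′ w → 1 ≤ p → p ≤ k + 1 → c ≡ a + p → e ≡ b + p + 1 + 2 * k → t ≡ b + k + 1 → s ≡ t + p →
  (a ∷ b ∷ c ∷ e ∷ t ∷ s ∷ x ∷ y ∷ x′ ∷ y′ ∷ w ∷ []) ⊨ Goal 11 even₃ᶠ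
even₃-separates a b _ _ p k _ _ x y x′ y′ w 1≤p p≤k+1 refl refl refl refl =
  even₃-arith (a ∷ b ∷ p ∷ k ∷ x ∷ y ∷ x′ ∷ y′ ∷ w ∷ []) 1≤p p≤k+1

-- Both distances are `a + p + 1 + k`.
balanced-odd = arith (Goal 8 λ a b c e p k s z →
  c :≡ a :+ p :⇒ e :≡ b :+ p :+ con 2 :+ 2 :* k :⇒ s :≡ b :+ p :+ con 1 :+ k :⇒ z :≡ con 0 :⇒
  own a b z s :≤ own c e z s :+ con 1 :∧ own c e z s :≤ own a b z s :+ con 1) tt

-- The grid distance of `E` and `F` is odd, so no vertex is equidistant from them. The rows are
-- chosen to make `E` farther by exactly 1, which takes row `s` on the left side and row `t` on the
-- right side.
balanced-even = arith (Goal 10 λ a b c e p k t s z w →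
  c :≡ a :+ p :⇒ e :≡ b :+ p :+ con 1 :+ 2 :* k :⇒ t :≡ b :+ k :+ con 1 :⇒ s :≡ t :+ p :⇒ z :≡ con 0 :⇒ c :≤ w :⇒
  (own a b z s :≤ own c e z s :+ con 1 :∧ own c e z s :≤ own a b z s :+ con 1) :∧
  (own a b w t :≤ own c e w t :+ con 1 :∧ own c e w t :≤ own a b w t :+ con 1)) tt

towards-odd = arith (Goal 9 λ a b c e p k s z w →
  c :≡ a :+ p :⇒ e :≡ b :+ p :+ con 2 :+ 2 :* k :⇒ s :≡ b :+ p :+ con 1 :+ k :⇒ z :≡ con 0 :⇒ c :≤ w :⇒
  own c e w s :≤ own a b w s :+ con 1 :∧ own a b z z :≤ own c e z z :+ con 1) tt

towards-even = arith (Goal 10 λ a b c e p k t s z w →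
  con 1 :≤ p :⇒ c :≡ a :+ p :⇒ e :≡ b :+ p :+ con 1 :+ 2 :* k :⇒ t :≡ b :+ k :+ con 1 :⇒ s :≡ t :+ p :⇒ z :≡ con 0 :⇒ c :≤ w :⇒
  own a b z t :≤ own c e z t :+ con 1 :∧ own c e w s :≤ own a b w s :+ con 1) tt

Res : ℕ → V n → V n → Set
Res k E F = ∃[ R ] (length R ≤ k × Resolving E F R)

D-oneway′ : (E F P X : V n) → d F X ≤ d E X + 1 → D E F P X ≡ d P X ⊓ (d P E + 1 + d F X)
D-oneway′ E F P X h = trans (sym (D-swap E F P X)) (D-oneway F E P X h)

toℕ≤ : (x : Fin (suc w)) → toℕ x ≤ toℕ (fromℕ w)
toℕ≤ {w} x = subst (toℕ x ≤_) (sym (Finₚ.toℕ-fromℕ w)) (Finₚ.toℕ≤pred[n] x)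

fin : (y : Fin n) (t : ℕ) → t ≤ toℕ y → ∃[ x ] toℕ {n} x ≡ t
fin y t t≤y = fromℕ< (ℕₚ.≤-<-trans t≤y (Finₚ.toℕ<n y)) , Finₚ.toℕ-fromℕ< _

-- The two vertices play symmetric roles; ordering their rows removes cases from the arithmetic.
resolving-ordered : (E F : V n) (R : List (V n)) →
  (∀ A B → toℕ (proj₂ A) ≤ toℕ (proj₂ B) → All (λ X → D E F A X ≡ D E F B X) R → A ≡ B) → Resolving E F R
resolving-ordered E F R h A B same with ℕₚ.≤-total (toℕ (proj₂ A)) (toℕ (proj₂ B))
... | inj₁ a≤b = h A B a≤b same
... | inj₂ b≤a = sym (h B A b≤a (All.map sym same))

vertex-≡ : {A B : V n} → toℕ (proj₁ A) ≡ toℕ (proj₁ B) × toℕ (proj₂ A) ≡ toℕ (proj₂ B) → A ≡ B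
vertex-≡ (p , q) = cong₂ _,_ (Finₚ.toℕ-injective p) (Finₚ.toℕ-injective q)

-- The gain is 2 k + 1.
resolving-odd : (E F : V (suc w)) (p k : ℕ) → 1 ≤ p → toℕ (proj₁ F) ≡ toℕ (proj₁ E) + p →
  toℕ (proj₂ F) ≡ toℕ (proj₂ E) + p + 2 + 2 * k → Res 3 E F
resolving-odd {w} E@(xE , yE) F@(xF , yF) p k 1≤p hx hy =
  L ∷ R ∷ O ∷ [] , ℕₚ.≤-refl , resolving-ordered E F _ separate
  where
  row = fin yF (toℕ yE + p + 1 + k) (subst (toℕ yE + p + 1 + k ≤_) (sym hy) (arith
    (Goal 3 λ b p k → b :+ p :+ con 1 :+ k :≤ b :+ p :+ con 2 :+ 2 :* k) tt (toℕ yE ∷ p ∷ k ∷ [])))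
  s = proj₁ row
  hs = proj₂ row
  L R O : V (suc w)
  L = zero , s
  R = fromℕ w , s
  O = zero , zero
  ρ : Vec ℕ 7
  ρ = toℕ xE ∷ toℕ yE ∷ toℕ xF ∷ toℕ yF ∷ p ∷ k ∷ toℕ s ∷ []
  atL : ∀ P → D E F P L ≡ d P L
  atL P = let h , h′ = balanced-odd (ρ Vec.++ 0 ∷ []) hx hy hs refl in D-balanced E F P L h h′
  atR : ∀ P → D E F P R ≡ d P R ⊓ (d P E + 1 + d F R)
  atR P = D-oneway′ E F P R (proj₁ (towards-odd (ρ Vec.++ 0 ∷ toℕ (fromℕ w) ∷ []) hx hy hs refl (toℕ≤ xF)))
  atO : ∀ P → D E F P O ≡ d P O ⊓ (d P F + 1 + d E O)
  atO P = D-oneway E F P O (proj₂ (towards-odd (ρ Vec.++ 0 ∷ toℕ (fromℕ w) ∷ []) hx hy hs refl (toℕ≤ xF)))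
  separate : ∀ A B → toℕ (proj₂ A) ≤ toℕ (proj₂ B) → All (λ X → D E F A X ≡ D E F B X) (L ∷ R ∷ O ∷ []) → A ≡ B
  separate A@(x , y) B@(x′ , y′) y≤y′ (eqL ∷ eqR ∷ eqO ∷ []) = vertex-≡
    (odd-separates (toℕ xE) (toℕ yE) (toℕ xF) (toℕ yF) p k (toℕ s) (toℕ x) (toℕ y) (toℕ x′) (toℕ y′) (toℕ (fromℕ w))
      1≤p hx hy hs
      (toℕ≤ xF) (toℕ≤ x) (toℕ≤ x′) y≤y′
      (trans (sym (atL A)) (trans eqL (atL B)))
      (trans (sym (atR A)) (trans eqR (atR B)))
      (trans (sym (atO A)) (trans eqO (atO B))))

-- The gain is 2 k.
module Even (E F : V (suc w)) (p k : ℕ) (1≤p : 1 ≤ p) (hx : toℕ (proj₁ F) ≡ toℕ (proj₁ E) + p)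
            (hy : toℕ (proj₂ F) ≡ toℕ (proj₂ E) + p + 1 + 2 * k) where

  private
    xE = proj₁ E
    yE = proj₂ E
    xF = proj₁ F
    yF = proj₂ F
    row₁ = fin yF (toℕ yE + k + 1) (subst (toℕ yE + k + 1 ≤_) (sym hy) (arith
      (Goal 3 λ b p k → b :+ k :+ con 1 :≤ b :+ p :+ con 1 :+ 2 :* k) tt (toℕ yE ∷ p ∷ k ∷ [])))
    row₂ = fin yF (toℕ (proj₁ row₁) + p) (subst (toℕ (proj₁ row₁) + p ≤_) (sym hy)
      (subst (λ t → t + p ≤ toℕ yE + p + 1 + 2 * k) (sym (proj₂ row₁)) (arith
      (Goal 3 λ b p k → b :+ k :+ con 1 :+ p :≤ b :+ p :+ con 1 :+ 2 :* k) tt (toℕ yE ∷ p ∷ k ∷ []))))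
    t = proj₁ row₁
    s = proj₁ row₂
    ht = proj₂ row₁
    hs = proj₂ row₂
    L₁ L₂ R₁ R₂ : V (suc w)
    L₁ = zero , t
    L₂ = zero , s
    R₁ = fromℕ w , t
    R₂ = fromℕ w , s
    ρ : Vec ℕ 8
    ρ = toℕ xE ∷ toℕ yE ∷ toℕ xF ∷ toℕ yF ∷ p ∷ k ∷ toℕ t ∷ toℕ s ∷ []
    σ : Vec ℕ 10
    σ = ρ Vec.++ 0 ∷ toℕ (fromℕ w) ∷ []
    atL₂ : ∀ P → D E F P L₂ ≡ d P L₂
    atL₂ P = let (h , h′) , _ = balanced-even σ hx hy ht hs refl (toℕ≤ xF) in D-balanced E F P L₂ h h′
    atR₁ : ∀ P → D E F P R₁ ≡ d P R₁
    atR₁ P = let _ , h , h′ = balanced-even σ hx hy ht hs refl (toℕ≤ xF) in D-balanced E F P R₁ h h′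
    atL₁ : ∀ P → D E F P L₁ ≡ d P L₁ ⊓ (d P F + 1 + d E L₁)
    atL₁ P = D-oneway E F P L₁ (proj₁ (towards-even σ 1≤p hx hy ht hs refl (toℕ≤ xF)))
    atR₂ : ∀ P → D E F P R₂ ≡ d P R₂ ⊓ (d P E + 1 + d F R₂)
    atR₂ P = D-oneway′ E F P R₂ (proj₂ (towards-even σ 1≤p hx hy ht hs refl (toℕ≤ xF)))

  resolving₄ : Res 4 E F
  resolving₄ = L₂ ∷ R₁ ∷ L₁ ∷ R₂ ∷ [] , ℕₚ.≤-refl , resolving-ordered E F _ separate
    where
    separate : ∀ A B → toℕ (proj₂ A) ≤ toℕ (proj₂ B) →
      All (λ X → D E F A X ≡ D E F B X) (L₂ ∷ R₁ ∷ L₁ ∷ R₂ ∷ []) → A ≡ B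
    separate A@(x , y) B@(x′ , y′) y≤y′ (eqL₂ ∷ eqR₁ ∷ eqL₁ ∷ eqR₂ ∷ []) = vertex-≡
      (even₄-separates (toℕ xE) (toℕ yE) (toℕ xF) (toℕ yF) p k (toℕ t) (toℕ s) (toℕ x) (toℕ y) (toℕ x′) (toℕ y′) (toℕ (fromℕ w))
        1≤p hx hy ht hs
        (toℕ≤ xF) (toℕ≤ x) (toℕ≤ x′) y≤y′
        (trans (sym (atL₂ A)) (trans eqL₂ (atL₂ B)))
        (trans (sym (atR₁ A)) (trans eqR₁ (atR₁ B)))
        (trans (sym (atL₁ A)) (trans eqL₁ (atL₁ B)))
        (trans (sym (atR₂ A)) (trans eqR₂ (atR₂ B))))

  resolving₃ : p ≤ k + 1 → Res 3 E F
  resolving₃ p≤k+1 = L₂ ∷ R₁ ∷ L₁ ∷ [] , ℕₚ.≤-refl , resolving-ordered E F _ separate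
    where
    separate : ∀ A B → toℕ (proj₂ A) ≤ toℕ (proj₂ B) →
      All (λ X → D E F A X ≡ D E F B X) (L₂ ∷ R₁ ∷ L₁ ∷ []) → A ≡ B
    separate A@(x , y) B@(x′ , y′) y≤y′ (eqL₂ ∷ eqR₁ ∷ eqL₁ ∷ []) = vertex-≡
      (even₃-separates (toℕ xE) (toℕ yE) (toℕ xF) (toℕ yF) p k (toℕ t) (toℕ s) (toℕ x) (toℕ y) (toℕ x′) (toℕ y′) (toℕ (fromℕ w))
        1≤p p≤k+1 hx hy ht hs
        (toℕ≤ xF) (toℕ≤ x) (toℕ≤ x′) y≤y′
        (trans (sym (atL₂ A)) (trans eqL₂ (atL₂ B)))
        (trans (sym (atR₁ A)) (trans eqR₁ (atR₁ B)))
        (trans (sym (atL₁ A)) (trans eqL₁ (atL₁ B))))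

-- p and q stand for the smaller and the larger coordinate difference.
Few : ℕ → ℕ → Set
Few p q = (∃[ k ] q ≡ p + 2 + 2 * k) ⊎ (∃[ k ] (q ≡ p + 1 + 2 * k × p ≤ k + 1))

Bound : ℕ → ℕ → V n → V n → Set
Bound p q E F = Res 4 E F × (Few p q → Res 3 E F)

parity : ∀ i → (∃[ k ] i ≡ 2 * k) ⊎ (∃[ k ] i ≡ 1 + 2 * k)
parity zero    = inj₁ (0 , refl)
parity (suc i) with parity i
... | inj₁ (k , refl) = inj₂ (k , refl)
... | inj₂ (k , refl) = inj₁ (suc k , cong suc (sym (ℕₚ.+-suc k (k + 0))))

bound-ordered : (E F : V n) (p q : ℕ) → 1 ≤ p → p < q → toℕ (proj₁ F) ≡ toℕ (proj₁ E) + p →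
  toℕ (proj₂ F) ≡ toℕ (proj₂ E) + q → Bound p q E F
-- `q ∸ suc p` is the gain.
bound-ordered {suc w} E F p q 1≤p p<q hx hy with parity (q ∸ suc p) 
... | inj₁ (k , eq) = Even.resolving₄ E F p k 1≤p hx hy′ , λ
  { (inj₁ (k′ , eq′)) → ⊥-elim (clash (p ∷ q ∷ k ∷ k′ ∷ []) q≡ eq′)
  ; (inj₂ (k′ , eq′ , p≤)) → Even.resolving₃ E F p k 1≤p hx hy′
      (subst (λ i → p ≤ i + 1) (sym (same (p ∷ q ∷ k ∷ k′ ∷ []) q≡ eq′)) p≤) }
  where
  q≡ : q ≡ p + 1 + 2 * k
  q≡ = trans (sym (ℕₚ.m+[n∸m]≡n p<q)) (cong₂ _+_ (ℕₚ.+-comm 1 p) eq)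
  hy′ = trans hy (trans (cong (toℕ (proj₂ E) +_) q≡) (arith
    (Goal 3 λ b p k → b :+ (p :+ con 1 :+ 2 :* k) :≡ b :+ p :+ con 1 :+ 2 :* k) tt (toℕ (proj₂ E) ∷ p ∷ k ∷ [])))
  clash = arith (Goal 4 λ p q k k′ → q :≡ p :+ con 1 :+ 2 :* k :⇒ q :≡ p :+ con 2 :+ 2 :* k′ :⇒ :⊥) tt
  same = arith (Goal 4 λ p q k k′ → q :≡ p :+ con 1 :+ 2 :* k :⇒ q :≡ p :+ con 1 :+ 2 :* k′ :⇒ k :≡ k′) tt
... | inj₂ (k , eq) = (let R , l , r = R₃ in R , ℕₚ.m≤n⇒m≤1+n l , r) , λ _ → R₃
  where
  q≡ : q ≡ p + 2 + 2 * k
  q≡ = trans (sym (ℕₚ.m+[n∸m]≡n p<q)) (trans (cong (suc p +_) eq) (arith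
    (Goal 2 λ p k → con 1 :+ p :+ (con 1 :+ 2 :* k) :≡ p :+ con 2 :+ 2 :* k) tt (p ∷ k ∷ [])))
  R₃ = resolving-odd E F p k 1≤p hx (trans hy (trans (cong (toℕ (proj₂ E) +_) q≡) (arith
    (Goal 3 λ b p k → b :+ (p :+ con 2 :+ 2 :* k) :≡ b :+ p :+ con 2 :+ 2 :* k) tt (toℕ (proj₂ E) ∷ p ∷ k ∷ []))))

-- Symmetries and reduction to the ordered case

record Symmetry (n : ℕ) : Set where
  field
    map        : V n → V n
    involutive : ∀ A → map (map A) ≡ A
    isometric  : ∀ A B → d (map A) (map B) ≡ d A B

  D-map : ∀ E F P X → D (map E) (map F) (map P) (map X) ≡ D E F P X
  D-map E F P X = cong₂ _⊓_ (cong₂ _⊓_ (isometric P X) (cong₂ _+_ (cong (_+ 1) (isometric P E)) (isometric F X)))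
    (cong₂ _+_ (cong (_+ 1) (isometric P F)) (isometric E X))

  injective : ∀ A B → map A ≡ map B → A ≡ B
  injective A B h = trans (sym (involutive A)) (trans (cong map h) (involutive B))

  Res-map : ∀ {k} E F → Res k (map E) (map F) → Res k E F
  Res-map {k} E F (R , l , res) = List.map map R , subst (_≤ k) (sym (Listₚ.length-map map R)) l , λ A B same →
    injective A B (res (map A) (map B) (All.map (λ {X} eq →
      trans (moved A X) (trans eq (sym (moved B X)))) (Allₚ.map⁻ same)))
    where
    moved : ∀ A X → D (map E) (map F) (map A) X ≡ D E F A (map X)
    moved A X = trans (cong (D (map E) (map F) (map A)) (sym (involutive X))) (D-map E F A (map X))

transposition : Symmetry n
transposition = record
  { map        = λ (x , y) → y , x
  ; involutive = λ _ → refl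
  ; isometric  = λ (x , y) (x′ , y′) → ℕₚ.+-comm ∣ toℕ y - toℕ y′ ∣ _
  }

opposite-∣-∣ : (x y : Fin n) → ∣ toℕ (opposite x) - toℕ (opposite y) ∣ ≡ ∣ toℕ x - toℕ y ∣
opposite-∣-∣ {suc w} x y rewrite Finₚ.opposite-prop x | Finₚ.opposite-prop y =
  arith (Goal 5 λ x y x′ y′ w → x′ :+ x :≡ w :⇒ y′ :+ y :≡ w :⇒ ∣ x′ :- y′ ∣ :≡ ∣ x :- y ∣) tt
    (toℕ x ∷ toℕ y ∷ w ∸ toℕ x ∷ w ∸ toℕ y ∷ w ∷ []) (ℕₚ.m∸n+n≡m (Finₚ.toℕ≤pred[n] x)) (ℕₚ.m∸n+n≡m (Finₚ.toℕ≤pred[n] y))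

opposite-+ : (x y : Fin n) {p : ℕ} → toℕ y ≡ toℕ x + p → toℕ (opposite x) ≡ toℕ (opposite y) + p
opposite-+ {suc w} x y {p} h rewrite Finₚ.opposite-prop x | Finₚ.opposite-prop y =
  arith (Goal 6 λ x y x′ y′ w p → x′ :+ x :≡ w :⇒ y′ :+ y :≡ w :⇒ y :≡ x :+ p :⇒ x′ :≡ y′ :+ p) tt
    (toℕ x ∷ toℕ y ∷ w ∸ toℕ x ∷ w ∸ toℕ y ∷ w ∷ p ∷ []) (ℕₚ.m∸n+n≡m (Finₚ.toℕ≤pred[n] x)) (ℕₚ.m∸n+n≡m (Finₚ.toℕ≤pred[n] y)) h

reflection : Symmetry n
reflection = record
  { map        = λ (x , y) → opposite x , y
  ; involutive = λ (x , y) → cong (_, y) (Finₚ.opposite-involutive x)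
  ; isometric  = λ (x , y) (x′ , y′) → cong (_+ ∣ toℕ y - toℕ y′ ∣) (opposite-∣-∣ x x′)
  }

Bound-map : (S : Symmetry n) (E F : V n) {p q : ℕ} → Bound p q (Symmetry.map S E) (Symmetry.map S F) → Bound p q E F
Bound-map S E F (r , r′) = Symmetry.Res-map S E F r , λ f → Symmetry.Res-map S E F (r′ f)

Res-swap : {k : ℕ} (E F : V n) → Res k F E → Res k E F
Res-swap E F (R , l , res) = R , l , λ A B same → res A B (All.map (λ {X} eq →
  trans (D-swap E F A X) (trans eq (sym (D-swap E F B X)))) same)

∣-∣-split : ∀ x x′ {p} → ∣ x - x′ ∣ ≡ p → (x′ ≡ x + p) ⊎ (x ≡ x′ + p)
∣-∣-split x x′ {p} = arith (Goal 3 λ x x′ p → ∣ x :- x′ ∣ :≡ p :⇒ (x′ :≡ x :+ p) :∨ (x :≡ x′ :+ p)) tt (x ∷ x′ ∷ p ∷ [])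

bound-x : (E F : V n) (p q : ℕ) → 1 ≤ p → p < q → toℕ (proj₂ F) ≡ toℕ (proj₂ E) + q → dx E F ≡ p → Bound p q E F
bound-x E@(x , y) F@(x′ , y′) p q 1≤p p<q hy hx with ∣-∣-split (toℕ x) (toℕ x′) hx
... | inj₁ h = bound-ordered E F p q 1≤p p<q h hy
... | inj₂ h = Bound-map reflection E F (bound-ordered (opposite x , y) (opposite x′ , y′) p q 1≤p p<q flipped hy)
  where
  flipped : toℕ (opposite x′) ≡ toℕ (opposite x) + p
  flipped = opposite-+ x′ x h

bound-< : (E F : V n) (p q : ℕ) → 1 ≤ p → p < q → dx E F ≡ p → dy E F ≡ q → Bound p q E F
bound-< E@(x , y) F@(x′ , y′) p q 1≤p p<q hx hy with ∣-∣-split (toℕ y′) (toℕ y) hy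
... | inj₂ h = bound-x E F p q 1≤p p<q h hx
... | inj₁ h = let r , r′ = bound-x F E p q 1≤p p<q h (trans (ℕₚ.∣-∣-comm (toℕ x′) (toℕ x)) hx) in
  Res-swap E F r , λ f → Res-swap E F (r′ f)

bound : (E F : V n) → 1 ≤ dx E F → 1 ≤ dy E F → dx E F ≢ dy E F →
  Bound (dx E F ⊓ dy E F) (dx E F ℕ.⊔ dy E F) E F
bound E@(x , y) F@(x′ , y′) 1≤p 1≤q p≢q with ℕₚ.<-cmp (dx E F) (dy E F)
... | tri< p<q _ _ rewrite ℕₚ.m≤n⇒m⊓n≡m (ℕₚ.<⇒≤ p<q) | ℕₚ.m≤n⇒m⊔n≡n (ℕₚ.<⇒≤ p<q) =
  bound-< E F (dx E F) (dy E F) 1≤p p<q refl refl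
... | tri≈ _ p≡q _ = ⊥-elim (p≢q p≡q)
... | tri> _ _ q<p rewrite ℕₚ.m≥n⇒m⊓n≡n (ℕₚ.<⇒≤ q<p) | ℕₚ.m≥n⇒m⊔n≡m (ℕₚ.<⇒≤ q<p) =
  Bound-map transposition E F (bound-< (y , x) (y′ , x′) (dy E F) (dx E F) 1≤q q<p
    (ℕₚ.∣-∣-comm (toℕ y) (toℕ y′)) (ℕₚ.∣-∣-comm (toℕ x′) (toℕ x)))

-- Lower bound

-- Each neighbour of `(x , y)` is one step closer to `(u , v)` or one step farther than `(x , y)`
-- itself, so among four neighbours two agree.
neighbour-pair = arith (Goal 8 λ x y u v l r b t → l :+ con 1 :≡ x :⇒ x :+ con 1 :≡ r :⇒ b :+ con 1 :≡ y :⇒ y :+ con 1 :≡ t :⇒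
  own l y u v :≡ own r y u v :∨ own x b u v :≡ own x t u v :∨ own l y u v :≡ own x b u v :∨
  own l y u v :≡ own x t u v :∨ own r y u v :≡ own x b u v :∨ own r y u v :≡ own x t u v) tt

genericᶠ : Tm n → Tm n → Tm n → Tm n → Fm n
genericᶠ a b c e = con 3 :≤ ∣ a :- c ∣ :∧ con 3 :≤ ∣ b :- e ∣ :∧ con 3 :≤ ∣ ∣ b :- e ∣ :- ∣ a :- c ∣ ∣

closeᶠ : Tm n → Tm n → Tm n → Tm n → Tm n → Tm n → Fm n
closeᶠ a b c e x y = own a b x y :≤ own c e x y :+ con 2 :∧ own c e x y :≤ own a b x y :+ con 2

-- Seen from a corner, the distances to the endpoints differ by the sum or by the difference of the
-- two coordinate differences, and both are at least 3.
not-corner = arith (Goal 8 λ a b c e x y z w →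
  genericᶠ a b c e :⇒ a :≤ w :∧ b :≤ w :∧ c :≤ w :∧ e :≤ w :⇒ z :≡ con 0 :⇒ 
  (x :≡ z :∨ x :≡ w) :⇒ (y :≡ z :∨ y :≡ w) :⇒ closeᶠ a b c e x y :⇒ :⊥) tt

-- A landmark that is not a corner lies on at most one side, and so spoils only the two corners of
-- this side. Two landmarks spoil all four corners only from opposite sides.
sides = arith (Goal 5 λ x y u v w → con 1 :≤ w :⇒ x :≤ w :∧ y :≤ w :∧ u :≤ w :∧ v :≤ w :⇒
  ((x :≡ con 0 :∨ x :≡ w) :⇒ (y :≡ con 0 :∨ y :≡ w) :⇒ :⊥) :⇒
  ((u :≡ con 0 :∨ u :≡ w) :⇒ (v :≡ con 0 :∨ v :≡ w) :⇒ :⊥) :⇒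
  ((con 1 :≤ x :∧ con 1 :≤ y) :∧ (con 1 :≤ u :∧ con 1 :≤ v)) :∨ ((x :< w :∧ con 1 :≤ y) :∧ (u :< w :∧ con 1 :≤ v)) :∨
  ((con 1 :≤ x :∧ y :< w) :∧ (con 1 :≤ u :∧ v :< w)) :∨ ((x :< w :∧ y :< w) :∧ (u :< w :∧ v :< w)) :∨
  (y :≡ con 0 :∧ v :≡ w) :∨ (y :≡ w :∧ v :≡ con 0) :∨ (x :≡ con 0 :∧ u :≡ w) :∨ (x :≡ w :∧ u :≡ con 0)) tt

-- Compare the difference of the distances to the two endpoints at `(x , 0)` and at `(u , w)`. For
-- `x` equal to `u` these two numbers would be at least 6 apart, as the rows of the endpoints differ
-- by 3 or more; yet both lie between -2 and 2.
distinct-columns = arith (Goal 8 λ a b c e x u z w → genericᶠ a b c e :⇒ b :≤ w :∧ e :≤ w :⇒ z :≡ con 0 :⇒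
  closeᶠ a b c e x z :⇒ closeᶠ a b c e u w :⇒ u :< x :∨ x :< u) tt

-- Let P be `(g , h)`, X be `(x , z)` and Y be `(u , w)`; P lies on a shortest path from X to Y. If
-- the detour from `E` to `F` were shorter, closeness of Y would put `E` on a shortest path from P
-- to Y, with `F` closer to Y by exactly 2. By closeness of X and the triangle inequality, `F` would
-- then lie in the rectangle spanned by X and Y too. There a lead of 2 forces the two coordinate
-- differences of `E` and `F` to be at most 2 apart, against genericity. The other direction is
-- alike.
unaffected-left = arith (Goal 10 λ a b c e x u z w g h → genericᶠ a b c e :⇒ b :≤ w :∧ e :≤ w :⇒ z :≡ con 0 :⇒
  u :< x :⇒ (g :+ con 1 :≡ x :∧ h :≡ z) :∨ (g :≡ x :∧ h :≡ con 1) :⇒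
  con 1 :≤ b :⇒ con 1 :≤ e :⇒ closeᶠ a b c e x z :⇒ closeᶠ a b c e u w :⇒
  own g h u w :≤ own g h a b :+ con 1 :+ own c e u w :∧ own g h u w :≤ own g h c e :+ con 1 :+ own a b u w) tt

unaffected-right = arith (Goal 10 λ a b c e x u z w g h → genericᶠ a b c e :⇒ b :≤ w :∧ e :≤ w :⇒ z :≡ con 0 :⇒
  x :< u :⇒ (x :+ con 1 :≡ g :∧ h :≡ z) :∨ (g :≡ x :∧ h :≡ con 1) :⇒
  con 1 :≤ b :⇒ con 1 :≤ e :⇒ closeᶠ a b c e x z :⇒ closeᶠ a b c e u w :⇒
  own g h u w :≤ own g h a b :+ con 1 :+ own c e u w :∧ own g h u w :≤ own g h c e :+ con 1 :+ own a b u w) tt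

Interior : V (suc w) → Set
Interior {w} (x , y) = (1 ≤ toℕ x × toℕ x < toℕ (fromℕ w)) × (1 ≤ toℕ y × toℕ y < toℕ (fromℕ w))

Generic : V n → V n → Set
Generic E F = 3 ≤ dx E F × 3 ≤ ∣ toℕ (proj₂ E) - toℕ (proj₂ F) ∣ × 3 ≤ ∣ ∣ toℕ (proj₂ E) - toℕ (proj₂ F) ∣ - dx E F ∣

Close : V n → V n → V n → Set
Close E F X = d E X ≤ d F X + 2 × d F X ≤ d E X + 2

Confused : (E F X Y : V n) → Set
Confused E F X Y = ∃[ A ] ∃[ B ] (A ≢ B × D E F A X ≡ D E F B X × D E F A Y ≡ D E F B Y)

confused-swap : {E F X Y : V n} → Confused E F X Y → Confused F E X Y
confused-swap {E = E} {F} {X} {Y} (A , B , A≢B , p , q) = A , B , A≢B ,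
  trans (D-swap E F A X) (trans p (sym (D-swap E F B X))) , trans (D-swap E F A Y) (trans q (sym (D-swap E F B Y)))

confused-sym : {E F X Y : V n} → Confused E F X Y → Confused E F Y X
confused-sym (A , B , A≢B , p , q) = A , B , A≢B , q , p

before : (x : Fin (suc w)) → 1 ≤ toℕ x → ∃[ l ] toℕ {suc w} l + 1 ≡ toℕ x
before x 1≤x = let l , h = fin x (toℕ x ∸ 1) (ℕₚ.m∸n≤m _ 1) in l , trans (cong (_+ 1) h) (ℕₚ.m∸n+n≡m 1≤x)

after : (x : Fin (suc w)) → toℕ x < toℕ (fromℕ w) → ∃[ r ] toℕ x + 1 ≡ toℕ {suc w} r
after {w} x x<w = let r , h = fin (fromℕ w) (suc (toℕ x)) x<w in r , trans (ℕₚ.+-comm (toℕ x) 1) (sym h)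

differ-x : {A B : V n} → toℕ (proj₁ A) ≢ toℕ (proj₁ B) → A ≢ B
differ-x h refl = h refl

differ-y : {A B : V n} → toℕ (proj₂ A) ≢ toℕ (proj₂ B) → A ≢ B
differ-y h refl = h refl

≢-before : ∀ {a b} → a + 1 ≡ b → a ≢ b
≢-before {a} {b} = arith (Goal 2 λ a b → a :+ con 1 :≡ b :⇒ a :≡ b :⇒ :⊥) tt (a ∷ b ∷ [])

≢-two-before : ∀ {a b c} → a + 1 ≡ b → b + 1 ≡ c → a ≢ c
≢-two-before {a} {b} {c} = arith (Goal 3 λ a b c → a :+ con 1 :≡ b :⇒ b :+ con 1 :≡ c :⇒ a :≡ c :⇒ :⊥) tt (a ∷ b ∷ c ∷ [])

-- Towards a landmark X that gains at least 2 from the edge, all neighbours of the far endpoint are reached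
-- through it, and for every Y two of the four neighbours are equidistant.
far-endpoint : (E F X Y : V (suc w)) → Interior F → d E X + 3 ≤ d F X → Confused E F X Y
far-endpoint E F@(x , y) X Y@(u , v) ((1≤x , x<w) , (1≤y , y<w)) far =
  pick (neighbour-pair (toℕ x ∷ toℕ y ∷ toℕ u ∷ toℕ v ∷ toℕ l ∷ toℕ r ∷ toℕ b ∷ toℕ t ∷ []) hl hr hb ht)
  where
  l = proj₁ (before x 1≤x)
  hl = proj₂ (before x 1≤x)
  r = proj₁ (after x x<w)
  hr = proj₂ (after x x<w)
  b = proj₁ (before y 1≤y)
  hb = proj₂ (before y 1≤y)
  t = proj₁ (after y y<w)
  ht = proj₂ (after y y<w)
  toX : ∀ P → d P F ≡ 1 → D E F P X ≡ 2 + d E X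
  toX P h = arith (Goal 5 λ px pe fx pf ex → pf :≡ con 1 :⇒ fx :≤ pf :+ px :⇒ ex :+ con 3 :≤ fx :⇒
    px :⊓ (pe :+ con 1 :+ fx) :⊓ (pf :+ con 1 :+ ex) :≡ con 2 :+ ex) tt
    (d P X ∷ d P E ∷ d F X ∷ d P F ∷ d E X ∷ []) h (subst (λ k → d F X ≤ k + d P X) (d-sym F P) (d-triangle F P X)) far
  toY : ∀ P → d P F ≡ 1 → D E F P Y ≡ d P Y ⊓ (2 + d E Y)
  toY P h = arith (Goal 5 λ py pe fy pf ey → pf :≡ con 1 :⇒ py :≤ pf :+ fy :⇒
    py :⊓ (pe :+ con 1 :+ fy) :⊓ (pf :+ con 1 :+ ey) :≡ py :⊓ (con 2 :+ ey)) tt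
    (d P Y ∷ d P E ∷ d F Y ∷ d P F ∷ d E Y ∷ []) h (d-triangle P F Y)
  confuse : ∀ A B → A ≢ B → d A F ≡ 1 → d B F ≡ 1 → d A Y ≡ d B Y → Confused E F X Y
  confuse A B A≢B hA hB eq = A , B , A≢B , trans (toX A hA) (sym (toX B hB)) ,
    trans (toY A hA) (trans (cong (_⊓ (2 + d E Y)) eq) (sym (toY B hB)))
  unit-left : ∀ {i j} → i + 1 ≡ j → ∣ i - j ∣ ≡ 1
  unit-left {i} {j} = arith (Goal 2 λ i j → i :+ con 1 :≡ j :⇒ ∣ i :- j ∣ :≡ con 1) tt (i ∷ j ∷ [])
  horizontal : ∀ z → ∣ toℕ z - toℕ x ∣ ≡ 1 → d (z , y) F ≡ 1
  horizontal z h = cong₂ _+_ h (ℕₚ.∣n-n∣≡0 (toℕ y))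
  vertical : ∀ z → ∣ toℕ z - toℕ y ∣ ≡ 1 → d (x , z) F ≡ 1
  vertical z h = cong₂ _+_ (ℕₚ.∣n-n∣≡0 (toℕ x)) h
  dl : d (l , y) F ≡ 1
  dl = horizontal l (unit-left hl)
  dr : d (r , y) F ≡ 1
  dr = horizontal r (trans (ℕₚ.∣-∣-comm (toℕ r) (toℕ x)) (unit-left hr))
  db : d (x , b) F ≡ 1
  db = vertical b (unit-left hb)
  dt : d (x , t) F ≡ 1
  dt = vertical t (trans (ℕₚ.∣-∣-comm (toℕ t) (toℕ y)) (unit-left ht))
  pick : _ → Confused E F X Y
  pick (inj₁ eq) = confuse (l , y) (r , y) (differ-x (≢-two-before hl hr)) dl dr eq
  pick (inj₂ (inj₁ eq)) = confuse (x , b) (x , t) (differ-y (≢-two-before hb ht)) db dt eq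
  pick (inj₂ (inj₂ (inj₁ eq))) = confuse (l , y) (x , b) (differ-x (≢-before hl)) dl db eq
  pick (inj₂ (inj₂ (inj₂ (inj₁ eq)))) = confuse (l , y) (x , t) (differ-x (≢-before hl)) dl dt eq
  pick (inj₂ (inj₂ (inj₂ (inj₂ (inj₁ eq))))) = confuse (r , y) (x , b) (differ-x (≢-before hr ∘ sym)) dr db eq
  pick (inj₂ (inj₂ (inj₂ (inj₂ (inj₂ eq))))) = confuse (r , y) (x , t) (differ-x (≢-before hr ∘ sym)) dr dt eq

-- i is the neighbour of the extremal coordinate c, and z lies beyond it.
Beyond : (c i z : Fin n) → Set
Beyond c i z = ∣ toℕ i - toℕ z ∣ + 1 ≡ ∣ toℕ c - toℕ z ∣

_∈₄_ : V n → V n × V n × V n × V n → Set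
Z ∈₄ (E , F , X , Y) = Z ≡ E ⊎ Z ≡ F ⊎ Z ≡ X ⊎ Z ≡ Y

-- The two neighbours of a corner have equal grid distance to every vertex off its two sides. This
-- applies to the endpoints of the edge as well, so the detours agree too.
corner : (c i c′ i′ : Fin n) → toℕ i ≢ toℕ c → (E F X Y : V n) →
  (∀ Z → Z ∈₄ (E , F , X , Y) → Beyond c i (proj₁ Z) × Beyond c′ i′ (proj₂ Z)) → Confused E F X Y
corner c i c′ i′ i≢c E F X Y far = (i , c′) , (c , i′) , differ-x i≢c , at X (inj₂ (inj₂ (inj₁ refl))) , at Y (inj₂ (inj₂ (inj₂ refl)))
  where
  level : ∀ Z → Z ∈₄ (E , F , X , Y) → d (i , c′) Z ≡ d (c , i′) Z
  level Z Z∈ = let h , h′ = far Z Z∈ in arith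
    (Goal 4 λ i c i′ c′ → i :+ con 1 :≡ c :⇒ i′ :+ con 1 :≡ c′ :⇒ i :+ c′ :≡ c :+ i′) tt (_ ∷ _ ∷ _ ∷ _ ∷ []) h h′
  at : ∀ Z → Z ∈₄ (E , F , X , Y) → D E F (i , c′) Z ≡ D E F (c , i′) Z
  at Z Z∈ = cong₂ _⊓_ (cong₂ _⊓_ (level Z Z∈) (cong (λ k → k + 1 + d F Z) (level E (inj₁ refl))))
    (cong (λ k → k + 1 + d E Z) (level F (inj₂ (inj₁ refl))))

-- The confused vertices are the neighbour of `X` along its side in the direction of `Y` and the
-- neighbour of `X` perpendicular to the side. Both are one step from `X` and one step closer to
-- `Y`, and neither profits towards `Y`. The direction exists because the columns of `X` and `Y`
-- differ.
opposite-sides : (E F X Y : V (suc w)) → Interior E → Interior F → Generic E F → Close E F X → Close E F Y →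
  1 ≤ toℕ (proj₁ X) → toℕ (proj₁ X) < toℕ (fromℕ w) → toℕ (proj₂ X) ≡ 0 → toℕ (proj₂ Y) ≡ toℕ (fromℕ w) → Confused E F X Y
opposite-sides {w} E@(a , b) F@(c , e) X@(x , z) Y@(u , v) (_ , 1≤b , b<w) (_ , 1≤e , e<w) gen close close′ 1≤x x<w hz hv =
  [ left , right ]′ (distinct-columns σ gen (ℕₚ.<⇒≤ b<w′ , ℕₚ.<⇒≤ e<w′) hz close close′)
  where
  b<w′ = subst (toℕ b <_) (sym hv) b<w
  e<w′ = subst (toℕ e <_) (sym hv) e<w
  σ : Vec ℕ 8
  σ = toℕ a ∷ toℕ b ∷ toℕ c ∷ toℕ e ∷ toℕ x ∷ toℕ u ∷ toℕ z ∷ toℕ v ∷ []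
  above = fin (fromℕ w) 1 (ℕₚ.≤-trans 1≤x (ℕₚ.<⇒≤ x<w))
  j = proj₁ above
  hj = proj₂ above
  toX : ∀ P → d P X ≡ 1 → D E F P X ≡ 1
  toX P h = arith (Goal 5 λ px pe fx pf ex → px :≡ con 1 :⇒
    px :⊓ (pe :+ con 1 :+ fx) :⊓ (pf :+ con 1 :+ ex) :≡ con 1) tt (d P X ∷ d P E ∷ d F X ∷ d P F ∷ d E X ∷ []) h
  toY : ∀ P → d P Y ≤ d P E + 1 + d F Y × d P Y ≤ d P F + 1 + d E Y → D E F P Y ≡ d P Y
  toY P (h , h′) = trans (cong (_⊓ (d P F + 1 + d E Y)) (ℕₚ.m≤n⇒m⊓n≡m h)) (ℕₚ.m≤n⇒m⊓n≡m h′)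
  confuse : ∀ i → ∣ toℕ i - toℕ x ∣ ≡ 1 → d (i , z) Y ≡ d (x , j) Y →
    d (i , z) Y ≤ d (i , z) E + 1 + d F Y × d (i , z) Y ≤ d (i , z) F + 1 + d E Y →
    d (x , j) Y ≤ d (x , j) E + 1 + d F Y × d (x , j) Y ≤ d (x , j) F + 1 + d E Y → Confused E F X Y
  confuse i hi eq h h′ = (i , z) , (x , j) , differ-y (λ eq → ℕₚ.0≢1+n (trans (sym hz) (trans eq hj))) ,
    trans (toX (i , z) (cong₂ _+_ hi (ℕₚ.∣n-n∣≡0 (toℕ z))))
      (sym (toX (x , j) (cong₂ _+_ (ℕₚ.∣n-n∣≡0 (toℕ x)) (cong₂ ∣_-_∣ hj hz)))) ,
    trans (toY (i , z) h) (trans eq (sym (toY (x , j) h′)))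
  left : toℕ u < toℕ x → Confused E F X Y
  left u<x = let i , hi = before x 1≤x in confuse i
    (arith (Goal 2 λ i x → i :+ con 1 :≡ x :⇒ ∣ i :- x ∣ :≡ con 1) tt (toℕ i ∷ toℕ x ∷ []) hi)
    (arith (Goal 6 λ i x u z j v → u :< x :⇒ i :+ con 1 :≡ x :⇒ z :≡ con 0 :⇒ j :≡ con 1 :⇒ con 1 :≤ v :⇒
      ∣ i :- u ∣ :+ ∣ z :- v ∣ :≡ ∣ x :- u ∣ :+ ∣ j :- v ∣) tt (toℕ i ∷ toℕ x ∷ toℕ u ∷ toℕ z ∷ toℕ j ∷ toℕ v ∷ [])
      u<x hi hz hj (ℕₚ.≤-trans (s≤s z≤n) b<w′))
    (unaffected-left (σ Vec.++ toℕ i ∷ toℕ z ∷ []) gen (ℕₚ.<⇒≤ b<w′ , ℕₚ.<⇒≤ e<w′) hz u<x (inj₁ (hi , refl)) 1≤b 1≤e close close′)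
    (unaffected-left (σ Vec.++ toℕ x ∷ toℕ j ∷ []) gen (ℕₚ.<⇒≤ b<w′ , ℕₚ.<⇒≤ e<w′) hz u<x (inj₂ (refl , hj)) 1≤b 1≤e close close′)
  right : toℕ x < toℕ u → Confused E F X Y
  right x<u = let i , hi = after x x<w in confuse i
    (arith (Goal 2 λ i x → x :+ con 1 :≡ i :⇒ ∣ i :- x ∣ :≡ con 1) tt (toℕ i ∷ toℕ x ∷ []) hi)
    (arith (Goal 6 λ i x u z j v → x :< u :⇒ x :+ con 1 :≡ i :⇒ z :≡ con 0 :⇒ j :≡ con 1 :⇒ con 1 :≤ v :⇒
      ∣ i :- u ∣ :+ ∣ z :- v ∣ :≡ ∣ x :- u ∣ :+ ∣ j :- v ∣) tt (toℕ i ∷ toℕ x ∷ toℕ u ∷ toℕ z ∷ toℕ j ∷ toℕ v ∷ [])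
      x<u hi hz hj (ℕₚ.≤-trans (s≤s z≤n) b<w′))
    (unaffected-right (σ Vec.++ toℕ i ∷ toℕ z ∷ []) gen (ℕₚ.<⇒≤ b<w′ , ℕₚ.<⇒≤ e<w′) hz x<u (inj₁ (hi , refl)) 1≤b 1≤e close close′)
    (unaffected-right (σ Vec.++ toℕ x ∷ toℕ j ∷ []) gen (ℕₚ.<⇒≤ b<w′ , ℕₚ.<⇒≤ e<w′) hz x<u (inj₂ (refl , hj)) 1≤b 1≤e close close′)

Extremal : Fin (suc w) → Set
Extremal {w} x = toℕ x ≡ 0 ⊎ toℕ x ≡ toℕ (fromℕ w)

inner : (x : Fin (suc w)) → ¬ Extremal x → 1 ≤ toℕ x × toℕ x < toℕ (fromℕ w)
inner x h = ℕₚ.n≢0⇒n>0 (h ∘ inj₁) , ℕₚ.≤∧≢⇒< (toℕ≤ x) (h ∘ inj₂)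

opposite-sides-x : (E F X Y : V (suc w)) → Interior E → Interior F → Generic E F → Close E F X → Close E F Y →
  1 ≤ toℕ (proj₂ X) → toℕ (proj₂ X) < toℕ (fromℕ w) → toℕ (proj₁ X) ≡ 0 → toℕ (proj₁ Y) ≡ toℕ (fromℕ w) → Confused E F X Y
opposite-sides-x E@(a , b) F@(c , e) X@(x , z) Y@(u , v) (iE , iE′) (iF , iF′) (g₁ , g₂ , g₃) close close′ h₁ h₂ h₃ h₄ =
  back (opposite-sides (swap E) (swap F) (swap X) (swap Y) (iE′ , iE) (iF′ , iF)
    (g₂ , g₁ , subst (3 ≤_) (ℕₚ.∣-∣-comm ∣ toℕ b - toℕ e ∣ ∣ toℕ a - toℕ c ∣) g₃) (flip X close) (flip Y close′) h₁ h₂ h₃ h₄)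
  where
  open Symmetry transposition
  flip : ∀ X → Close E F X → Close (swap E) (swap F) (swap X)
  flip X = subst₂ (λ i j → i ≤ j + 2 × j ≤ i + 2) (sym (isometric E X)) (sym (isometric F X))
  back : Confused (swap E) (swap F) (swap X) (swap Y) → Confused E F X Y
  back (A , B , A≢B , p , q) = swap A , swap B , A≢B ∘ cong swap ,
    trans (sym (D-map E F (swap A) X)) (trans p (D-map E F (swap B) X)) ,
    trans (sym (D-map E F (swap A) Y)) (trans q (D-map E F (swap B) Y))

unresolvable : (E F : V (suc w)) → Interior E → Interior F → Generic E F → Unresolvable E F
unresolvable {w} E@(a , b) F@(c , e) iE@((1≤a , a<w) , (1≤b , b<w)) iF@((1≤c , c<w) , (1≤e , e<w)) gen X@(x , y) Y@(u , v)
  with d E X ℕₚ.≤? d F X + 2 | d F X ℕₚ.≤? d E X + 2 | d E Y ℕₚ.≤? d F Y + 2 | d F Y ℕₚ.≤? d E Y + 2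
... | no h | _ | _ | _ = confused-swap (far-endpoint F E X Y iE (beyond h))
  where
  beyond : ∀ {i j} → ¬ i ≤ j + 2 → j + 3 ≤ i
  beyond {i} {j} h = subst (_≤ i) (sym (ℕₚ.+-suc j 2)) (ℕₚ.≰⇒> h)
... | yes _ | no h | _ | _ = far-endpoint E F X Y iF (subst (_≤ d F X) (sym (ℕₚ.+-suc (d E X) 2)) (ℕₚ.≰⇒> h))
... | yes _ | yes _ | no h | _ = confused-sym {E = E} {F} (confused-swap (far-endpoint F E Y X iE (subst (_≤ d E Y) (sym (ℕₚ.+-suc (d F Y) 2)) (ℕₚ.≰⇒> h))))
... | yes _ | yes _ | yes _ | no h = confused-sym {E = E} {F} (far-endpoint E F Y X iF (subst (_≤ d F Y) (sym (ℕₚ.+-suc (d E Y) 2)) (ℕₚ.≰⇒> h)))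
... | yes p | yes p′ | yes q | yes q′ = pick (sides (toℕ x ∷ toℕ y ∷ toℕ u ∷ toℕ v ∷ toℕ W ∷ [])
    1≤w (toℕ≤ x , toℕ≤ y , toℕ≤ u , toℕ≤ v) (not-corner′ X (p , p′)) (not-corner′ Y (q , q′)))
  where
  W : Fin (suc w)
  W = fromℕ w
  1≤w : 1 ≤ toℕ W
  1≤w = ℕₚ.≤-trans 1≤a (ℕₚ.<⇒≤ a<w)
  not-corner′ : ∀ X → Close E F X → Extremal (proj₁ X) → Extremal (proj₂ X) → ⊥
  not-corner′ (x , y) close ex ey = not-corner (toℕ a ∷ toℕ b ∷ toℕ c ∷ toℕ e ∷ toℕ x ∷ toℕ y ∷ 0 ∷ toℕ W ∷ []) gen
    (toℕ≤ a , toℕ≤ b , toℕ≤ c , toℕ≤ e) refl ex ey close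
  one last : Fin (suc w)
  one  = proj₁ (fin W 1 1≤w)
  last = proj₁ (before W 1≤w)
  h1 : toℕ one ≡ 1
  h1 = proj₂ (fin W 1 1≤w)
  hl : toℕ last + 1 ≡ toℕ W
  hl = proj₂ (before W 1≤w)
  low : ∀ z → 1 ≤ toℕ z → Beyond zero one z
  low z = arith (Goal 2 λ i z → i :≡ con 1 :⇒ con 1 :≤ z :⇒ ∣ i :- z ∣ :+ con 1 :≡ ∣ con 0 :- z ∣) tt (toℕ one ∷ toℕ z ∷ []) h1
  high : ∀ z → toℕ z < toℕ W → Beyond W last z
  high z = arith (Goal 3 λ i w z → i :+ con 1 :≡ w :⇒ z :< w :⇒ ∣ i :- z ∣ :+ con 1 :≡ ∣ w :- z ∣) tt (toℕ last ∷ toℕ W ∷ toℕ z ∷ []) hl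
  one≢0 : toℕ one ≢ 0
  one≢0 h = ℕₚ.1+n≢0 (trans (sym h1) h)
  by-corner : ∀ c₁ i₁ c₂ i₂ → toℕ i₁ ≢ toℕ c₁ → (P Q : Fin (suc w) → Set) →
    (∀ z → P z → Beyond c₁ i₁ z) → (∀ z → Q z → Beyond c₂ i₂ z) → P a × Q b → P c × Q e → P x × Q y → P u × Q v → Confused E F X Y
  by-corner c₁ i₁ c₂ i₂ i≢c P Q hP hQ hE hF hX hY = corner c₁ i₁ c₂ i₂ i≢c E F X Y λ
    { Z (inj₁ refl) → hP _ (proj₁ hE) , hQ _ (proj₂ hE)
    ; Z (inj₂ (inj₁ refl)) → hP _ (proj₁ hF) , hQ _ (proj₂ hF)
    ; Z (inj₂ (inj₂ (inj₁ refl))) → hP _ (proj₁ hX) , hQ _ (proj₂ hX)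
    ; Z (inj₂ (inj₂ (inj₂ refl))) → hP _ (proj₁ hY) , hQ _ (proj₂ hY) }
  pos under : Fin (suc w) → Set
  pos z = 1 ≤ toℕ z
  under z = toℕ z < toℕ W
  pick : _ → Confused E F X Y
  pick (inj₁ (hX , hY)) = by-corner zero one zero one one≢0 pos pos low low (1≤a , 1≤b) (1≤c , 1≤e) hX hY
  pick (inj₂ (inj₁ (hX , hY))) = by-corner W last zero one (≢-before hl) under pos high low (a<w , 1≤b) (c<w , 1≤e) hX hY
  pick (inj₂ (inj₂ (inj₁ (hX , hY)))) = by-corner zero one W last one≢0 pos under low high (1≤a , b<w) (1≤c , e<w) hX hY
  pick (inj₂ (inj₂ (inj₂ (inj₁ (hX , hY))))) = by-corner W last W last (≢-before hl) under under high high (a<w , b<w) (c<w , e<w) hX hY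
  pick (inj₂ (inj₂ (inj₂ (inj₂ (inj₁ (h , h′)))))) =
    let i , i′ = inner x (λ ex → not-corner′ X (p , p′) ex (inj₁ h)) in
    opposite-sides E F X Y iE iF gen (p , p′) (q , q′) i i′ h h′
  pick (inj₂ (inj₂ (inj₂ (inj₂ (inj₂ (inj₁ (h , h′))))))) =
    let i , i′ = inner u (λ ex → not-corner′ Y (q , q′) ex (inj₁ h′)) in
    confused-sym {E = E} {F} (opposite-sides E F Y X iE iF gen (q , q′) (p , p′) i i′ h′ h)
  pick (inj₂ (inj₂ (inj₂ (inj₂ (inj₂ (inj₂ (inj₁ (h , h′)))))))) =
    let i , i′ = inner y (λ ey → not-corner′ X (p , p′) (inj₁ h) ey) in
    opposite-sides-x E F X Y iE iF gen (p , p′) (q , q′) i i′ h h′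
  pick (inj₂ (inj₂ (inj₂ (inj₂ (inj₂ (inj₂ (inj₂ (h , h′)))))))) =
    let i , i′ = inner v (λ ey → not-corner′ Y (q , q′) (inj₁ h′) ey) in
    confused-sym {E = E} {F} (opposite-sides-x E F Y X iE iF gen (q , q′) (p , p′) i i′ h′ h)

-- Counting

ι : Bool → ℕ
ι b = if b then 1 else 0

ι-≤1 : ∀ b → ι b ≤ 1
ι-≤1 true  = ℕₚ.≤-refl
ι-≤1 false = z≤n

ι-true : ∀ {b} → T b → ι b ≡ 1
ι-true {true} _ = refl

ι-false : ∀ {b} → ¬ T b → ι b ≡ 0
ι-false {true}  h = ⊥-elim (h tt)
ι-false {false} _ = refl

sumL : {A : Set} → (A → ℕ) → List A → ℕ
sumL f []       = 0
sumL f (x ∷ xs) = f x + sumL f xs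

∑ : ℕ → (ℕ → ℕ) → ℕ
∑ zero    f = 0
∑ (suc n) f = f 0 + ∑ n (f ∘ suc)

syntax ∑ n (λ i → e) = ∑[ i < n ] e

∑-mono : ∀ n {f g : ℕ → ℕ} → (∀ i → f i ≤ g i) → ∑ n f ≤ ∑ n g
∑-mono zero    h = z≤n
∑-mono (suc n) h = ℕₚ.+-mono-≤ (h 0) (∑-mono n (h ∘ suc))

∑-cong : ∀ n {f g : ℕ → ℕ} → (∀ i → f i ≡ g i) → ∑ n f ≡ ∑ n g
∑-cong zero    h = refl
∑-cong (suc n) h = cong₂ _+_ (h 0) (∑-cong n (h ∘ suc))

interchange : ∀ a b c e → (a + b) + (c + e) ≡ (a + c) + (b + e)
interchange = solve-∀

∑-+ : ∀ n (f g : ℕ → ℕ) → ∑[ i < n ] (f i + g i) ≡ ∑ n f + ∑ n g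
∑-+ zero    f g = refl
∑-+ (suc n) f g = trans (cong (f 0 + g 0 +_) (∑-+ n (f ∘ suc) (g ∘ suc))) (interchange (f 0) (g 0) _ _)

∑-* : ∀ n k (f : ℕ → ℕ) → ∑[ i < n ] (k * f i) ≡ k * ∑ n f
∑-* zero    k f = sym (ℕₚ.*-zeroʳ k)
∑-* (suc n) k f = trans (cong (k * f 0 +_) (∑-* n k (f ∘ suc))) (sym (ℕₚ.*-distribˡ-+ k _ _))

∑-const : ∀ n k → ∑[ i < n ] k ≡ n * k
∑-const zero    k = refl
∑-const (suc n) k = cong (k +_) (∑-const n k)

∑-≤ : ∀ n {f : ℕ → ℕ} {k} → (∀ i → f i ≤ k) → ∑ n f ≤ n * k
∑-≤ n {k = k} h = ℕₚ.≤-trans (∑-mono n h) (ℕₚ.≤-reflexive (∑-const n k))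

∑-extend : ∀ {m n} (f : ℕ → ℕ) → m ≤ n → ∑ m f ≤ ∑ n f
∑-extend f z≤n       = z≤n
∑-extend f (s≤s m≤n) = ℕₚ.+-monoʳ-≤ (f 0) (∑-extend (f ∘ suc) m≤n)

∑-comm : ∀ m n (f : ℕ → ℕ → ℕ) → ∑[ i < m ] ∑[ j < n ] f i j ≡ ∑[ j < n ] ∑[ i < m ] f i j
∑-comm zero    n f = sym (trans (∑-const n 0) (ℕₚ.*-zeroʳ n))
∑-comm (suc m) n f = trans (cong (∑ n (f 0) +_) (∑-comm m n (f ∘ suc))) (sym (∑-+ n (f 0) _))

∑-pairs : ∀ m {f g : ℕ → ℕ} → (∀ i → f (i * 2) + f (suc (i * 2)) ≤ g (i * 2) + g (suc (i * 2))) →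
  ∑ (m * 2) f ≤ ∑ (m * 2) g
∑-pairs zero    h = z≤n
∑-pairs (suc m) {f} {g} h = subst₂ _≤_ (ℕₚ.+-assoc (f 0) (f 1) _) (ℕₚ.+-assoc (g 0) (g 1) _)
  (ℕₚ.+-mono-≤ (h 0) (∑-pairs m (h ∘ suc)))

∑⁴ : ℕ → (ℕ → ℕ → ℕ → ℕ → ℕ) → ℕ
∑⁴ n f = ∑[ a < n ] ∑[ b < n ] ∑[ c < n ] ∑[ e < n ] f a b c e

total : (n : ℕ) → (V n → V n → ℕ) → ℕ
total n f = sumL (λ E → sumL (f E) (verts n)) (verts n)

sumL-mono : {A : Set} {f g : A → ℕ} → (∀ x → f x ≤ g x) → ∀ xs → sumL f xs ≤ sumL g xs
sumL-mono h []       = z≤n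
sumL-mono h (x ∷ xs) = ℕₚ.+-mono-≤ (h x) (sumL-mono h xs)

sumL-cong : {A : Set} {f g : A → ℕ} → (∀ x → f x ≡ g x) → ∀ xs → sumL f xs ≡ sumL g xs
sumL-cong h []       = refl
sumL-cong h (x ∷ xs) = cong₂ _+_ (h x) (sumL-cong h xs)

sumL-+ : {A : Set} (f g : A → ℕ) (xs : List A) → sumL (λ x → f x + g x) xs ≡ sumL f xs + sumL g xs
sumL-+ f g []       = refl
sumL-+ f g (x ∷ xs) = trans (cong (f x + g x +_) (sumL-+ f g xs)) (interchange (f x) (g x) _ _)

sumL-++ : {A : Set} (f : A → ℕ) (xs ys : List A) → sumL f (xs ++ ys) ≡ sumL f xs + sumL f ys
sumL-++ f []       ys = refl
sumL-++ f (x ∷ xs) ys = trans (cong (f x +_) (sumL-++ f xs ys)) (sym (ℕₚ.+-assoc (f x) _ _))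

sumL-map : {A B : Set} (f : B → ℕ) (h : A → B) (xs : List A) → sumL f (List.map h xs) ≡ sumL (f ∘ h) xs
sumL-map f h []       = refl
sumL-map f h (x ∷ xs) = cong (f (h x) +_) (sumL-map f h xs)

sumL-concatMap : {A B : Set} (f : B → ℕ) (h : A → List B) (xs : List A) → sumL f (concatMap h xs) ≡ sumL (sumL f ∘ h) xs
sumL-concatMap f h []       = refl
sumL-concatMap f h (x ∷ xs) = trans (sumL-++ f (h x) _) (cong (sumL f (h x) +_) (sumL-concatMap f h xs))

sumL-tabulate : ∀ {A : Set} {n} (f : A → ℕ) (h : Fin n → A) (g : ℕ → ℕ) → (∀ i → f (h i) ≡ g (toℕ i)) →
  sumL f (tabulate h) ≡ ∑ n g
sumL-tabulate {n = zero}  f h g eq = refl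
sumL-tabulate {n = suc n} f h g eq = cong₂ _+_ (eq zero) (sumL-tabulate f (h ∘ suc) (g ∘ suc) (eq ∘ suc))

sumL-verts : ∀ {n} (f : V n → ℕ) (g : ℕ → ℕ → ℕ) → (∀ x y → f (x , y) ≡ g (toℕ x) (toℕ y)) →
  sumL f (verts n) ≡ ∑[ a < n ] ∑[ b < n ] g a b
sumL-verts {n} f g eq = trans (sumL-concatMap f (λ x → List.map (x ,_) (allFin n)) (allFin n))
  (sumL-tabulate _ id _ λ x → trans (sumL-map f (x ,_) (allFin n)) (sumL-tabulate _ id _ (eq x)))

total-∑⁴ : ∀ n (f : V n → V n → ℕ) (g : ℕ → ℕ → ℕ → ℕ → ℕ) →
  (∀ x y x′ y′ → f (x , y) (x′ , y′) ≡ g (toℕ x) (toℕ y) (toℕ x′) (toℕ y′)) → total n f ≡ ∑⁴ n g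
total-∑⁴ n f g eq = sumL-verts _ _ λ x y → sumL-verts _ _ (eq x y)

countL-sumL : {A : Set} (P : A → Bool) (xs : List A) → countL P xs ≡ sumL (ι ∘ P) xs
countL-sumL P []       = refl
countL-sumL P (x ∷ xs) = cong (ι (P x) +_) (countL-sumL P xs)

-- The local function of count has no name: unification finds it once verts n is abstracted.
mutual
  outerSum : ∀ n → (V n → V n → Bool) → List (V n) → ℕ
  outerSum n P = _

  count-outerSum : ∀ n (P : V n → V n → Bool) → count n P ≡ outerSum n P (verts n)
  count-outerSum n P with verts n
  ... | vs = refl

outerSum-sumL : ∀ n (P : V n → V n → Bool) vs → outerSum n P vs ≡ sumL (λ E → sumL (λ F → ι (P E F)) (verts n)) vs
outerSum-sumL n P []       = refl
outerSum-sumL n P (E ∷ Es) = cong₂ _+_ (countL-sumL (P E) (verts n)) (outerSum-sumL n P Es)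

count-total : ∀ n (P : V n → V n → Bool) → count n P ≡ total n (λ E F → ι (P E F))
count-total n P = trans (count-outerSum n P) (outerSum-sumL n P (verts n))

total-mono : ∀ {n} {f g : V n → V n → ℕ} → (∀ E F → f E F ≤ g E F) → total n f ≤ total n g
total-mono {n} h = sumL-mono (λ E → sumL-mono (h E) (verts n)) (verts n)

total-+ : ∀ n (f g : V n → V n → ℕ) → total n (λ E F → f E F + g E F) ≡ total n f + total n g
total-+ n f g = trans (sumL-cong (λ E → sumL-+ (f E) (g E) (verts n)) (verts n)) (sumL-+ _ _ (verts n))

-- The indicator of `v ≤ k * x + u < v + K`. Written as a sum over the `K` possible values, it can
-- be exchanged with a sum over `x`.
near : (K k x u v : ℕ) → ℕ
near K k x u v = ∑[ i < K ] ι (k * x + u ≡ᵇ v + i)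

ι-≡ᵇ-step : ∀ k u w → 1 ≤ k → ι (u ≡ᵇ w) + ι (k + u ≤ᵇ w) ≤ ι (u ≤ᵇ w)
ι-≡ᵇ-step k u w 1≤k with u ℕₚ.≟ w | k + u ℕₚ.≤? w
... | yes refl | yes h = ⊥-elim (ℕₚ.<⇒≱ (ℕₚ.+-monoˡ-≤ u 1≤k) h)
... | yes refl | no h rewrite ι-true (ℕₚ.≡⇒≡ᵇ u u refl) | ι-false (h ∘ ℕₚ.≤ᵇ⇒≤ (k + u) u) | ι-true (ℕₚ.≤⇒≤ᵇ (ℕₚ.≤-refl {u})) = ℕₚ.≤-refl
... | no u≢w | yes h rewrite ι-false (u≢w ∘ ℕₚ.≡ᵇ⇒≡ u w) | ι-true (ℕₚ.≤⇒≤ᵇ h) | ι-true (ℕₚ.≤⇒≤ᵇ (ℕₚ.≤-trans (ℕₚ.m≤n+m u k) h)) = ℕₚ.≤-refl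
... | no u≢w | no h rewrite ι-false (u≢w ∘ ℕₚ.≡ᵇ⇒≡ u w) | ι-false (h ∘ ℕₚ.≤ᵇ⇒≤ (k + u) w) = z≤n

-- The bound `ι (u ≤ᵇ w)` in place of 1 carries the induction: once `u` has met `w`, the next value
-- `k + u` exceeds it.
∑-solutions : ∀ n k u w → 1 ≤ k → ∑[ x < n ] ι (k * x + u ≡ᵇ w) ≤ ι (u ≤ᵇ w)
∑-solutions zero    k u w 1≤k = z≤n
∑-solutions (suc n) k u w 1≤k = ℕₚ.≤-trans (ℕₚ.+-mono-≤
  (ℕₚ.≤-reflexive (cong (λ z → ι (z + u ≡ᵇ w)) (ℕₚ.*-zeroʳ k)))
  (ℕₚ.≤-trans (ℕₚ.≤-reflexive (∑-cong n λ x → cong (λ z → ι (z ≡ᵇ w)) (shift k x u))) (∑-solutions n k (k + u) w 1≤k)))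
  (ι-≡ᵇ-step k u w 1≤k)
  where
  shift : ∀ k x u → k * (suc x) + u ≡ k * x + (k + u)
  shift = solve-∀

∑-near : ∀ n K k u v → 1 ≤ k → ∑[ x < n ] near K k x u v ≤ K
∑-near n K k u v 1≤k = ℕₚ.≤-trans (ℕₚ.≤-reflexive (∑-comm n K _))
  (ℕₚ.≤-trans (∑-≤ K λ i → ℕₚ.≤-trans (∑-solutions n k u (v + i) 1≤k) (ι-≤1 _)) (ℕₚ.≤-reflexive (ℕₚ.*-identityʳ K)))

∑-term : ∀ n (f : ℕ → ℕ) {i} → i < n → f i ≤ ∑ n f
∑-term (suc n) f {zero}  _         = ℕₚ.m≤m+n (f 0) _
∑-term (suc n) f {suc i} (s≤s i<n) = ℕₚ.≤-trans (∑-term n (f ∘ suc) i<n) (ℕₚ.m≤n+m _ (f 0))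

near-zero : ∀ K k x u v → near K k x u v ≡ 0 → v ≤ k * x + u → k * x + u < v + K → ⊥
near-zero K k x u v h v≤ <v+K = ℕₚ.1+n≰n (subst₂ _≤_ one h (∑-term K (λ i → ι (y ≡ᵇ v + i)) {y ∸ v}
  (ℕₚ.+-cancelˡ-< v _ _ (subst (_< v + K) (sym (ℕₚ.m+[n∸m]≡n v≤)) <v+K))))
  where
  y = k * x + u
  one : ι (y ≡ᵇ v + (y ∸ v)) ≡ 1
  one = ι-true (ℕₚ.≡⇒≡ᵇ y _ (sym (ℕₚ.m+[n∸m]≡n v≤)))

sumL-zero : ∀ xs → sumL id xs ≡ 0 → All (_≡ 0) xs
sumL-zero []       h = []
sumL-zero (x ∷ xs) h = ℕₚ.m+n≡0⇒m≡0 x h ∷ sumL-zero xs (ℕₚ.m+n≡0⇒n≡0 x h)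

∑³ : ℕ → (ℕ → ℕ → ℕ → ℕ) → ℕ
∑³ n f = ∑[ b < n ] ∑[ c < n ] ∑[ e < n ] f b c e

∑³-mono : ∀ n {f g : ℕ → ℕ → ℕ → ℕ} → (∀ b c e → f b c e ≤ g b c e) → ∑³ n f ≤ ∑³ n g
∑³-mono n h = ∑-mono n λ b → ∑-mono n λ c → ∑-mono n (h b c)

∑³-+ : ∀ n (f g : ℕ → ℕ → ℕ → ℕ) → ∑³ n (λ b c e → f b c e + g b c e) ≡ ∑³ n f + ∑³ n g
∑³-+ n f g = trans (∑-cong n λ b → trans (∑-cong n λ c → ∑-+ n (f b c) (g b c)) (∑-+ n _ _)) (∑-+ n _ _)

∑⁴-+ : ∀ n (f g : ℕ → ℕ → ℕ → ℕ → ℕ) → ∑⁴ n (λ a b c e → f a b c e + g a b c e) ≡ ∑⁴ n f + ∑⁴ n g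
∑⁴-+ n f g = trans (∑-cong n λ a → ∑³-+ n (f a) (g a)) (∑-+ n _ _)

∑⁴-* : ∀ n k (f : ℕ → ℕ → ℕ → ℕ → ℕ) → ∑⁴ n (λ a b c e → k * f a b c e) ≡ k * ∑⁴ n f
∑⁴-* n k f = trans (∑-cong n λ a → trans (∑-cong n λ b → trans (∑-cong n λ c → ∑-* n k _) (∑-* n k _)) (∑-* n k _)) (∑-* n k _)

∑⁴-1 : ∀ n → ∑⁴ n (λ _ _ _ _ → 1) ≡ n ^ 4
∑⁴-1 n = trans (∑-cong n λ _ → trans (∑-cong n λ _ → trans (∑-cong n λ _ → ∑-const n 1) (∑-const n _)) (∑-const n _)) (∑-const n _)

∑⁴-extend : ∀ {m n} (f : ℕ → ℕ → ℕ → ℕ → ℕ) → m ≤ n → ∑⁴ m f ≤ ∑⁴ n f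
∑⁴-extend {m} {n} f m≤n = ℕₚ.≤-trans (∑-mono m λ a → ℕₚ.≤-trans (∑-mono m λ b → ℕₚ.≤-trans (∑-mono m λ c →
  ∑-extend _ m≤n) (∑-extend _ m≤n)) (∑-extend _ m≤n)) (∑-extend _ m≤n)

-- Error terms of order n³

Cubic : (ℕ → ℕ) → Set
Cubic F = ∃[ K ] ∀ n → F n ≤ K * n ^ 3

cube : ∀ n K → n * (n * (n * K)) ≡ K * (n * (n * (n * 1)))
cube = solve-∀

cubic-+ : {f g : ℕ → ℕ → ℕ → ℕ → ℕ → ℕ} → Cubic (λ n → ∑⁴ n (f n)) → Cubic (λ n → ∑⁴ n (g n)) →
  Cubic (λ n → ∑⁴ n (λ a b c e → f n a b c e + g n a b c e))
cubic-+ {f} {g} (K , h) (L , h′) = K + L , λ n → ℕₚ.≤-trans (ℕₚ.≤-reflexive (∑⁴-+ n (f n) (g n)))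
  (ℕₚ.≤-trans (ℕₚ.+-mono-≤ (h n) (h′ n)) (ℕₚ.≤-reflexive (sym (ℕₚ.*-distribʳ-+ (n ^ 3) K L))))

cubic-0 : Cubic (λ n → ∑⁴ n (λ a b c e → 0))
cubic-0 = 0 , λ n → ℕₚ.≤-reflexive (trans (∑⁴-* n 0 (λ _ _ _ _ → 0)) refl)

cubic-e : ∀ K k (u v : ℕ → ℕ → ℕ → ℕ → ℕ) → 1 ≤ k → Cubic (λ n → ∑⁴ n (λ a b c e → near K k e (u n a b c) (v n a b c)))
cubic-e K k u v 1≤k = K , λ n → ℕₚ.≤-trans (∑-≤ n λ a → ∑-≤ n λ b → ∑-≤ n λ c → ∑-near n K k _ _ 1≤k) (ℕₚ.≤-reflexive (cube n K))

cubic-c : ∀ K k (u v : ℕ → ℕ → ℕ → ℕ) → 1 ≤ k → Cubic (λ n → ∑⁴ n (λ a b c e → near K k c (u n a b) (v n a b)))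
cubic-c K k u v 1≤k = K , λ n → ℕₚ.≤-trans (∑-≤ n λ a → ∑-≤ n λ b → ℕₚ.≤-trans
  (ℕₚ.≤-reflexive (∑-comm n n _)) (∑-≤ n λ e → ∑-near n K k _ _ 1≤k)) (ℕₚ.≤-reflexive (cube n K))

cubic-b : ∀ K k (u v : ℕ → ℕ → ℕ) → 1 ≤ k → Cubic (λ n → ∑⁴ n (λ a b c e → near K k b (u n a) (v n a)))
cubic-b K k u v 1≤k = K , λ n → ℕₚ.≤-trans (∑-≤ n λ a → ℕₚ.≤-trans (ℕₚ.≤-reflexive (∑-comm n n _))
  (∑-≤ n λ c → ℕₚ.≤-trans (ℕₚ.≤-reflexive (∑-comm n n _)) (∑-≤ n λ e → ∑-near n K k _ _ 1≤k))) (ℕₚ.≤-reflexive (cube n K))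

cubic-a : ∀ K k (u v : ℕ → ℕ) → 1 ≤ k → Cubic (λ n → ∑⁴ n (λ a b c e → near K k a (u n) (v n)))
cubic-a K k u v 1≤k = K , λ n → ℕₚ.≤-trans (ℕₚ.≤-reflexive (∑-comm n n _)) (ℕₚ.≤-trans (∑-≤ n λ b →
  ℕₚ.≤-trans (ℕₚ.≤-reflexive (∑-comm n n _)) (∑-≤ n λ c → ℕₚ.≤-trans (ℕₚ.≤-reflexive (∑-comm n n _))
  (∑-≤ n λ e → ∑-near n K k _ _ 1≤k))) (ℕₚ.≤-reflexive (cube n K)))

-- The event C compared with 3 min < max

-- The event in terms of the coordinate differences, oriented so that it unfolds to `eventC`.
inC : ℕ → ℕ → Bool
inC A B = ((∣ B - A ∣ ∸ 1) % 2 ≡ᵇ 1) ∨ ((2 * (A ⊓ B)) <ᵇ ((∣ B - A ∣ ∸ 1) + 4))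

-- Away from the lines of lineTerms, C holds when one difference exceeds three times the other, and otherwise
-- it is decided by a parity that changes with every unit step.
skew : ℕ → ℕ → ℕ
skew A B = ι (3 * A <ᵇ B) + ι (3 * B <ᵇ A)

-- `near 15` describes a band of half-width 7 about a line on which one difference is three times
-- the other, `near 5` one of half-width 2 about a diagonal. Off the wide bands the margin is 8. A
-- unit step of `a` uses up at most 3 of it, so 5 remain at the neighbouring position.
lineTerms : ℕ → ℕ → ℕ → ℕ → List ℕ
lineTerms a b c e =
    near 15 1 e (3 * c + 7) (b + 3 * a) ∷ near 15 1 e (3 * a + 7) (b + 3 * c)
  ∷ near 15 3 e (c + 7) (3 * b + a) ∷ near 15 3 e (a + 7) (3 * b + c)
  ∷ near 5 1 e (c + 2) (b + a) ∷ near 5 1 e (a + 2) (b + c) ∷ []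

lines : ℕ → ℕ → ℕ → ℕ → ℕ
lines a b c e = sumL id (lineTerms a b c e)

cubic-lines : Cubic (λ n → ∑⁴ n lines)
cubic-lines = cubic-+ (cubic-e 15 1 _ _ (s≤s z≤n)) (cubic-+ (cubic-e 15 1 _ _ (s≤s z≤n)) (cubic-+ (cubic-e 15 3 _ _ (s≤s z≤n))
  (cubic-+ (cubic-e 15 3 _ _ (s≤s z≤n)) (cubic-+ (cubic-e 5 1 _ _ (s≤s z≤n)) (cubic-+ (cubic-e 5 1 _ _ (s≤s z≤n)) cubic-0)))))

off-lines-1 = arith (Goal 4 λ a b c e →
  (b :+ 3 :* a :≤ 1 :* e :+ (3 :* c :+ con 7) :⇒ 1 :* e :+ (3 :* c :+ con 7) :< b :+ 3 :* a :+ con 15 :⇒ :⊥) :⇒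
  (b :+ 3 :* c :≤ 1 :* e :+ (3 :* a :+ con 7) :⇒ 1 :* e :+ (3 :* a :+ con 7) :< b :+ 3 :* c :+ con 15 :⇒ :⊥) :⇒
  3 :* ∣ a :- c ∣ :+ con 8 :≤ ∣ e :- b ∣ :∨ ∣ e :- b ∣ :+ con 8 :≤ 3 :* ∣ a :- c ∣) tt

off-lines-3 = arith (Goal 4 λ a b c e →
  (3 :* b :+ a :≤ 3 :* e :+ (c :+ con 7) :⇒ 3 :* e :+ (c :+ con 7) :< 3 :* b :+ a :+ con 15 :⇒ :⊥) :⇒
  (3 :* b :+ c :≤ 3 :* e :+ (a :+ con 7) :⇒ 3 :* e :+ (a :+ con 7) :< 3 :* b :+ c :+ con 15 :⇒ :⊥) :⇒
  3 :* ∣ e :- b ∣ :+ con 8 :≤ ∣ a :- c ∣ :∨ ∣ a :- c ∣ :+ con 8 :≤ 3 :* ∣ e :- b ∣) tt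

off-diagonals = arith (Goal 4 λ a b c e →
  (b :+ a :≤ 1 :* e :+ (c :+ con 2) :⇒ 1 :* e :+ (c :+ con 2) :< b :+ a :+ con 5 :⇒ :⊥) :⇒
  (b :+ c :≤ 1 :* e :+ (a :+ con 2) :⇒ 1 :* e :+ (a :+ con 2) :< b :+ c :+ con 5 :⇒ :⊥) :⇒
  ∣ a :- c ∣ :+ con 3 :≤ ∣ e :- b ∣ :∨ ∣ e :- b ∣ :+ con 3 :≤ ∣ a :- c ∣) tt

odd-suc : ∀ g → ι (suc g % 2 ≡ᵇ 1) + ι (g % 2 ≡ᵇ 1) ≡ 1
odd-suc zero          = refl
odd-suc (suc zero)    = refl
odd-suc (suc (suc g)) = trans
  (cong₂ (λ x y → ι (x ≡ᵇ 1) + ι (y ≡ᵇ 1)) (trans (cong (_% 2) (ℕₚ.+-comm 2 (suc g))) (DivMod.[m+n]%n≡m%n (suc g) 2))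
    (trans (cong (_% 2) (ℕₚ.+-comm 2 g)) (DivMod.[m+n]%n≡m%n g 2))) (odd-suc g)

gap : ∀ {i} → 1 ≤ i → i ∸ 1 + 1 ≡ i
gap 1≤i = ℕₚ.m∸n+n≡m 1≤i

ι-∨ʳ : ∀ b {b′} → T b′ → ι (b ∨ b′) ≡ 1
ι-∨ʳ true  _ = refl
ι-∨ʳ false t = ι-true t

ι-∨ˡ : ∀ b {b′} → ¬ T b′ → ι (b ∨ b′) ≡ ι b
ι-∨ˡ true  _ = refl
ι-∨ˡ false h = ι-false h

skewed : ∀ A B → 3 * A < B ⊎ 3 * B < A → ι (inC A B) ≡ 1 × skew A B ≡ 1
skewed A B h = ι-∨ʳ _ (ℕₚ.<⇒<ᵇ (small (A ∷ B ∷ ∣ B - A ∣ ∸ 1 ∷ []) h (gap (apart (A ∷ B ∷ []) h)))) , weight h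
  where
  apart = arith (Goal 2 λ A B → 3 :* A :< B :∨ 3 :* B :< A :⇒ con 1 :≤ ∣ B :- A ∣) tt
  small = arith (Goal 3 λ A B g → 3 :* A :< B :∨ 3 :* B :< A :⇒ g :+ con 1 :≡ ∣ B :- A ∣ :⇒ 2 :* (A :⊓ B) :< g :+ con 4) tt
  exclusive = arith (Goal 2 λ A B → 3 :* A :< B :⇒ 3 :* B :< A :⇒ :⊥) tt
  weight : 3 * A < B ⊎ 3 * B < A → skew A B ≡ 1
  weight (inj₁ h) = cong₂ _+_ (ι-true (ℕₚ.<⇒<ᵇ h)) (ι-false (exclusive (A ∷ B ∷ []) h ∘ ℕₚ.<ᵇ⇒< (3 * B) A))
  weight (inj₂ h) = cong₂ _+_ (ι-false (λ t → exclusive (A ∷ B ∷ []) (ℕₚ.<ᵇ⇒< (3 * A) B t) h)) (ι-true (ℕₚ.<⇒<ᵇ h))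

-- With gain `max - min - 1` the second alternative of the event means `3 * min < max + 3`, which
-- the margin 5 rules out; only the parity is left.
balanced : ∀ A B → B + 5 ≤ 3 * A → A + 5 ≤ 3 * B → 1 ≤ ∣ B - A ∣ →
  ι (inC A B) ≡ ι ((∣ B - A ∣ ∸ 1) % 2 ≡ᵇ 1) × skew A B ≡ 0
balanced A B h h′ 1≤ = ι-∨ˡ _ (λ t → large (A ∷ B ∷ ∣ B - A ∣ ∸ 1 ∷ []) h h′ (gap 1≤) (ℕₚ.<ᵇ⇒< (2 * (A ⊓ B)) _ t)) ,
  cong₂ _+_ (ι-false (thin (A ∷ B ∷ []) h ∘ ℕₚ.<ᵇ⇒< (3 * A) B)) (ι-false (thin (B ∷ A ∷ []) h′ ∘ ℕₚ.<ᵇ⇒< (3 * B) A))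
  where
  large = arith (Goal 3 λ A B g → B :+ con 5 :≤ 3 :* A :⇒ A :+ con 5 :≤ 3 :* B :⇒ g :+ con 1 :≡ ∣ B :- A ∣ :⇒ 2 :* (A :⊓ B) :< g :+ con 4 :⇒ :⊥) tt
  thin = arith (Goal 2 λ A B → B :+ con 5 :≤ 3 :* A :⇒ 3 :* A :< B :⇒ :⊥) tt

-- The margins keep both positions in the same regime. In the skewed one both satisfy the event; in
-- the balanced one the two gains are consecutive, so exactly one of them is odd.
step-count : ∀ A A′ B → A′ ≡ suc A ⊎ A ≡ suc A′ →
  3 * A + 8 ≤ B ⊎ B + 8 ≤ 3 * A → 3 * B + 8 ≤ A ⊎ A + 8 ≤ 3 * B → A + 3 ≤ B ⊎ B + 3 ≤ A →
  2 * (ι (inC A B) + ι (inC A′ B)) ≡ 2 + (skew A B + skew A′ B)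
step-count A A′ B st (inj₁ h) _ _ =
  let c , s = skewed A B (inj₁ (ℕₚ.<-≤-trans (ℕₚ.m<m+n (3 * A) (s≤s z≤n)) h))
      c′ , s′ = skewed A′ B (inj₁ (next (A ∷ A′ ∷ B ∷ []) st h))
  in trans (cong (2 *_) (cong₂ _+_ c c′)) (cong (2 +_) (sym (cong₂ _+_ s s′)))
  where next = arith (Goal 3 λ A A′ B → (A′ :≡ con 1 :+ A :∨ A :≡ con 1 :+ A′) :⇒ 3 :* A :+ con 8 :≤ B :⇒ 3 :* A′ :< B) tt
step-count A A′ B st _ (inj₁ h) _ =
  let c , s = skewed A B (inj₂ (ℕₚ.<-≤-trans (ℕₚ.m<m+n (3 * B) (s≤s z≤n)) h))
      c′ , s′ = skewed A′ B (inj₂ (next (A ∷ A′ ∷ B ∷ []) st h))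
  in trans (cong (2 *_) (cong₂ _+_ c c′)) (cong (2 +_) (sym (cong₂ _+_ s s′)))
  where next = arith (Goal 3 λ A A′ B → (A′ :≡ con 1 :+ A :∨ A :≡ con 1 :+ A′) :⇒ 3 :* B :+ con 8 :≤ A :⇒ 3 :* B :< A′) tt
step-count A A′ B st (inj₂ h) (inj₂ h′) dg =
  let c , s = balanced A B (ℕₚ.≤-trans (ℕₚ.+-monoʳ-≤ B (ℕₚ.m≤m+n 5 3)) h) (ℕₚ.≤-trans (ℕₚ.+-monoʳ-≤ A (ℕₚ.m≤m+n 5 3)) h′) 1≤g
      c′ , s′ = balanced A′ B (proj₁ near′) (proj₂ near′) 1≤g′
  in trans (cong (2 *_) (trans (cong₂ _+_ c c′) (alternate (step (A ∷ A′ ∷ B ∷ g ∷ g′ ∷ []) st dg (gap 1≤g) (gap 1≤g′)))))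
       (cong (2 +_) (sym (cong₂ _+_ s s′)))
  where
  g = ∣ B - A ∣ ∸ 1
  g′ = ∣ B - A′ ∣ ∸ 1
  near′ = arith (Goal 3 λ A A′ B → (A′ :≡ con 1 :+ A :∨ A :≡ con 1 :+ A′) :⇒ B :+ con 8 :≤ 3 :* A :⇒ A :+ con 8 :≤ 3 :* B :⇒
    B :+ con 5 :≤ 3 :* A′ :∧ A′ :+ con 5 :≤ 3 :* B) tt (A ∷ A′ ∷ B ∷ []) st h h′
  1≤g : 1 ≤ ∣ B - A ∣
  1≤g = arith (Goal 2 λ A B → (A :+ con 3 :≤ B :∨ B :+ con 3 :≤ A) :⇒ con 1 :≤ ∣ B :- A ∣) tt (A ∷ B ∷ []) dg
  1≤g′ : 1 ≤ ∣ B - A′ ∣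
  1≤g′ = arith (Goal 3 λ A A′ B → (A′ :≡ con 1 :+ A :∨ A :≡ con 1 :+ A′) :⇒ (A :+ con 3 :≤ B :∨ B :+ con 3 :≤ A) :⇒
    con 1 :≤ ∣ B :- A′ ∣) tt (A ∷ A′ ∷ B ∷ []) st dg
  step = arith (Goal 5 λ A A′ B g g′ → (A′ :≡ con 1 :+ A :∨ A :≡ con 1 :+ A′) :⇒ (A :+ con 3 :≤ B :∨ B :+ con 3 :≤ A) :⇒
    g :+ con 1 :≡ ∣ B :- A ∣ :⇒ g′ :+ con 1 :≡ ∣ B :- A′ ∣ :⇒ g :≡ con 1 :+ g′ :∨ g′ :≡ con 1 :+ g) tt
  alternate : g ≡ suc g′ ⊎ g′ ≡ suc g → ι (g % 2 ≡ᵇ 1) + ι (g′ % 2 ≡ᵇ 1) ≡ 1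
  alternate (inj₁ h) = trans (cong (λ i → ι (i % 2 ≡ᵇ 1) + ι (g′ % 2 ≡ᵇ 1)) h) (odd-suc g′)
  alternate (inj₂ h) = trans (cong (λ i → ι (g % 2 ≡ᵇ 1) + ι (i % 2 ≡ᵇ 1)) h)
    (trans (ℕₚ.+-comm (ι (g % 2 ≡ᵇ 1)) _) (odd-suc g))

module _ (a b c e : ℕ) where
  private
    A = ∣ a - c ∣
    A′ = ∣ suc a - c ∣
    B = ∣ e - b ∣

  pair-exact : lines a b c e ≡ 0 → 2 * (ι (inC A B) + ι (inC A′ B)) ≡ 2 + (skew A B + skew A′ B)
  pair-exact h with sumL-zero (lineTerms a b c e) h
  ... | z₁ ∷ z₂ ∷ z₃ ∷ z₄ ∷ z₅ ∷ z₆ ∷ [] = step-count A A′ B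
    (arith (Goal 2 λ a c → ∣ con 1 :+ a :- c ∣ :≡ con 1 :+ ∣ a :- c ∣ :∨ ∣ a :- c ∣ :≡ con 1 :+ ∣ con 1 :+ a :- c ∣) tt (a ∷ c ∷ []))
    (off-lines-1 (a ∷ b ∷ c ∷ e ∷ []) (near-zero 15 1 e _ _ z₁) (near-zero 15 1 e _ _ z₂))
    (off-lines-3 (a ∷ b ∷ c ∷ e ∷ []) (near-zero 15 3 e _ _ z₃) (near-zero 15 3 e _ _ z₄))
    (off-diagonals (a ∷ b ∷ c ∷ e ∷ []) (near-zero 5 1 e _ _ z₅) (near-zero 5 1 e _ _ z₆))

  pair-≤ : 2 * (ι (inC A B) + ι (inC A′ B)) ≤ 2 + (skew A B + skew A′ B) + 6 * lines a b c e
  pair-≤ with lines a b c e in eq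
  ... | zero  = ℕₚ.≤-trans (ℕₚ.≤-reflexive (pair-exact eq)) (ℕₚ.m≤m+n _ _)
  ... | suc l = ℕₚ.≤-trans (ℕₚ.*-monoʳ-≤ 2 (ℕₚ.+-mono-≤ (ι-≤1 (inC A B)) (ι-≤1 (inC A′ B))))
    (ℕₚ.≤-trans (ℕₚ.m≤m+n 4 2) (ℕₚ.≤-trans (ℕₚ.*-monoʳ-≤ 6 (s≤s (z≤n {l}))) (ℕₚ.m≤n+m _ (2 + (skew A B + skew A′ B)))))

  -- The factor 6 is the trivial bound for the left side, each `skew` being at most 2. It also
  -- exceeds the trivial bound 4 used in `pair-≤`.
  pair-≥ : 2 + (skew A B + skew A′ B) ≤ 2 * (ι (inC A B) + ι (inC A′ B)) + 6 * lines a b c e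
  pair-≥ with lines a b c e in eq
  ... | zero  = ℕₚ.≤-trans (ℕₚ.≤-reflexive (sym (pair-exact eq))) (ℕₚ.m≤m+n _ _)
  ... | suc l = ℕₚ.≤-trans (ℕₚ.+-monoʳ-≤ 2 (ℕₚ.+-mono-≤ (skew≤2 A) (skew≤2 A′)))
    (ℕₚ.≤-trans (ℕₚ.*-monoʳ-≤ 6 (s≤s (z≤n {l}))) (ℕₚ.m≤n+m _ (2 * (ι (inC A B) + ι (inC A′ B)))))
    where
    skew≤2 : ∀ A → skew A B ≤ 2
    skew≤2 A = ℕₚ.+-mono-≤ (ι-≤1 (3 * A <ᵇ B)) (ι-≤1 (3 * B <ᵇ A))

cC sC : ℕ → ℕ → ℕ → ℕ → ℕ
cC a b c e = ι (inC ∣ a - c ∣ ∣ e - b ∣)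
sC a b c e = skew ∣ a - c ∣ ∣ e - b ∣

-- Matching `2 i` with `2 i + 1`, rather than comparing a sum with its shift, leaves no boundary
-- term but restricts the side length to even numbers.
∑⁴-pairs : ∀ m (f g : ℕ → ℕ → ℕ → ℕ → ℕ) →
  (∀ a b c e → f a b c e + f (suc a) b c e ≤ g a b c e + g (suc a) b c e) → ∑⁴ (m * 2) f ≤ ∑⁴ (m * 2) g
∑⁴-pairs m f g h = ∑-pairs m λ i → subst₂ _≤_ (∑³-+ k _ _) (∑³-+ k _ _) (∑³-mono k (h (i * 2)))
  where k = m * 2

C-≤-skew : ∀ m → let k = m * 2 in 2 * ∑⁴ k cC ≤ k ^ 4 + ∑⁴ k sC + 6 * ∑⁴ k lines
C-≤-skew m = subst₂ _≤_ (∑⁴-* k 2 cC)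
  (trans (∑⁴-+ k _ _) (cong₂ _+_ (trans (∑⁴-+ k _ _) (cong (_+ ∑⁴ k sC) (∑⁴-1 k))) (∑⁴-* k 6 lines)))
  (∑⁴-pairs m (λ a b c e → 2 * cC a b c e) (λ a b c e → 1 + sC a b c e + 6 * lines a b c e) λ a b c e →
    ℕₚ.≤-trans (ℕₚ.≤-reflexive (sym (ℕₚ.*-distribˡ-+ 2 (cC a b c e) _)))
      (ℕₚ.≤-trans (pair-≤ a b c e) (ℕₚ.≤-trans (ℕₚ.m≤m+n _ (6 * lines (suc a) b c e))
        (ℕₚ.≤-reflexive (shuffle (sC a b c e) (sC (suc a) b c e) (6 * lines a b c e) _)))))
  where
  k = m * 2
  shuffle : ∀ s s′ l l′ → 2 + (s + s′) + l + l′ ≡ (1 + s + l) + (1 + s′ + l′)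
  shuffle = solve-∀

skew-≤-C : ∀ m → let k = m * 2 in k ^ 4 + ∑⁴ k sC ≤ 2 * ∑⁴ k cC + 6 * ∑⁴ k lines
skew-≤-C m = subst₂ _≤_ (trans (∑⁴-+ k _ _) (cong (_+ ∑⁴ k sC) (∑⁴-1 k)))
  (trans (∑⁴-+ k _ _) (cong₂ _+_ (∑⁴-* k 2 cC) (∑⁴-* k 6 lines)))
  (∑⁴-pairs m (λ a b c e → 1 + sC a b c e) (λ a b c e → 2 * cC a b c e + 6 * lines a b c e) λ a b c e →
    ℕₚ.≤-trans (ℕₚ.≤-reflexive (shuffle′ (sC a b c e) _))
      (ℕₚ.≤-trans (pair-≥ a b c e) (ℕₚ.≤-trans (ℕₚ.m≤m+n _ (6 * lines (suc a) b c e))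
        (ℕₚ.≤-reflexive (shuffle (cC a b c e) (cC (suc a) b c e) (6 * lines a b c e) _)))))
  where
  k = m * 2
  shuffle′ : ∀ s s′ → (1 + s) + (1 + s′) ≡ 2 + (s + s′)
  shuffle′ = solve-∀
  shuffle : ∀ s s′ l l′ → 2 * (s + s′) + l + l′ ≡ (2 * s + l) + (2 * s′ + l′)
  shuffle = solve-∀

-- The number of pairs with 3 min < max

Δ : ℕ → (ℕ → ℕ) → ℕ
Δ n h = ∑[ i < n ] ∑[ j < n ] h ∣ i - j ∣

Δ-cong : ∀ n {h h′ : ℕ → ℕ} → (∀ i → h i ≡ h′ i) → Δ n h ≡ Δ n h′
Δ-cong n eq = ∑-cong n λ i → ∑-cong n λ j → eq ∣ i - j ∣

Δ-mono : ∀ n {h h′ : ℕ → ℕ} → (∀ i → h i ≤ h′ i) → Δ n h ≤ Δ n h′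
Δ-mono n le = ∑-mono n λ i → ∑-mono n λ j → le ∣ i - j ∣

Δ-suc : ∀ n h → Δ (suc n) h ≡ h 0 + 2 * ∑ n (h ∘ suc) + Δ n h
Δ-suc n h = trans (cong (h 0 + ∑ n (h ∘ suc) +_) (∑-+ n (h ∘ suc) _)) (shuffle (h 0) (∑ n (h ∘ suc)) (Δ n h))
  where
  shuffle : ∀ a b c → a + b + (b + c) ≡ a + 2 * b + c
  shuffle = solve-∀

∑-tail : ∀ n B → ∑[ j < n ] ι (B <ᵇ suc j) ≡ n ∸ B
∑-tail zero    B       = sym (ℕₚ.0∸n≡0 B)
∑-tail (suc n) zero    = cong suc (trans (∑-const n 1) (ℕₚ.*-identityʳ n))
∑-tail (suc n) (suc B) = ∑-tail n B

Δ-tail : ∀ n B → Δ n (λ b → ι (B <ᵇ b)) ≡ (n ∸ B) * (n ∸ B ∸ 1)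
Δ-tail zero    B rewrite ℕₚ.0∸n≡0 B = refl
Δ-tail (suc n) B = trans (Δ-suc n (λ b → ι (B <ᵇ b))) (trans (cong₂ (λ u v → 2 * u + v) (∑-tail n B) (Δ-tail n B)) (close (ℕₚ.≤-<-connex B n)))
  where
  step : ∀ r → 2 * r + r * (r ∸ 1) ≡ suc r * (suc r ∸ 1)
  step zero    = refl
  step (suc r) = poly r
    where
    poly : ∀ r → 2 * suc r + suc r * r ≡ suc (suc r) * suc r
    poly = solve-∀
  close : B ≤ n ⊎ n < B → 2 * (n ∸ B) + (n ∸ B) * (n ∸ B ∸ 1) ≡ (suc n ∸ B) * (suc n ∸ B ∸ 1)
  close (inj₁ B≤n) rewrite ℕₚ.+-∸-assoc 1 B≤n = step (n ∸ B)
  close (inj₂ n<B) rewrite ℕₚ.m≤n⇒m∸n≡0 (ℕₚ.<⇒≤ n<B) | ℕₚ.m≤n⇒m∸n≡0 n<B = refl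

sq : ℕ → ℕ
sq x = x * x

-- The subtraction never truncates: the summands are the squares of `k + 1` to `k + n`.
ramp : ∀ n k → 6 * ∑[ j < n ] sq (n + k ∸ j) ≡ 6 * (n * (k * k)) + 6 * (k * (n * suc n)) + n * (suc n * (2 * n + 1))
ramp zero    k = solve-k k
  where
  solve-k : ∀ k → 0 ≡ 6 * (0 * (k * k)) + 6 * (k * (0 * 1)) + 0 * (1 * 1)
  solve-k = solve-∀
ramp (suc n) k = trans (ℕₚ.*-distribˡ-+ 6 (sq (suc n + k)) _) (trans (cong (6 * sq (suc n + k) +_) (ramp n k)) (poly n k))
  where
  poly : ∀ n k → 6 * ((1 + n + k) * (1 + n + k)) + (6 * (n * (k * k)) + 6 * (k * (n * (1 + n))) + n * ((1 + n) * (2 * n + 1)))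
    ≡ 6 * ((1 + n) * (k * k)) + 6 * (k * ((1 + n) * (2 + n))) + (1 + n) * ((2 + n) * (2 * (1 + n) + 1))
  poly = solve-∀

-- The parameter `k` is there for the induction: removing the first row and column lowers `n` by 1
-- while the argument of the square stays the same, so `k` rises by 1.
Δ-ramp : ∀ n k → 6 * Δ n (λ A → sq (n + k ∸ A)) ≡
  3 * (n * (n * (n * n))) + 8 * (k * (n * (n * n))) + 6 * (k * k * (n * n)) + 3 * (n * n) + 4 * (k * n)
Δ-ramp zero    k = poly k
  where
  poly : ∀ k → 0 ≡ 3 * (0 * (0 * (0 * 0))) + 8 * (k * (0 * (0 * 0))) + 6 * (k * k * (0 * 0)) + 3 * (0 * 0) + 4 * (k * 0)
  poly = solve-∀
Δ-ramp (suc n) k = trans (cong (6 *_) (Δ-suc n (λ A → sq (suc n + k ∸ A))))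
  (trans (distribute (sq (suc n + k)) (∑[ j < n ] sq (n + k ∸ j)) (Δ n (λ A → sq (suc n + k ∸ A))))
  (trans (cong₂ (λ u v → 6 * sq (suc n + k) + 2 * u + v) (ramp n k)
    (trans (cong (6 *_) (Δ-cong n λ A → cong (λ z → sq (z ∸ A)) (sym (ℕₚ.+-suc n k)))) (Δ-ramp n (suc k)))) (poly n k)))
  where
  distribute : ∀ a b c → 6 * (a + 2 * b + c) ≡ 6 * a + 2 * (6 * b) + 6 * c
  distribute = solve-∀
  poly : ∀ n k → 6 * ((1 + n + k) * (1 + n + k)) + 2 * (6 * (n * (k * k)) + 6 * (k * (n * (1 + n))) + n * ((1 + n) * (2 * n + 1)))
    + (3 * (n * (n * (n * n))) + 8 * ((1 + k) * (n * (n * n))) + 6 * ((1 + k) * (1 + k) * (n * n)) + 3 * (n * n) + 4 * ((1 + k) * n))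
    ≡ 3 * ((1 + n) * ((1 + n) * ((1 + n) * (1 + n)))) + 8 * (k * ((1 + n) * ((1 + n) * (1 + n)))) + 6 * (k * k * ((1 + n) * (1 + n)))
      + 3 * ((1 + n) * (1 + n)) + 4 * (k * (1 + n))
  poly = solve-∀

squares : ℕ → ℕ
squares zero    = 0
squares (suc M) = sq M + squares M

∑-squares : ∀ M i → ∑[ j < M + i ] sq (M ∸ suc j) ≡ squares M
∑-squares zero    i = trans (∑-const i 0) (ℕₚ.*-zeroʳ i)
∑-squares (suc M) i = cong (sq M +_) (∑-squares M i)

squares-closed : ∀ M → 6 * squares M + 3 * (M * M) ≡ 2 * (M * (M * M)) + M
squares-closed zero    = refl
squares-closed (suc M) = trans (split (M * M) (squares M) M) (trans (cong (_+ (6 * (M * M) + 6 * M + 3)) (squares-closed M)) (poly M))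
  where
  split : ∀ m s M → 6 * (m + s) + 3 * ((1 + M) * (1 + M)) ≡ 6 * s + 3 * (M * M) + (6 * m + 6 * M + 3)
  split = solve-∀
  poly : ∀ M → 2 * (M * (M * M)) + M + (6 * (M * M) + 6 * M + 3) ≡ 2 * ((1 + M) * ((1 + M) * (1 + M))) + (1 + M)
  poly = solve-∀

-- The summand vanishes for `A ≥ M`, so beyond side length `M` every further row and column
-- contributes the same amount.
Δ-plateau : ∀ M L → Δ (M + L) (λ A → sq (M ∸ A)) ≡ Δ M (λ A → sq (M ∸ A)) + L * (sq M + 2 * squares M)
Δ-plateau M zero    = trans (cong (λ z → Δ z (λ A → sq (M ∸ A))) (ℕₚ.+-identityʳ M)) (sym (ℕₚ.+-identityʳ _))
Δ-plateau M (suc L) = trans (cong (λ z → Δ z (λ A → sq (M ∸ A))) (ℕₚ.+-suc M L))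
  (trans (Δ-suc (M + L) (λ A → sq (M ∸ A))) (trans (cong₂ (λ u v → sq M + 2 * u + v) (∑-squares M L) (Δ-plateau M L)) (shuffle (sq M + 2 * squares M) (Δ M (λ A → sq (M ∸ A))) L)))
  where
  shuffle : ∀ s x L → s + (x + L * s) ≡ x + (1 + L) * s
  shuffle = solve-∀

Δ-squares : ∀ M → 6 * Δ (3 * M) (λ A → sq (M ∸ A)) ≡ 11 * (M * (M * (M * M))) + 7 * (M * M)
-- Adding `12 * M³` on both sides completes `24 * M * squares M` to a multiple of the left side of
-- `squares-closed`, which avoids subtraction.
Δ-squares M = ℕₚ.+-cancelʳ-≡ (12 * (M * (M * M))) _ _ (trans
  (cong (λ z → 6 * z + 12 * (M * (M * M))) (Δ-plateau M (2 * M)))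
  (trans (regroup M (Δ M (λ A → sq (M ∸ A))) (squares M))
  (trans (cong₂ (λ u v → u + 12 * (M * (M * M)) + 4 * M * v) diagonal (squares-closed M)) (poly M))))
  where
  diagonal = trans (cong (λ z → 6 * z) (Δ-cong M λ A → cong (λ z → sq (z ∸ A)) (sym (ℕₚ.+-identityʳ M)))) (Δ-ramp M 0)
  regroup : ∀ M x s → 6 * (x + 2 * M * (M * M + 2 * s)) + 12 * (M * (M * M)) ≡
    6 * x + 12 * (M * (M * M)) + 4 * M * (6 * s + 3 * (M * M))
  regroup = solve-∀
  poly : ∀ M → 3 * (M * (M * (M * M))) + 8 * (0 * (M * (M * M))) + 6 * (0 * 0 * (M * M)) + 3 * (M * M) + 4 * (0 * M)
    + 12 * (M * (M * M)) + 4 * M * (2 * (M * (M * M)) + M) ≡ 11 * (M * (M * (M * M))) + 7 * (M * M) + 12 * (M * (M * M))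
  poly = solve-∀

thirdOf : ℕ → ℕ
thirdOf n = ∑⁴ n (λ a b c e → ι (3 * ∣ a - c ∣ <ᵇ ∣ e - b ∣))

∑⁴-transpose : ∀ n (f : ℕ → ℕ → ℕ → ℕ → ℕ) → ∑⁴ n f ≡ ∑⁴ n (λ a b c e → f b a e c)
∑⁴-transpose n f = trans (∑-comm n n _) (∑-cong n λ a → ∑-cong n λ b → ∑-comm n n _)

skew-third : ∀ n → ∑⁴ n sC ≡ 2 * thirdOf n
skew-third n = trans (∑⁴-+ n _ _) (cong (thirdOf n +_) (trans (∑⁴-transpose n _)
  (trans (∑-cong n λ a → ∑-cong n λ b → ∑-cong n λ c → ∑-cong n λ e →
    cong₂ (λ u v → ι (3 * u <ᵇ v)) (ℕₚ.∣-∣-comm c a) (ℕₚ.∣-∣-comm b e)) (sym (ℕₚ.+-identityʳ _)))))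

third-Δ : ∀ n → thirdOf n ≡ Δ n (λ A → (n ∸ 3 * A) * (n ∸ 3 * A ∸ 1))
third-Δ n = ∑-cong n λ a → trans (∑-comm n n _) (∑-cong n λ c →
  trans (∑-cong n λ b → ∑-cong n λ e → cong (λ u → ι (3 * ∣ a - c ∣ <ᵇ u)) (ℕₚ.∣-∣-comm e b)) (Δ-tail n (3 * ∣ a - c ∣)))

Δ-* : ∀ n k h → Δ n (λ A → k * h A) ≡ k * Δ n h
Δ-* n k h = trans (∑-cong n λ i → ∑-* n k _) (∑-* n k _)

-- For side length `3 * M` the truncated difference `3 * M ∸ 3 * A` is exactly `3 * (M ∸ A)`, so the
-- count compares with a sum of squares of known value.
third-upper : ∀ M → thirdOf (3 * M) ≤ 9 * Δ (3 * M) (λ A → sq (M ∸ A))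
third-upper M = ℕₚ.≤-trans (ℕₚ.≤-reflexive (third-Δ (3 * M))) (ℕₚ.≤-trans (Δ-mono (3 * M) λ A → begin
    (3 * M ∸ 3 * A) * (3 * M ∸ 3 * A ∸ 1) ≤⟨ ℕₚ.*-monoʳ-≤ (3 * M ∸ 3 * A) (ℕₚ.m∸n≤m _ 1) ⟩
    (3 * M ∸ 3 * A) * (3 * M ∸ 3 * A)     ≡⟨ cong sq (sym (ℕₚ.*-distribˡ-∸ 3 M A)) ⟩
    sq (3 * (M ∸ A))                      ≡⟨ poly (M ∸ A) ⟩
    9 * sq (M ∸ A)                        ∎) (ℕₚ.≤-reflexive (Δ-* (3 * M) 9 (λ A → sq (M ∸ A)))))
  where
  open ℕₚ.≤-Reasoning
  poly : ∀ r → 3 * r * (3 * r) ≡ 9 * (r * r)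
  poly = solve-∀

third-lower : ∀ M → 9 * Δ (3 * M) (λ A → sq (M ∸ A)) ≤ thirdOf (3 * M) + (3 * M) ^ 3
third-lower M = ℕₚ.≤-trans (ℕₚ.≤-reflexive (sym (Δ-* k 9 (λ A → sq (M ∸ A))))) (ℕₚ.≤-trans (Δ-mono k λ A → pointwise A)
  (ℕₚ.≤-reflexive (trans (trans (∑-cong k λ i → ∑-+ k _ _) (∑-+ k _ _))
    (cong₂ _+_ (sym (third-Δ k)) (trans (∑-cong k λ i → ∑-const k k) (trans (∑-const k (k * k)) (cong (λ z → k * (k * z)) (sym (ℕₚ.*-identityʳ k)))))))))
  where
  k = 3 * M
  poly : ∀ r → 9 * (r * r) ≡ 3 * r * (3 * r)
  poly = solve-∀
  drop : ∀ r → r * r ≤ r * (r ∸ 1) + r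
  drop zero    = z≤n
  drop (suc r) = ℕₚ.≤-reflexive (square r)
    where
    square : ∀ r → (1 + r) * (1 + r) ≡ (1 + r) * r + (1 + r)
    square = solve-∀
  pointwise : ∀ A → 9 * sq (M ∸ A) ≤ (k ∸ 3 * A) * (k ∸ 3 * A ∸ 1) + k
  pointwise A rewrite sym (ℕₚ.*-distribˡ-∸ 3 M A) = ℕₚ.≤-trans (ℕₚ.≤-reflexive (poly (M ∸ A)))
    (ℕₚ.≤-trans (drop (3 * (M ∸ A))) (ℕₚ.+-monoʳ-≤ (3 * (M ∸ A) * (3 * (M ∸ A) ∸ 1)) (ℕₚ.*-monoʳ-≤ 3 (ℕₚ.m∸n≤m M A))))

countC : ℕ → ℕ
countC n = ∑⁴ n cC

-- Twice the count is about `n ^ 4 + 2 * thirdOf n`, and `54 * thirdOf n` is about `11 * n ^ 4`.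
-- Multiplication by 27 therefore clears all denominators: 38 = 27 + 11, and 38/54 = 19/27.
record Approx (K n : ℕ) : Set where
  constructor approx
  field
    upper : 54 * countC n ≤ 38 * n ^ 4 + K * n ^ 3
    lower : 38 * n ^ 4 ≤ 54 * countC n + K * n ^ 3

n²≤n³ : ∀ n → n * n ≤ n ^ 3
n²≤n³ zero    = z≤n
n²≤n³ (suc n) = ℕₚ.*-monoʳ-≤ (suc n) (ℕₚ.m≤m*n (suc n) (suc n * 1))

-- The form `3 * m * 2` provides the even side length for the matching and the factor 3 for the sum
-- of squares. In the constant, 162 is 27 · 6 from the lines; 567 covers the 63 of the quadratic
-- term above and the 54 from `third-lower` below.
approx-six : ∃[ K ] ∀ m → Approx K (3 * m * 2)
approx-six = let K , hK = cubic-lines in 162 * K + 567 , λ m → go K m (hK (3 * m * 2))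
  where
  go : ∀ K m → ∑⁴ (3 * m * 2) lines ≤ K * (3 * m * 2) ^ 3 → Approx (162 * K + 567) (3 * m * 2)
  go K m hL = approx up low
    where
    open ℕₚ.≤-Reasoning
    k = 3 * m * 2
    M = m * 2
    k≡3M : k ≡ 3 * M
    k≡3M = ℕₚ.*-assoc 3 m 2
    S = countC k
    N = thirdOf k
    L = ∑⁴ k lines
    G = Δ (3 * M) (λ A → sq (M ∸ A))
    N≤ : N ≤ 9 * G
    N≤ = subst (λ z → thirdOf z ≤ 9 * G) (sym k≡3M) (third-upper M)
    ≤N : 9 * G ≤ N + k ^ 3
    ≤N = subst (λ z → 9 * G ≤ thirdOf z + z ^ 3) (sym k≡3M) (third-lower M)
    81G : 81 * (6 * G) ≡ 11 * k ^ 4 + 63 * (k * k)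
    81G = trans (cong (81 *_) (Δ-squares M)) (trans (poly M) (cong (λ z → 11 * z ^ 4 + 63 * (z * z)) (sym k≡3M)))
      where
      poly : ∀ M → 81 * (11 * (M * (M * (M * M))) + 7 * (M * M)) ≡
        11 * (3 * M * (3 * M * (3 * M * (3 * M * 1)))) + 63 * (3 * M * (3 * M))
      poly = solve-∀
    up : 54 * S ≤ 38 * k ^ 4 + (162 * K + 567) * k ^ 3
    up = begin
      54 * S                                     ≡⟨ e₁ S ⟩
      27 * (2 * S)                               ≤⟨ ℕₚ.*-monoʳ-≤ 27 (C-≤-skew (3 * m)) ⟩
      27 * (k ^ 4 + ∑⁴ k sC + 6 * L)             ≡⟨ cong (λ z → 27 * (k ^ 4 + z + 6 * L)) (skew-third k) ⟩
      27 * (k ^ 4 + 2 * N + 6 * L)               ≤⟨ ℕₚ.*-monoʳ-≤ 27 (ℕₚ.+-mono-≤ (ℕₚ.+-monoʳ-≤ (k ^ 4) (ℕₚ.*-monoʳ-≤ 2 N≤)) (ℕₚ.*-monoʳ-≤ 6 hL)) ⟩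
      27 * (k ^ 4 + 2 * (9 * G) + 6 * (K * k ^ 3)) ≡⟨ e₂ (k ^ 4) G K (k ^ 3) ⟩
      27 * k ^ 4 + 81 * (6 * G) + 162 * K * k ^ 3 ≡⟨ cong (λ z → 27 * k ^ 4 + z + 162 * K * k ^ 3) 81G ⟩
      27 * k ^ 4 + (11 * k ^ 4 + 63 * (k * k)) + 162 * K * k ^ 3
        ≤⟨ ℕₚ.+-monoˡ-≤ (162 * K * k ^ 3) (ℕₚ.+-monoʳ-≤ (27 * k ^ 4) (ℕₚ.+-monoʳ-≤ (11 * k ^ 4)
             (ℕₚ.*-mono-≤ (ℕₚ.m≤m+n 63 504) (n²≤n³ k)))) ⟩
      27 * k ^ 4 + (11 * k ^ 4 + 567 * k ^ 3) + 162 * K * k ^ 3 ≡⟨ e₃ (k ^ 4) (k ^ 3) K ⟩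
      38 * k ^ 4 + (162 * K + 567) * k ^ 3       ∎
      where
      e₁ : ∀ S → 54 * S ≡ 27 * (2 * S)
      e₁ = solve-∀
      e₂ : ∀ q G K c → 27 * (q + 2 * (9 * G) + 6 * (K * c)) ≡ 27 * q + 81 * (6 * G) + 162 * K * c
      e₂ = solve-∀
      e₃ : ∀ q c K → 27 * q + (11 * q + 567 * c) + 162 * K * c ≡ 38 * q + (162 * K + 567) * c
      e₃ = solve-∀
    low : 38 * k ^ 4 ≤ 54 * S + (162 * K + 567) * k ^ 3
    low = begin
      38 * k ^ 4                                 ≤⟨ ℕₚ.m≤m+n _ (63 * (k * k)) ⟩
      38 * k ^ 4 + 63 * (k * k)                  ≡⟨ e₁ (k ^ 4) (63 * (k * k)) ⟩
      27 * k ^ 4 + (11 * k ^ 4 + 63 * (k * k))   ≡⟨ cong (27 * k ^ 4 +_) (sym 81G) ⟩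
      27 * k ^ 4 + 81 * (6 * G)                  ≡⟨ e₂ (k ^ 4) G ⟩
      27 * k ^ 4 + 54 * (9 * G)                  ≤⟨ ℕₚ.+-monoʳ-≤ (27 * k ^ 4) (ℕₚ.*-monoʳ-≤ 54 ≤N) ⟩
      27 * k ^ 4 + 54 * (N + k ^ 3)              ≡⟨ e₃ (k ^ 4) N (k ^ 3) ⟩
      27 * (k ^ 4 + 2 * N) + 54 * k ^ 3          ≡⟨ cong (λ z → 27 * (k ^ 4 + z) + 54 * k ^ 3) (sym (skew-third k)) ⟩
      27 * (k ^ 4 + ∑⁴ k sC) + 54 * k ^ 3        ≤⟨ ℕₚ.+-monoˡ-≤ (54 * k ^ 3) (ℕₚ.*-monoʳ-≤ 27 (ℕₚ.≤-trans (skew-≤-C (3 * m)) (ℕₚ.+-monoʳ-≤ (2 * S) (ℕₚ.*-monoʳ-≤ 6 hL)))) ⟩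
      27 * (2 * S + 6 * (K * k ^ 3)) + 54 * k ^ 3 ≤⟨ ℕₚ.m≤m+n _ (513 * k ^ 3) ⟩
      27 * (2 * S + 6 * (K * k ^ 3)) + 54 * k ^ 3 + 513 * k ^ 3 ≡⟨ e₄ S K (k ^ 3) ⟩
      54 * S + (162 * K + 567) * k ^ 3           ∎
      where
      e₁ : ∀ q s → 38 * q + s ≡ 27 * q + (11 * q + s)
      e₁ = solve-∀
      e₂ : ∀ q G → 27 * q + 81 * (6 * G) ≡ 27 * q + 54 * (9 * G)
      e₂ = solve-∀
      e₃ : ∀ q N c → 27 * q + 54 * (N + c) ≡ 27 * (q + 2 * N) + 54 * c
      e₃ = solve-∀
      e₄ : ∀ S K c → 27 * (2 * S + 6 * (K * c)) + 54 * c + 513 * c ≡ 54 * S + (162 * K + 567) * c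
      e₄ = solve-∀

shift⁴ : ∀ n → 1 ≤ n → (n + 6) ^ 4 ≤ n ^ 4 + 2400 * n ^ 3
shift⁴ n@(suc k) _ = begin
  (n + 6) ^ 4 ≡⟨ expand n ⟩
  n ^ 4 + (24 * n ^ 3 + 216 * (n * n) + 864 * n + 1296) ≤⟨ ℕₚ.+-monoʳ-≤ (n ^ 4) (ℕₚ.+-mono-≤ (ℕₚ.+-mono-≤ (ℕₚ.+-monoʳ-≤ (24 * n ^ 3)
    (ℕₚ.*-monoʳ-≤ 216 (n²≤n³ n))) (ℕₚ.*-monoʳ-≤ 864 n≤n³)) (ℕₚ.*-monoʳ-≤ 1296 (ℕₚ.≤-trans (s≤s z≤n) n≤n³))) ⟩
  n ^ 4 + (24 * n ^ 3 + 216 * n ^ 3 + 864 * n ^ 3 + 1296 * n ^ 3) ≡⟨ collect (n ^ 4) (n ^ 3) ⟩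
  n ^ 4 + 2400 * n ^ 3 ∎
  where
  open ℕₚ.≤-Reasoning
  n≤n³ : n ≤ n ^ 3
  n≤n³ = ℕₚ.≤-trans (ℕₚ.m≤m*n n n) (n²≤n³ n)
  expand : ∀ n → (n + 6) * ((n + 6) * ((n + 6) * ((n + 6) * 1))) ≡
    n * (n * (n * (n * 1))) + (24 * (n * (n * (n * 1))) + 216 * (n * n) + 864 * n + 1296)
  expand = solve-∀
  collect : ∀ q c → q + (24 * c + 216 * c + 864 * c + 1296 * c) ≡ q + 2400 * c
  collect = solve-∀

shift³ : ∀ n → 6 ≤ n → (n + 6) ^ 3 ≤ 8 * n ^ 3
shift³ n 6≤n = ℕₚ.≤-trans (ℕₚ.^-monoˡ-≤ 3 (ℕₚ.+-monoʳ-≤ n 6≤n)) (ℕₚ.≤-reflexive (double n))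
  where
  double : ∀ n → (n + n) * ((n + n) * ((n + n) * 1)) ≡ 8 * (n * (n * (n * 1)))
  double = solve-∀

-- `countC` is monotone, so it is enclosed by its values at the neighbouring multiples of 6. Moving
-- by 6 changes the fourth power by at most 2400 n³, and 91200 is 38 · 2400.
approximation : ∃[ K ] ∀ n → 6 ≤ n → Approx K n
approximation = let K , h = approx-six in 91200 + 8 * K , λ n 6≤n → go K h n 6≤n
  where
  go : ∀ K → (∀ i → Approx K (3 * i * 2)) → ∀ n → 6 ≤ n → Approx (91200 + 8 * K) n
  go K h n 6≤n = approx up low
    where
    open ℕₚ.≤-Reasoning
    i = n ℕ./ 6
    n₀ = 3 * i * 2
    n₁ = 3 * suc i * 2
    six : ∀ i → 3 * i * 2 ≡ i * 6
    six = solve-∀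
    n₁≡ : n₁ ≡ n₀ + 6
    n₁≡ = next i
      where
      next : ∀ i → 3 * (1 + i) * 2 ≡ 3 * i * 2 + 6
      next = solve-∀
    n₀≤n : n₀ ≤ n
    n₀≤n = subst (_≤ n) (sym (six i)) (DivMod.m/n*n≤m n 6)
    n≤n₁ : n ≤ n₁
    n≤n₁ = begin
      n               ≡⟨ DivMod.m≡m%n+[m/n]*n n 6 ⟩
      n % 6 + i * 6   ≤⟨ ℕₚ.+-monoˡ-≤ (i * 6) (ℕₚ.<⇒≤ (DivMod.m%n<n n 6)) ⟩
      6 + i * 6       ≡⟨ trans (ℕₚ.+-comm 6 _) (cong (_+ 6) (sym (six i))) ⟩
      n₀ + 6          ≡⟨ sym n₁≡ ⟩
      n₁              ∎
    n₁≤ : n₁ ≤ n + 6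
    n₁≤ = subst (_≤ n + 6) (sym n₁≡) (ℕₚ.+-monoˡ-≤ 6 n₀≤n)
    6≤n₀ : 6 ≤ n₀
    6≤n₀ = subst (6 ≤_) (sym (six i)) (ℕₚ.*-monoˡ-≤ 6 (DivMod.m≥n⇒m/n>0 6≤n))
    up : 54 * countC n ≤ 38 * n ^ 4 + (91200 + 8 * K) * n ^ 3
    up = begin
      54 * countC n                     ≤⟨ ℕₚ.*-monoʳ-≤ 54 (∑⁴-extend cC n≤n₁) ⟩
      54 * countC n₁                    ≤⟨ Approx.upper (h (suc i)) ⟩
      38 * n₁ ^ 4 + K * n₁ ^ 3          ≤⟨ ℕₚ.+-mono-≤ (ℕₚ.*-monoʳ-≤ 38 (ℕₚ.^-monoˡ-≤ 4 n₁≤)) (ℕₚ.*-monoʳ-≤ K (ℕₚ.^-monoˡ-≤ 3 n₁≤)) ⟩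
      38 * (n + 6) ^ 4 + K * (n + 6) ^ 3 ≤⟨ ℕₚ.+-mono-≤ (ℕₚ.*-monoʳ-≤ 38 (shift⁴ n (ℕₚ.≤-trans (s≤s z≤n) 6≤n))) (ℕₚ.*-monoʳ-≤ K (shift³ n 6≤n)) ⟩
      38 * (n ^ 4 + 2400 * n ^ 3) + K * (8 * n ^ 3) ≡⟨ e (n ^ 4) (n ^ 3) K ⟩
      38 * n ^ 4 + (91200 + 8 * K) * n ^ 3 ∎
      where
      e : ∀ q c K → 38 * (q + 2400 * c) + K * (8 * c) ≡ 38 * q + (91200 + 8 * K) * c
      e = solve-∀
    low : 38 * n ^ 4 ≤ 54 * countC n + (91200 + 8 * K) * n ^ 3
    low = begin
      38 * n ^ 4                        ≤⟨ ℕₚ.*-monoʳ-≤ 38 (ℕₚ.^-monoˡ-≤ 4 (subst (n ≤_) n₁≡ n≤n₁)) ⟩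
      38 * (n₀ + 6) ^ 4                 ≤⟨ ℕₚ.*-monoʳ-≤ 38 (shift⁴ n₀ (ℕₚ.≤-trans (s≤s z≤n) 6≤n₀)) ⟩
      38 * (n₀ ^ 4 + 2400 * n₀ ^ 3)     ≡⟨ ℕₚ.*-distribˡ-+ 38 (n₀ ^ 4) (2400 * n₀ ^ 3) ⟩
      38 * n₀ ^ 4 + 38 * (2400 * n₀ ^ 3) ≤⟨ ℕₚ.+-monoˡ-≤ _ (Approx.lower (h i)) ⟩
      54 * countC n₀ + K * n₀ ^ 3 + 38 * (2400 * n₀ ^ 3) ≡⟨ e (54 * countC n₀) K (n₀ ^ 3) ⟩
      54 * countC n₀ + (91200 + K) * n₀ ^ 3 ≤⟨ ℕₚ.+-mono-≤ (ℕₚ.*-monoʳ-≤ 54 (∑⁴-extend cC n₀≤n))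
                                            (ℕₚ.*-mono-≤ (ℕₚ.+-monoʳ-≤ 91200 (ℕₚ.m≤n*m K 8)) (ℕₚ.^-monoˡ-≤ 3 n₀≤n)) ⟩
      54 * countC n + (91200 + 8 * K) * n ^ 3 ∎
      where
      e : ∀ s K c → s + K * c + 38 * (2400 * c) ≡ s + (91200 + K) * c
      e = solve-∀

-- Pairs in general position

few : ∀ p q → p < q → T (((q ∸ p ∸ 1) % 2 ≡ᵇ 1) ∨ (2 * p <ᵇ (q ∸ p ∸ 1) + 4)) → Few p q
few p q p<q t with parity (q ∸ suc p)
... | inj₂ (k , eq) = inj₁ (k , trans (sym (ℕₚ.m+[n∸m]≡n p<q)) (trans (cong (suc p +_) eq) (shift p k)))
  where
  shift : ∀ p k → 1 + p + (1 + 2 * k) ≡ p + 2 + 2 * k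
  shift = solve-∀
... | inj₁ (k , eq) = inj₂ (k , trans (sym (ℕₚ.m+[n∸m]≡n p<q)) (cong₂ _+_ (ℕₚ.+-comm 1 p) eq) , short)
  where
  gain≡ : q ∸ p ∸ 1 ≡ 2 * k
  gain≡ = trans (ℕₚ.∸-+-assoc q p 1) (trans (cong (q ∸_) (ℕₚ.+-comm p 1)) eq)
  short : p ≤ k + 1
  short with Equivalence.to (T-∨ {(q ∸ p ∸ 1) % 2 ≡ᵇ 1}) t
  ... | inj₁ t₁ = ⊥-elim (ℕₚ.0≢1+n (trans (sym (trans (cong (_% 2) (trans gain≡ (ℕₚ.*-comm 2 k))) (DivMod.m*n%n≡0 k 2)))
                    (ℕₚ.≡ᵇ⇒≡ ((q ∸ p ∸ 1) % 2) 1 t₁)))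
  ... | inj₂ t₂ = arith (Goal 3 λ p k g → 2 :* p :< g :+ con 4 :⇒ g :≡ 2 :* k :⇒ p :≤ k :+ con 1) tt
                    (p ∷ k ∷ q ∸ p ∸ 1 ∷ []) (ℕₚ.<ᵇ⇒< (2 * p) _ t₂) gain≡

C-few : (E F : V n) → dx E F ≢ dy E F → T (eventC E F) → Few (dx E F ⊓ dy E F) (dx E F ℕ.⊔ dy E F)
C-few E F p≢q t with ℕₚ.<-cmp (dx E F) (dy E F)
... | tri≈ _ p≡q _ = ⊥-elim (p≢q p≡q)
... | tri< p<q _ _ rewrite ℕₚ.m≤n⇒m⊓n≡m (ℕₚ.<⇒≤ p<q) | ℕₚ.m≤n⇒m⊔n≡n (ℕₚ.<⇒≤ p<q)
    | ℕₚ.m≤n⇒∣n-m∣≡n∸m (ℕₚ.<⇒≤ p<q) = few (dx E F) (dy E F) p<q t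
... | tri> _ _ q<p rewrite ℕₚ.m≥n⇒m⊓n≡n (ℕₚ.<⇒≤ q<p) | ℕₚ.m≥n⇒m⊔n≡m (ℕₚ.<⇒≤ q<p)
    | ℕₚ.m≤n⇒∣m-n∣≡n∸m (ℕₚ.<⇒≤ q<p) = few (dy E F) (dx E F) q<p t

-- The first eight terms say that a coordinate is 0 or `n - 1`. The others say that a coordinate
-- difference, or the difference of the two, is at most 2, which is the complement of `Generic`.
exceptionTerms : ℕ → ℕ → ℕ → ℕ → ℕ → List ℕ
exceptionTerms n a b c e =
    near 1 1 a 0 0 ∷ near 1 1 a 1 n ∷ near 1 1 b 0 0 ∷ near 1 1 b 1 n
  ∷ near 1 1 c 0 0 ∷ near 1 1 c 1 n ∷ near 1 1 e 0 0 ∷ near 1 1 e 1 n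
  ∷ near 5 1 c 2 a ∷ near 5 1 e 2 b ∷ near 5 1 e (c + 2) (b + a) ∷ near 5 1 e (a + 2) (b + c) ∷ []

exceptions : ℕ → ℕ → ℕ → ℕ → ℕ → ℕ
exceptions n a b c e = sumL id (exceptionTerms n a b c e)

cubic-exceptions : Cubic (λ n → ∑⁴ n (exceptions n))
cubic-exceptions =
  cubic-+ (cubic-a 1 1 (λ _ → 0) (λ _ → 0) 1≤1) (cubic-+ (cubic-a 1 1 (λ _ → 1) (λ n → n) 1≤1)
  (cubic-+ (cubic-b 1 1 (λ _ _ → 0) (λ _ _ → 0) 1≤1) (cubic-+ (cubic-b 1 1 (λ _ _ → 1) (λ n _ → n) 1≤1)
  (cubic-+ (cubic-c 1 1 (λ _ _ _ → 0) (λ _ _ _ → 0) 1≤1) (cubic-+ (cubic-c 1 1 (λ _ _ _ → 1) (λ n _ _ → n) 1≤1)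
  (cubic-+ (cubic-e 1 1 (λ _ _ _ _ → 0) (λ _ _ _ _ → 0) 1≤1) (cubic-+ (cubic-e 1 1 (λ _ _ _ _ → 1) (λ n _ _ _ → n) 1≤1)
  (cubic-+ (cubic-c 5 1 (λ _ _ _ → 2) (λ _ a _ → a) 1≤1) (cubic-+ (cubic-e 5 1 (λ _ _ _ _ → 2) (λ _ _ b _ → b) 1≤1)
  (cubic-+ (cubic-e 5 1 (λ _ _ _ c → c + 2) (λ _ a b _ → b + a) 1≤1) (cubic-+ (cubic-e 5 1 (λ _ a _ _ → a + 2) (λ _ _ b c → b + c) 1≤1)
  cubic-0)))))))))))
  where
  1≤1 : 1 ≤ 1
  1≤1 = s≤s z≤n

exceptional : V n → V n → ℕ
exceptional {n} (x , y) (x′ , y′) = exceptions n (toℕ x) (toℕ y) (toℕ x′) (toℕ y′)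

not-low = arith (Goal 1 λ a → (con 0 :≤ 1 :* a :+ con 0 :⇒ 1 :* a :+ con 0 :< con 0 :+ con 1 :⇒ :⊥) :⇒ con 1 :≤ a) tt

not-high = arith (Goal 3 λ a W n → (n :≤ 1 :* a :+ con 1 :⇒ 1 :* a :+ con 1 :< n :+ con 1 :⇒ :⊥) :⇒ a :≤ W :⇒ n :≡ con 1 :+ W :⇒ a :< W) tt

apart = arith (Goal 2 λ a c → (a :≤ 1 :* c :+ con 2 :⇒ 1 :* c :+ con 2 :< a :+ con 5 :⇒ :⊥) :⇒ con 3 :≤ ∣ a :- c ∣) tt

uneven = arith (Goal 4 λ a b c e →
  (b :+ a :≤ 1 :* e :+ (c :+ con 2) :⇒ 1 :* e :+ (c :+ con 2) :< b :+ a :+ con 5 :⇒ :⊥) :⇒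
  (b :+ c :≤ 1 :* e :+ (a :+ con 2) :⇒ 1 :* e :+ (a :+ con 2) :< b :+ c :+ con 5 :⇒ :⊥) :⇒
  con 3 :≤ ∣ ∣ b :- e ∣ :- ∣ a :- c ∣ ∣) tt

generic-position : (E F : V (suc w)) → exceptional E F ≡ 0 → Interior E × Interior F × Generic E F
generic-position {w} (x , y) (x′ , y′) h with sumL-zero (exceptionTerms (suc w) (toℕ x) (toℕ y) (toℕ x′) (toℕ y′)) h
... | a₀ ∷ a₁ ∷ b₀ ∷ b₁ ∷ c₀ ∷ c₁ ∷ e₀ ∷ e₁ ∷ ac ∷ be ∷ g₁ ∷ g₂ ∷ [] =
  ((low x a₀ , high x a₁) , (low y b₀ , high y b₁)) , ((low x′ c₀ , high x′ c₁) , (low y′ e₀ , high y′ e₁)) ,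
  apart (toℕ x ∷ toℕ x′ ∷ []) (near-zero 5 1 (toℕ x′) 2 (toℕ x) ac) , apart (toℕ y ∷ toℕ y′ ∷ []) (near-zero 5 1 (toℕ y′) 2 (toℕ y) be) ,
  uneven (toℕ x ∷ toℕ y ∷ toℕ x′ ∷ toℕ y′ ∷ []) (near-zero 5 1 (toℕ y′) _ _ g₁) (near-zero 5 1 (toℕ y′) _ _ g₂)
  where
  low : (z : Fin (suc w)) → near 1 1 (toℕ z) 0 0 ≡ 0 → 1 ≤ toℕ z
  low z h = not-low (toℕ z ∷ []) (near-zero 1 1 (toℕ z) 0 0 h)
  high : (z : Fin (suc w)) → near 1 1 (toℕ z) 1 (suc w) ≡ 0 → toℕ z < toℕ (fromℕ w)
  high z h = not-high (toℕ z ∷ toℕ (fromℕ w) ∷ suc w ∷ []) (near-zero 1 1 (toℕ z) 1 (suc w) h) (toℕ≤ z) (cong suc (sym (Finₚ.toℕ-fromℕ w)))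

β'-generic : (E F : V (suc w)) → exceptional E F ≡ 0 → 3 ≤ β' E F × β' E F ≤ 4 × (T (eventC E F) → β' E F ≤ 3)
β'-generic {w} E@(x , y) F@(x′ , y′) h = let iE , iF , gen@(g₁ , g₂ , g₃) = generic-position E F h
                                             1≤p = ℕₚ.≤-trans (s≤s z≤n) g₁
                                             1≤q = subst (1 ≤_) (ℕₚ.∣-∣-comm (toℕ y) (toℕ y′)) (ℕₚ.≤-trans (s≤s z≤n) g₂)
                                             p≢q = λ eq → ℕₚ.<⇒≱ (ℕₚ.≤-trans (s≤s z≤n) g₃) (ℕₚ.≤-reflexive
                                               (ℕₚ.m≡n⇒∣m-n∣≡0 (trans (ℕₚ.∣-∣-comm (toℕ y) (toℕ y′)) (sym eq))))
                                             (R , l , res) , r₃ = bound E F 1≤p 1≤q p≢q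
                                         in
  β'-≥3 E F (s≤s (ℕₚ.≤-trans (proj₁ (proj₁ iE)) (Finₚ.toℕ≤pred[n] x))) (unresolvable E F iE iF gen) ,
  ℕₚ.≤-trans (β'-≤ E F R res) l ,
  λ t → let R′ , l′ , res′ = r₃ (C-few E F p≢q t) in ℕₚ.≤-trans (β'-≤ E F R′ res′) l′

ι-∧ : ∀ {b b′} → T b → ι (b ∧ b′) ≡ ι b′
ι-∧ {true} _ = refl

-- The value β stands for β' E F, which must not be unfolded.
three-or-four : ∀ β x {Q : Set} → (x ≡ 0 → 3 ≤ β × β ≤ 4 × Q) → 1 ≤ ι ((β ≡ᵇ 3) ∨ (β ≡ᵇ 4)) + x
three-or-four β (suc x) h = ℕₚ.≤-trans (s≤s z≤n) (ℕₚ.m≤n+m (suc x) _)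
three-or-four β zero    h = let lo , hi , _ = h refl in subst (1 ≤_) (sym (ℕₚ.+-identityʳ _)) (range β lo hi)
  where
  range : ∀ β → 3 ≤ β → β ≤ 4 → 1 ≤ ι ((β ≡ᵇ 3) ∨ (β ≡ᵇ 4))
  range 1 (s≤s ()) _
  range 2 (s≤s (s≤s ())) _
  range 3 _ _ = ℕₚ.≤-refl
  range 4 _ _ = ℕₚ.≤-refl
  range (suc (suc (suc (suc (suc _))))) _ (s≤s (s≤s (s≤s (s≤s ()))))

three-on-event : ∀ β x c → (x ≡ 0 → 3 ≤ β × β ≤ 4 × (T c → β ≤ 3)) → ι c ≤ ι ((β ≡ᵇ 3) ∧ c) + x
three-on-event β (suc x) c     h = ℕₚ.≤-trans (ι-≤1 c) (ℕₚ.≤-trans (s≤s z≤n) (ℕₚ.m≤n+m (suc x) _))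
three-on-event β zero    false h = z≤n
three-on-event β zero    true  h = let lo , _ , hi = h refl in
  ℕₚ.≤-reflexive (sym (trans (ℕₚ.+-identityʳ _) (ι-∧ (ℕₚ.≡⇒≡ᵇ β 3 (ℕₚ.≤-antisym (hi tt) lo)))))

β34-or-exceptional : (E F : V n) → 1 ≤ ι (eventβ34 E F) + exceptional E F
β34-or-exceptional {suc w} E F = three-or-four (β' E F) (exceptional E F) (β'-generic E F)

C-or-exceptional : (E F : V n) → ι (eventC E F) ≤ ι ((β' E F ≡ᵇ 3) ∧ eventC E F) + exceptional E F
C-or-exceptional {suc w} E F = three-on-event (β' E F) (exceptional E F) (eventC E F) (β'-generic E F)

cubic-exceptional : ∃[ K ] ∀ n → total n exceptional ≤ K * n ^ 3
cubic-exceptional = let K , h = cubic-exceptions in K , λ n →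
  ℕₚ.≤-trans (ℕₚ.≤-reflexive (total-∑⁴ n exceptional (exceptions n) λ _ _ _ _ → refl)) (h n)

total-1 : ∀ n → total n (λ _ _ → 1) ≡ n ^ 4
total-1 n = trans (total-∑⁴ n _ (λ _ _ _ _ → 1) λ _ _ _ _ → refl) (∑⁴-1 n)

count-C : ∀ n → count n eventC ≡ countC n
count-C n = trans (count-total n eventC) (total-∑⁴ n _ cC λ _ _ _ _ → refl)

count-≤ : ∀ n (P Q : V n → V n → Bool) (f : V n → V n → ℕ) → (∀ E F → ι (P E F) ≤ ι (Q E F) + f E F) →
  count n P ≤ count n Q + total n f
count-≤ n P Q f h = begin
  count n P                                     ≡⟨ count-total n P ⟩
  total n (λ E F → ι (P E F))                   ≤⟨ total-mono h ⟩
  total n (λ E F → ι (Q E F) + f E F)           ≡⟨ total-+ n (λ E F → ι (Q E F)) f ⟩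
  total n (λ E F → ι (Q E F)) + total n f       ≡⟨ cong (_+ total n f) (sym (count-total n Q)) ⟩
  count n Q + total n f                         ∎
  where open ℕₚ.≤-Reasoning

count-≤-n⁴ : ∀ n (P : V n → V n → Bool) → count n P ≤ n ^ 4
count-≤-n⁴ n P = subst₂ _≤_ (sym (count-total n P)) (total-1 n) (total-mono λ E F → ι-≤1 (P E F))

-- Limits

module Limits where

  open import Data.Integer as ℤ using (ℤ; +_; -[1+_])
  import Data.Integer.Properties as ℤₚ
  open import Data.Rational as ℚ using (ℚ; mkℚ)
  import Data.Rational.Properties as ℚₚ
  import Algebra.Properties.Group as GroupProperties
  open import Data.Rational.Unnormalised as ℚᵘ using (mkℚᵘ)
  import Data.Rational.Unnormalised.Properties as ℚᵘₚ

  fraction-< : ∀ (a b p q e f : ℕ) → a * (suc q * suc f) < (p * suc f + e * suc q) * suc b →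
    mkℚᵘ (+ a) b ℚᵘ.< mkℚᵘ (+ p) q ℚᵘ.+ mkℚᵘ (+ e) f
  fraction-< a b p q e f h = ℚᵘ.*<* (subst₂ ℤ._<_ (ℤₚ.pos-* a _) (trans (ℤₚ.pos-* (p * suc f + e * suc q) (suc b))
    (cong (ℤ._* + suc b) (trans (ℤₚ.pos-+ (p * suc f) (e * suc q)) (cong₂ ℤ._+_ (ℤₚ.pos-* p (suc f)) (ℤₚ.pos-* e (suc q))))))
    (ℤ.+<+ h))

  <-+⇒-< : ∀ {x y z} → x ℚ.< y ℚ.+ z → x ℚ.- y ℚ.< z
  <-+⇒-< {x} {y} {z} h = subst (x ℚ.- y ℚ.<_) (trans (cong (ℚ._- y) (ℚₚ.+-comm y z))
    (trans (ℚₚ.+-assoc z y (ℚ.- y)) (trans (cong (z ℚ.+_) (ℚₚ.+-inverseʳ y)) (ℚₚ.+-identityʳ z)))) (ℚₚ.+-monoˡ-< (ℚ.- y) h)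

  neg-difference : ∀ x y → ℚ.- (x ℚ.- y) ≡ y ℚ.- x
  neg-difference x y = trans (ℚₚ.neg-distrib-+ x (ℚ.- y)) (trans (cong (ℚ.- x ℚ.+_) (GroupProperties.⁻¹-involutive ℚₚ.+-0-group y)) (ℚₚ.+-comm (ℚ.- x) y))

  ∣-∣-< : ∀ {x y z} → x ℚ.< y ℚ.+ z → y ℚ.< x ℚ.+ z → ℚ.∣ x ℚ.- y ∣ ℚ.< z
  ∣-∣-< {x} {y} {z} h h′ with ℚₚ.∣p∣≡p∨∣p∣≡-p (x ℚ.- y)
  ... | inj₁ eq = subst (ℚ._< z) (sym eq) (<-+⇒-< {x} {y} {z} h)
  ... | inj₂ eq = subst (ℚ._< z) (sym (trans eq (neg-difference x y))) (<-+⇒-< {y} {x} {z} h′)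

  fromℚᵘ-< : ∀ x y (ε : ℚ) → x ℚᵘ.< y ℚᵘ.+ ℚ.toℚᵘ ε → ℚ.fromℚᵘ x ℚ.< ℚ.fromℚᵘ y ℚ.+ ε
  fromℚᵘ-< x y ε h = ℚₚ.toℚᵘ-cancel-< (ℚᵘₚ.<-respˡ-≃ (ℚᵘₚ.≃-sym (ℚₚ.toℚᵘ-fromℚᵘ x)) (ℚᵘₚ.<-respʳ-≃ (ℚᵘₚ.≃-sym
    (ℚᵘₚ.≃-trans (ℚₚ.toℚᵘ-homo-+ (ℚ.fromℚᵘ y) ε) (ℚᵘₚ.+-congˡ (ℚ.toℚᵘ ε) (ℚₚ.toℚᵘ-fromℚᵘ y)))) h))

  -- A cubic error against a denominator of order n⁴. The bound `n ^ 4 ≤ M * b n` also excludes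
  -- `b n = 0`, where `ratio` takes its default value.
  tendsto-ratio : ∀ (a b : ℕ → ℕ) (p q K M N₀ : ℕ) →
    (∀ n → n ≥ N₀ → suc q * a n ≤ p * b n + K * n ^ 3 × p * b n ≤ suc q * a n + K * n ^ 3 × n ^ 4 ≤ M * b n) →
    Tendsto (λ n → ratio (a n) (b n)) (+ p ℚ./ suc q)
  tendsto-ratio a b p q K M N₀ h (mkℚ (+ zero) f _) (ℚ.*<* (ℤ.+<+ ()))
  tendsto-ratio a b p q K M N₀ h (mkℚ -[1+ e ] f _) (ℚ.*<* ())
  -- Here ε is at least `1 / suc f`, so it suffices that `K * n ^ 3 * suc f` is below `b n`;
  -- `n > M * (K * suc f)` ensures this.
  tendsto-ratio a b p q K M N₀ h ε@(mkℚ (+ suc e) f _) _ = N₀ + suc (M * (K * suc f)) , λ n n≥ → at n n≥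
    where
    at : ∀ n → n ≥ N₀ + suc (M * (K * suc f)) → ℚ.∣ ratio (a n) (b n) ℚ.- (+ p ℚ./ suc q) ∣ ℚ.< ε
    at n n≥ with h n (ℕₚ.≤-trans (ℕₚ.m≤m+n N₀ _) n≥) | ℕₚ.≤-trans (ℕₚ.m≤n+m (suc (M * (K * suc f))) N₀) n≥
    ... | up , low , big | n> with b n
    ...   | zero = ⊥-elim (ℕₚ.<⇒≱ (positive n n>) (subst (n ^ 4 ≤_) (ℕₚ.*-zeroʳ M) big))
      where
      positive : ∀ n → suc (M * (K * suc f)) ≤ n → 0 < n ^ 4
      positive (suc n) _ = ℕₚ.m^n>0 (suc n) 4
    ...   | suc b′ = ∣-∣-< {+ a n ℚ./ suc b′} {+ p ℚ./ suc q} {ε}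
        (fromℚᵘ-< (mkℚᵘ (+ a n) b′) (mkℚᵘ (+ p) q) ε (fraction-< (a n) b′ p q (suc e) f above))
        (fromℚᵘ-< (mkℚᵘ (+ p) q) (mkℚᵘ (+ a n) b′) ε (fraction-< p q (a n) b′ (suc e) f below))
      where
      open ℕₚ.≤-Reasoning
      error : K * n ^ 3 * suc f < suc b′
      error = ℕₚ.*-cancelˡ-< M _ _ (begin-strict
        M * (K * n ^ 3 * suc f)   ≡⟨ e₁ M K (n ^ 3) (suc f) ⟩
        M * (K * suc f) * n ^ 3   <⟨ ℕₚ.*-monoˡ-< (n ^ 3) ⦃ ℕₚ.m^n≢0 n 3 ⦃ ℕ.>-nonZero (ℕₚ.≤-trans (s≤s z≤n) n>) ⦄ ⦄ n> ⟩
        n * n ^ 3                 ≤⟨ big ⟩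
        M * suc b′                ∎)
        where
        e₁ : ∀ M K c f → M * (K * c * f) ≡ M * (K * f) * c
        e₁ = solve-∀
      slack : K * n ^ 3 * suc f < suc e * suc q * suc b′
      slack = ℕₚ.<-≤-trans error (ℕₚ.m≤n*m (suc b′) (suc e * suc q))
      above : a n * (suc q * suc f) < (p * suc f + suc e * suc q) * suc b′
      above = begin-strict
        a n * (suc q * suc f)               ≡⟨ e₁ (a n) (suc q) (suc f) ⟩
        suc q * a n * suc f                 ≤⟨ ℕₚ.*-monoˡ-≤ (suc f) up ⟩
        (p * suc b′ + K * n ^ 3) * suc f    ≡⟨ ℕₚ.*-distribʳ-+ (suc f) (p * suc b′) (K * n ^ 3) ⟩
        p * suc b′ * suc f + K * n ^ 3 * suc f <⟨ ℕₚ.+-monoʳ-< (p * suc b′ * suc f) slack ⟩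
        p * suc b′ * suc f + suc e * suc q * suc b′ ≡⟨ e₂ p (suc b′) (suc f) (suc e * suc q) ⟩
        (p * suc f + suc e * suc q) * suc b′ ∎
        where
        e₁ : ∀ a q f → a * (q * f) ≡ q * a * f
        e₁ = solve-∀
        e₂ : ∀ p b f r → p * b * f + r * b ≡ (p * f + r) * b
        e₂ = solve-∀
      below : p * (suc b′ * suc f) < (a n * suc f + suc e * suc b′) * suc q
      below = begin-strict
        p * (suc b′ * suc f)                ≡⟨ sym (ℕₚ.*-assoc p (suc b′) (suc f)) ⟩
        p * suc b′ * suc f                  ≤⟨ ℕₚ.*-monoˡ-≤ (suc f) low ⟩
        (suc q * a n + K * n ^ 3) * suc f   ≡⟨ ℕₚ.*-distribʳ-+ (suc f) (suc q * a n) (K * n ^ 3) ⟩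
        suc q * a n * suc f + K * n ^ 3 * suc f <⟨ ℕₚ.+-monoʳ-< (suc q * a n * suc f) slack ⟩
        suc q * a n * suc f + suc e * suc q * suc b′ ≡⟨ e₂ (suc q) (a n) (suc f) (suc e) (suc b′) ⟩
        (a n * suc f + suc e * suc b′) * suc q ∎
        where
        e₂ : ∀ q a f e b → q * a * f + e * q * b ≡ (a * f + e * b) * q
        e₂ = solve-∀

open Limits using (tendsto-ratio)

ι-∧-≤ : ∀ b {b′} → ι (b ∧ b′) ≤ ι b′
ι-∧-≤ true  = ℕₚ.≤-refl
ι-∧-≤ false = z≤n

total-0 : ∀ n → total n (λ _ _ → 0) ≡ 0
total-0 n = trans (sumL-cong (λ E → zeros (verts n)) (verts n)) (zeros (verts n))
  where
  zeros : {A : Set} (xs : List A) → sumL (λ _ → 0) xs ≡ 0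
  zeros []       = refl
  zeros (x ∷ xs) = zeros xs

count-β34 : ∀ n → n ^ 4 ≤ count n eventβ34 + total n exceptional
count-β34 n = begin
  n ^ 4                                                      ≡⟨ sym (total-1 n) ⟩
  total n (λ _ _ → 1)                                        ≤⟨ total-mono {n} {λ _ _ → 1} {λ E F → ι (eventβ34 E F) + exceptional E F} β34-or-exceptional ⟩
  total n (λ E F → ι (eventβ34 E F) + exceptional E F)       ≡⟨ total-+ n (λ E F → ι (eventβ34 E F)) exceptional ⟩
  total n (λ E F → ι (eventβ34 E F)) + total n exceptional   ≡⟨ cong (_+ total n exceptional) (sym (count-total n eventβ34)) ⟩
  count n eventβ34 + total n exceptional                     ∎
  where open ℕₚ.≤-Reasoning

count-β3∧C-≤ : ∀ n → count n eventβ3∧C ≤ count n eventC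
count-β3∧C-≤ n = begin
  count n eventβ3∧C                       ≤⟨ count-≤ n eventβ3∧C eventC (λ _ _ → 0) (λ E F → ℕₚ.≤-trans (ι-∧-≤ (β' E F ≡ᵇ 3)) (ℕₚ.m≤m+n (ι (eventC E F)) 0)) ⟩
  count n eventC + total n (λ _ _ → 0)    ≡⟨ cong (λ z → count n eventC + z) (total-0 n) ⟩
  count n eventC + 0                      ≡⟨ ℕₚ.+-identityʳ (count n eventC) ⟩
  count n eventC                          ∎
  where open ℕₚ.≤-Reasoning

open import Data.Integer using (+_)
open import Data.Rational using (ℚ; _/_; 1ℚ)

theorem3 : Tendsto (λ n → prob n eventβ34) 1ℚ
    × Tendsto (λ n → condProb n (λ E F → β' E F ≡ᵇ 3) eventC) 1ℚ
    × Tendsto (λ n → prob n eventC) ((+ 19) / 27)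
theorem3 = almost-surely , conditionally , probability-C
  where
  K L : ℕ
  K = proj₁ cubic-exceptional
  L = proj₁ approximation
  rare : ∀ n → total n exceptional ≤ K * n ^ 3
  rare = proj₂ cubic-exceptional
  near-C : ∀ n → 6 ≤ n → Approx L n
  near-C = proj₂ approximation

  once′ : ∀ x y z → x ≤ y + z → 1 * x ≤ 1 * y + z
  once′ x y z = subst₂ _≤_ (sym (ℕₚ.*-identityˡ x)) (cong (_+ z) (sym (ℕₚ.*-identityˡ y)))

  almost-surely = tendsto-ratio (λ n → count n eventβ34) (_^ 4) 1 0 K 1 0 λ n _ →
    once′ (count n eventβ34) (n ^ 4) (K * n ^ 3) (ℕₚ.≤-trans (count-≤-n⁴ n eventβ34) (ℕₚ.m≤m+n (n ^ 4) _)) ,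
    once′ (n ^ 4) (count n eventβ34) (K * n ^ 3) (ℕₚ.≤-trans (count-β34 n) (ℕₚ.+-monoʳ-≤ (count n eventβ34) (rare n))) ,
    ℕₚ.≤-reflexive (sym (ℕₚ.*-identityˡ (n ^ 4)))

  C-large : ∀ n → n ≥ 6 + L → n ^ 4 ≤ 2 * count n eventC
  C-large n n≥ = ℕₚ.*-cancelˡ-≤ 37 (ℕₚ.+-cancelʳ-≤ (n ^ 4) _ _ (begin
    37 * n ^ 4 + n ^ 4                  ≡⟨ e₁ (n ^ 4) ⟩
    38 * n ^ 4                          ≤⟨ Approx.lower (near-C n (ℕₚ.≤-trans (ℕₚ.m≤m+n 6 L) n≥)) ⟩
    -- One of the 38 fourth powers absorbs the error, as `L ≤ n`. The remaining proportion 37/54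
    -- exceeds 1/2, so 54 may be raised to 74 = 2 · 37.
    54 * countC n + L * n ^ 3           ≤⟨ ℕₚ.+-mono-≤ (ℕₚ.*-monoˡ-≤ (countC n) (ℕₚ.m≤m+n 54 20)) (ℕₚ.*-monoˡ-≤ (n ^ 3) (ℕₚ.≤-trans (ℕₚ.m≤n+m L 6) n≥)) ⟩
    74 * countC n + n ^ 4               ≡⟨ cong (_+ n ^ 4) (trans (e₂ (countC n)) (cong (λ z → 37 * (2 * z)) (sym (count-C n)))) ⟩
    37 * (2 * count n eventC) + n ^ 4   ∎))
    where
    open ℕₚ.≤-Reasoning
    e₁ : ∀ q → 37 * q + q ≡ 38 * q
    e₁ = solve-∀
    e₂ : ∀ c → 74 * c ≡ 37 * (2 * c)
    e₂ = solve-∀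

  conditionally = tendsto-ratio (λ n → count n eventβ3∧C) (λ n → count n eventC) 1 0 K 2 (6 + L) λ n n≥ →
    once′ (count n eventβ3∧C) (count n eventC) (K * n ^ 3) (ℕₚ.≤-trans (count-β3∧C-≤ n) (ℕₚ.m≤m+n (count n eventC) _)) ,
    once′ (count n eventC) (count n eventβ3∧C) (K * n ^ 3)
      (ℕₚ.≤-trans (count-≤ n eventC eventβ3∧C exceptional C-or-exceptional) (ℕₚ.+-monoʳ-≤ (count n eventβ3∧C) (rare n))) ,
    C-large n n≥

  probability-C = tendsto-ratio (λ n → count n eventC) (_^ 4) 19 26 L 1 6 λ n n≥ →
    halve _ _ (begin
      2 * (27 * count n eventC)           ≡⟨ trans (e₁ (count n eventC)) (cong (54 *_) (count-C n)) ⟩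
      54 * countC n                       ≤⟨ Approx.upper (near-C n n≥) ⟩
      -- Doubling the error makes every term even, so that the inequality can be halved.
      38 * n ^ 4 + L * n ^ 3              ≤⟨ ℕₚ.+-monoʳ-≤ (38 * n ^ 4) (ℕₚ.m≤n*m (L * n ^ 3) 2) ⟩
      38 * n ^ 4 + 2 * (L * n ^ 3)        ≡⟨ e₂ (n ^ 4) (L * n ^ 3) ⟩
      2 * (19 * n ^ 4 + L * n ^ 3)        ∎) ,
    halve _ _ (begin
      2 * (19 * n ^ 4)                    ≡⟨ e₃ (n ^ 4) ⟩
      38 * n ^ 4                          ≤⟨ Approx.lower (near-C n n≥) ⟩
      54 * countC n + L * n ^ 3           ≤⟨ ℕₚ.+-mono-≤ (ℕₚ.≤-reflexive (cong (54 *_) (sym (count-C n)))) (ℕₚ.m≤n*m (L * n ^ 3) 2) ⟩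
      54 * count n eventC + 2 * (L * n ^ 3) ≡⟨ e₄ (count n eventC) (L * n ^ 3) ⟩
      2 * (27 * count n eventC + L * n ^ 3) ∎) ,
    ℕₚ.≤-reflexive (sym (ℕₚ.*-identityˡ (n ^ 4)))
    where
    open ℕₚ.≤-Reasoning
    halve : ∀ x y → 2 * x ≤ 2 * y → x ≤ y
    halve x y = ℕₚ.*-cancelˡ-≤ 2
    e₁ : ∀ c → 2 * (27 * c) ≡ 54 * c
    e₁ = solve-∀
    e₂ : ∀ q l → 38 * q + 2 * l ≡ 2 * (19 * q + l)
    e₂ = solve-∀
    e₃ : ∀ q → 2 * (19 * q) ≡ 38 * q
    e₃ = solve-∀
    e₄ : ∀ c l → 54 * c + 2 * l ≡ 2 * (27 * c + l)
    e₄ = solve-∀
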